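{- Let $n\in\mathbb N$, let $x_1,\ldots,x_n,y_1,\ldots,y_n,z_0$ be non-zero parameters (writing $\overline{w}=w^{ -1}$), and let $\lambda$ be a strict partition with exactly $n$ non-zero parts. For $1\le k,\ell\le n$ put $$f_{k,\ell}(q_\ell)=\frac{u_kq_\ell}{1-x_kq_\ell}\prod_{i=k+1}^n\frac{1+y_iq_\ell}{1-x_iq_\ell}\cdot\frac{1+\overline{z}_0q_\ell}{1-z_0q_\ell}\cdot\prod_{i=1}^n\frac{1+\overline{x}_iq_\ell}{1-\overline{y}_iq_\ell},\qquad g_{k,\ell}(q_\ell)=\frac{q_\ell}{1-\overline{y}_kq_\ell}\prod_{i=1}^{k-1}\frac{1+\overline{x}_iq_\ell}{1-\overline{y}_iq_\ell},$$ where $u_k=z_0x_k\prod_{i=k+1}^n x_i\overline{y}_i$, and $h_{k,\ell}(q_\ell)=f_{k,\ell}(q_\ell)+(-1)^{n-k}g_{k,\ell}(q_\ell)$. Then $$\sum_{P\in\mathcal P^\lambda(2n+1)}\mathrm{wgt}(P)=[q^\lambda]\det_{1\le k,\ell\le n}\big(h_{k,\ell}(q_\ell)\big),$$ where $[q^\lambda]$ denotes the coefficient of $q_1^{\lambda_1}q_2^{\lambda_2}\cdots q_n^{\lambda_n}$ in the expansion as a formal power series in $q_1,\ldots,q_n$.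
   Context: Consider the totally ordered alphabet $1'<1<2'<2<\cdots<n'<n<0'<0<\overline{n}'<\overline{n}<\cdots<\overline{2}'<\overline{2}<\overline{1}'<\overline{1}$; letters with a prime are "primed", the others "unprimed". For a strict partition $\lambda=(\lambda_1>\cdots>\lambda_n>0)$ the shifted diagram consists of boxes $(i,j)$ with $1\le i\le n$, $i\le j\le i+\lambda_i-1$; the boxes $(i,i)$ form the main diagonal, and a diagonal is a set of boxes with $j-i$ fixed. $\mathcal P^\lambda(2n+1)$ is the set of fillings $P$ of the shifted diagram by letters of the alphabet such that: entries weakly increase along rows (left to right) and down columns; entries strictly increase along diagonals (from $(i,j)$ to $(i+1,j+1)$); no two equal primed letters lie in the same row; no two equal unprimed letters lie in the same column; all main-diagonal entries are unprimed and for each $k=1,\ldots,n$ exactly one of $k,\overline{k}$ appears on the main diagonal. The weight is $\mathrm{wgt}(P)=\prod_{e\in P}\mathrm{wgt}(e)$ where: a main-diagonal entry $k$ has weight $z_0x_k\prod_{j>k}x_j\overline{y}_j$ and a main-diagonal entry $\overline{k}$ has weight $1$; off the main diagonal, $k\mapsto x_k$, $k'\mapsto y_k$, $\overline{k}\mapsto\overline{y}_k$, $\overline{k}'\mapsto\overline{x}_k$, $0\mapsto z_0$, $0'\mapsto\overline{z}_0$. -}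

module Defs where

open import Level using (_⊔_)
open import Function using (_∘_)
open import Algebra.Bundles using (CommutativeRing)
open import Data.Nat as ℕ using (ℕ; zero; suc; _∸_; _≤ᵇ_; _<ᵇ_; _≡ᵇ_)
open import Data.Fin as Fin using (Fin; zero; suc; toℕ; punchIn)
open import Data.Bool using (Bool; true; false; _∧_; _∨_; not; if_then_else_)
open import Data.Maybe using (Maybe; just; nothing)
open import Data.List as List using (List; []; _∷_; _++_; foldr; concatMap; filterᵇ; allFin)
open import Data.Vec as Vec using (Vec; []; _∷_)
open import Data.Product using (_×_)

allBelow : (m : ℕ) → (ℕ → Bool) → Bool
allBelow zero    p = true
allBelow (suc m) p = allBelow m p ∧ p m

allFinB : (m : ℕ) → (Fin m → Bool) → Bool
allFinB m p = foldr (λ i r → p i ∧ r) true (allFin m)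

countFin : (m : ℕ) → (Fin m → Bool) → ℕ
countFin m p = List.length (filterᵇ p (allFin m))

vget : ∀ {A : Set} {k} → Vec A k → ℕ → Maybe A
vget []       _       = nothing
vget (a ∷ as) zero    = just a
vget (a ∷ as) (suc j) = vget as j

allVecs : ∀ {A : Set} → List A → (k : ℕ) → List (Vec A k)
allVecs L zero    = [] ∷ []
allVecs L (suc k) = concatMap (λ a → List.map (a ∷_) (allVecs L k)) L

consF : ∀ {m} {B : Fin (suc m) → Set} → B zero → ((i : Fin m) → B (suc i)) → (i : Fin (suc m)) → B i
consF b f zero    = b
consF b f (suc i) = f i

allDep : (m : ℕ) (B : Fin m → Set) → ((i : Fin m) → List (B i)) → List ((i : Fin m) → B i)
allDep zero    B L = (λ ()) ∷ []
allDep (suc m) B L =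
  concatMap (λ b → List.map (consF {B = B} b) (allDep m (B ∘ suc) (L ∘ suc))) (L zero)

-- The alphabet 1' < 1 < 2' < 2 < ... < n' < n < 0' < 0 < n̄' < n̄ < ... < 1̄' < 1̄
-- (0-based indices: num k is the letter k+1, bar k is the letter \overline{k+1})

data Base (n : ℕ) : Set where
  num : Fin n → Base n
  zer : Base n
  bar : Fin n → Base n

record Letter (n : ℕ) : Set where
  constructor mkL
  field
    base   : Base n
    primed : Bool
open Letter public

rank : ∀ {n} → Base n → ℕ
rank     (num k) = toℕ k
rank {n} zer     = n
rank {n} (bar k) = n ℕ.+ (n ∸ toℕ k)

key : ∀ {n} → Letter n → ℕ
key (mkL b p) = 2 ℕ.* rank b ℕ.+ (if p then 0 else 1)

_≤L_ _<L_ _=L_ : ∀ {n} → Letter n → Letter n → Bool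
a ≤L b = key a ≤ᵇ key b
a <L b = key a <ᵇ key b
a =L b = key a ≡ᵇ key b

allBases : (n : ℕ) → List (Base n)
allBases n = List.map num (allFin n) ++ (zer ∷ List.map bar (allFin n))

allLetters : (n : ℕ) → List (Letter n)
allLetters n = concatMap (λ b → mkL b true ∷ mkL b false ∷ []) (allBases n)

StrictPartition : (n : ℕ) → (Fin n → ℕ) → Set
StrictPartition n lam = ((i j : Fin n) → i Fin.< j → lam j ℕ.< lam i) × ((i : Fin n) → 0 ℕ.< lam i)

-- Fillings of the shifted diagram.  Row i (0-based) has boxes (i , j) for
-- i ≤ j < i + lam i; P i is the list of its entries from left to right,
-- so the first entry of each row is the main-diagonal box (i , i).

Filling : (n : ℕ) → (Fin n → ℕ) → Set
Filling n lam = (i : Fin n) → Vec (Letter n) (lam i)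

allFillings : (n : ℕ) (lam : Fin n → ℕ) → List (Filling n lam)
allFillings n lam = allDep n (λ i → Vec (Letter n) (lam i)) (λ i → allVecs (allLetters n) (lam i))

entry : ∀ {n lam} → Filling n lam → Fin n → ℕ → Maybe (Letter n)
entry P i j = if toℕ i ≤ᵇ j then vget (P i) (j ∸ toℕ i) else nothing

rel : ∀ {n} → (Letter n → Letter n → Bool) → Maybe (Letter n) → Maybe (Letter n) → Bool
rel r (just a) (just b) = r a b
rel r _        _        = true

module _ {n : ℕ} {lam : Fin n → ℕ} (P : Filling n lam) where

  allBoxes : (Fin n → ℕ → Bool) → Bool
  allBoxes p = allFinB n (λ i → allBelow (lam i) (λ c → p i (toℕ i ℕ.+ c)))

  monotone : Bool
  monotone = allBoxes λ i j →
      rel _≤L_ (entry P i j) (entry P i (suc j))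
    ∧ allFinB n (λ i' → not (toℕ i' ≡ᵇ suc (toℕ i))
                        ∨ (rel _≤L_ (entry P i j) (entry P i' j)
                           ∧ rel _<L_ (entry P i j) (entry P i' (suc j))))

  rowPrimed : Bool
  rowPrimed = allBoxes λ i j → allBoxes λ i' j' →
    not ((toℕ i ≡ᵇ toℕ i') ∧ (j <ᵇ j'))
    ∨ rel (λ a b → not ((a =L b) ∧ primed a)) (entry P i j) (entry P i' j')

  colUnprimed : Bool
  colUnprimed = allBoxes λ i j → allBoxes λ i' j' →
    not ((toℕ i <ᵇ toℕ i') ∧ (j ≡ᵇ j'))
    ∨ rel (λ a b → not ((a =L b) ∧ not (primed a))) (entry P i j) (entry P i' j')

  diagEntry : Fin n → Maybe (Letter n)
  diagEntry i = entry P i (toℕ i)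

  isKorBar : Fin n → Maybe (Letter n) → Bool
  isKorBar k (just (mkL (num k') _)) = toℕ k ≡ᵇ toℕ k'
  isKorBar k (just (mkL (bar k') _)) = toℕ k ≡ᵇ toℕ k'
  isKorBar k _ = false

  diagonalOK : Bool
  diagonalOK =
      allFinB n (λ i → rel (λ a _ → not (primed a)) (diagEntry i) (diagEntry i))
    ∧ allFinB n (λ k → (countFin n (λ i → isKorBar k (diagEntry i)) ≡ᵇ 1))

  valid : Bool
  valid = monotone ∧ rowPrimed ∧ colUnprimed ∧ diagonalOK

module _ {c ℓ} (R : CommutativeRing c ℓ) where
  open CommutativeRing R hiding (zero)

  record Params (n : ℕ) : Set c where
    field
      x y xb yb : Fin n → Carrier
      z0 z0b    : Carrier

  Inverses : ∀ {n} → Params n → Set ℓ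
  Inverses {n} p = ((i : Fin n) → x i * xb i ≈ 1#) × ((i : Fin n) → y i * yb i ≈ 1#) × (z0 * z0b ≈ 1#)
    where open Params p

  prodL : ∀ {A : Set} → List A → (A → Carrier) → Carrier
  prodL L f = foldr (λ a r → f a * r) 1# L

  above below : ∀ {n} → Fin n → List (Fin n)
  above {n} k = filterᵇ (λ i → toℕ k <ᵇ toℕ i) (allFin n)
  below {n} k = filterᵇ (λ i → toℕ i <ᵇ toℕ k) (allFin n)

  module _ {n : ℕ} (p : Params n) where
    open Params p

    u : Fin n → Carrier
    u k = z0 * x k * prodL (above k) (λ i → x i * yb i)

    -- weight of a main-diagonal entry (main-diagonal entries are unprimed)
    wgtDiag : Letter n → Carrier
    wgtDiag (mkL (num k) _) = z0 * x k * prodL (above k) (λ i → x i * yb i)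
    wgtDiag (mkL zer _)     = 1#   -- never occurs in a valid filling
    wgtDiag (mkL (bar k) _) = 1#

    wgtOff : Letter n → Carrier
    wgtOff (mkL (num k) false) = x k
    wgtOff (mkL (num k) true)  = y k
    wgtOff (mkL (bar k) false) = yb k
    wgtOff (mkL (bar k) true)  = xb k
    wgtOff (mkL zer false)     = z0
    wgtOff (mkL zer true)      = z0b

    rowWgt : ∀ {m} → Vec (Letter n) m → Carrier
    rowWgt []       = 1#
    rowWgt (a ∷ as) = wgtDiag a * Vec.foldr _ (λ b r → wgtOff b * r) 1# as

    wgt : {lam : Fin n → ℕ} → Filling n lam → Carrier
    wgt P = prodL (allFin n) (λ i → rowWgt (P i))

    tableauSum : (lam : Fin n → ℕ) → Carrier
    tableauSum lam = foldr (λ P r → (if valid P then wgt P else 0#) + r) 0# (allFillings n lam)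

  -- Formal power series in m variables q₁ … q_m (q₁ outermost)

  Ser : ℕ → Set c
  Ser zero    = Carrier
  Ser (suc m) = ℕ → Ser m

  zeroS : (m : ℕ) → Ser m
  zeroS zero    = 0#
  zeroS (suc m) = λ _ → zeroS m

  constS : (m : ℕ) → Carrier → Ser m
  constS zero    a = a
  constS (suc m) a = λ { zero → constS m a ; (suc _) → zeroS m }

  addS : (m : ℕ) → Ser m → Ser m → Ser m
  addS zero    a b = a + b
  addS (suc m) f g = λ i → addS m (f i) (g i)

  negS : (m : ℕ) → Ser m → Ser m
  negS zero    a = - a
  negS (suc m) f = λ i → negS m (f i)

  sumTo : (m : ℕ) → (ℕ → Ser m) → ℕ → Ser m
  sumTo m f zero    = f zero
  sumTo m f (suc k) = addS m (sumTo m f k) (f (suc k))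

  mulS : (m : ℕ) → Ser m → Ser m → Ser m
  mulS zero    a b = a * b
  mulS (suc m) f g = λ k → sumTo m (λ i → mulS m (f i) (g (k ∸ i))) k

  signS : (m : ℕ) → ℕ → Ser m → Ser m
  signS m zero    s = s
  signS m (suc k) s = negS m (signS m k s)

  sumFin : (m : ℕ) (k : ℕ) → (Fin k → Ser m) → Ser m
  sumFin m k f = foldr (λ j r → addS m (f j) r) (zeroS m) (allFin k)

  det : (m : ℕ) (k : ℕ) → (Fin k → Fin k → Ser m) → Ser m
  det m zero    A = constS m 1#
  det m (suc k) A = sumFin m (suc k) (λ j →
    signS m (toℕ j) (mulS m (A zero j) (det m k (λ r c → A (suc r) (punchIn j c)))))

  coeff : (m : ℕ) → Ser m → (Fin m → ℕ) → Carrier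
  coeff zero    a e = a
  coeff (suc m) f e = coeff m (f (e zero)) (e ∘ suc)

  U : Set c
  U = Ser 1

  embed : (m : ℕ) → Fin m → U → Ser m
  embed (suc m) zero    h = λ i → constS m (h i)
  embed (suc m) (suc l) h = λ { zero → embed m l h ; (suc _) → zeroS m }

  _*U_ _+U_ : U → U → U
  f *U g = mulS 1 f g
  f +U g = addS 1 f g
  infixl 7 _*U_
  infixl 6 _+U_

  pow : Carrier → ℕ → Carrier
  pow a zero    = 1#
  pow a (suc k) = a * pow a k

  geomU : Carrier → U
  geomU a = λ k → pow a k

  linU : Carrier → U
  linU b = λ { zero → 1# ; (suc zero) → b ; (suc (suc _)) → 0# }

  qU : U
  qU = λ { (suc zero) → 1# ; _ → 0# }

  cU : Carrier → U
  cU a = constS 1 a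

  prodU : ∀ {A : Set} → List A → (A → U) → U
  prodU L f = foldr (λ a r → f a *U r) (cU 1#) L

  module _ {n : ℕ} (p : Params n) where
    open Params p

    f : Fin n → U
    f k = cU (u p k) *U qU *U geomU (x k)
          *U prodU (above k) (λ i → linU (y i) *U geomU (x i))
          *U linU z0b *U geomU z0
          *U prodU (allFin n) (λ i → linU (xb i) *U geomU (yb i))

    g : Fin n → U
    g k = qU *U geomU (yb k) *U prodU (below k) (λ i → linU (xb i) *U geomU (yb i))

    -- h_k = f_k + (-1)^{n-k} g_k   (k 0-based, so n-k becomes n - (k+1))
    h : Fin n → U
    h k = f k +U signS 1 (n ∸ suc (toℕ k)) (g k)

    detCoeff : (lam : Fin n → ℕ) → Carrier
    detCoeff lam = coeff n (det n n (λ k l → embed n l (h k))) lam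

{-# OPTIONS --safe #-}
module Submission where

open import Defs
open import Algebra.Bundles using (CommutativeRing; CommutativeMonoid)
open import Data.Bool using (Bool; true; false; _∧_; _∨_; not; if_then_else_)
open import Data.Bool.Properties using (∧-assoc; ∧-zeroʳ; T-≡)
open import Data.Empty using (⊥; ⊥-elim)
open import Data.Fin as Fin using (Fin; zero; suc; toℕ; punchIn; punchOut)
import Data.Fin.Properties as Finₚ
open import Data.List using (List; []; _∷_; _++_; _∷ʳ_; foldr; concatMap; map; replicate; length; tabulate; allFin; filterᵇ; drop)
open import Data.List.Membership.Propositional using (_∈_)
open import Data.List.Membership.Propositional.Properties using (∈-allFin; ∈-++⁺ˡ; ∈-++⁺ʳ; ∈-map⁺; ∈-map⁻)
open import Data.List.Properties using (length-++; length-map; length-tabulate; map-∘; map-++; map-injective; map-tabulate; tabulate-cong; foldr-++; ∷ʳ-injectiveˡ; ∷-injectiveʳ; ∷-injectiveˡ)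
open import Data.List.Relation.Binary.Pointwise using (Pointwise; []; _∷_)
open import Data.List.Relation.Unary.All as All using (All; []; _∷_)
import Data.List.Relation.Unary.All.Properties as Allₚ
open import Data.List.Relation.Unary.AllPairs as AllPairs using (AllPairs; []; _∷_)
import Data.List.Relation.Unary.AllPairs.Properties as AllPairsₚ
open import Data.List.Relation.Unary.Any using (here; there)
open import Data.List.Relation.Unary.Linked as Linked using (Linked; []; [-]; _∷_)
open import Data.List.Relation.Unary.Linked.Properties using (Linked⇒AllPairs)
open import Data.List.Relation.Unary.Unique.Propositional using (Unique)
import Data.List.Relation.Unary.Unique.Propositional.Properties as Uniqueₚ
open import Data.Maybe using (just; nothing)
open import Data.Maybe.Properties using (just-injective)
open import Data.Nat as ℕ using (ℕ; zero; suc; pred; _∸_; _≤_; _<_; _>_; _≥_; z≤n; s≤s; _<ᵇ_; _≡ᵇ_; _≤ᵇ_; ⌊_/2⌋)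
import Data.Nat.Properties as ℕₚ
open import Data.Product using (_×_; _,_; proj₁; proj₂; ∃; ∃₂)
open import Data.Sum using (_⊎_; inj₁; inj₂)
open import Data.Unit using (⊤; tt)
open import Data.Vec as Vec using (Vec; []; _∷_; toList)
open import Function using (_∘_; id)
open import Function.Bundles using (Equivalence)
open import Level using (Level)
open import Relation.Binary.Definitions using (tri<; tri≈; tri>)
open import Relation.Binary.PropositionalEquality as ≡ using (_≡_; _≢_)
open import Relation.Nullary using (¬_; yes; no; contradiction)

-- Reading the determinant column by column, the coefficient of q^λ is the scalar determinant
-- (h_k(λ_l)), an alternating function of the list λ.  Expanding each row h_k = f_k ± g_k and moving
-- a chosen g_k to the bottom absorbs its sign, so the determinant is a sum over the possible main
-- diagonals, with the rows in the order of the diagonal.  For a fixed diagonal, tableaux and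
-- determinants satisfy the same recursion on the largest letter: that letter contributes a factor
-- 1 + wq or 1/(1 - wq) for every variable, and multiplying an alternating function by such a product
-- and cancelling the terms that alternation kills leaves exactly the vertical or horizontal strips.
-- The row of the diagonal entry equal to the largest letter is δ, which forces the last part.
-- Off-diagonal row lengths λ_i - 1 are used throughout, which removes the common factors q.

-- The main diagonal of a valid filling strictly increases, so the choices between k and its barred
-- partner already fix its order; the products of rows f and g in the expansion thus match the
-- possible diagonals one by one. The factors in f and g are those of the letters that can follow
-- the diagonal letter in its row: that letter itself, which is unprimed and may repeat, and all
-- larger ones.
--
-- The obstacle is that removing a primed letter from rows of distinct lengths can leave equal
-- lengths. The induction therefore runs over weakly decreasing lists. At a repeated length both
-- sides vanish for different reasons: the lower row, shifted by one box, sticks out under the upper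
-- one, and the determinant has two equal columns. Conversely, the product expansion on the
-- determinant side contains shapes that no strip produces, and these have to cancel.

private variable
  a b : Level
  A : Set a
  B : Set b

-- Finite sums over lists and over initial segments of the natural numbers

module Sums {c ℓ} (R : CommutativeRing c ℓ) where
  open CommutativeRing R hiding (zero)
  open import Algebra.Properties.Ring ring
  open import Algebra.Properties.AbelianGroup +-abelianGroup using (⁻¹-∙-comm)
  open import Algebra.Solver.Ring.NaturalCoefficients.Default commutativeSemiring using (solve; _:=_; _:+_; _:*_)
  open import Relation.Binary.Reasoning.Setoid setoid

  ∑ : List A → (A → Carrier) → Carrier
  ∑ xs f = foldr (λ x r → f x + r) 0# xs

  ∑-cong : (xs : List A) {f g : A → Carrier} → (∀ x → f x ≈ g x) → ∑ xs f ≈ ∑ xs g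
  ∑-cong []       e = refl
  ∑-cong (x ∷ xs) e = +-cong (e x) (∑-cong xs e)

  ∑-congAll : {xs : List A} {P : A → Set b} {f g : A → Carrier} →
              All P xs → (∀ x → P x → f x ≈ g x) → ∑ xs f ≈ ∑ xs g
  ∑-congAll []       e = refl
  ∑-congAll (p ∷ ps) e = +-cong (e _ p) (∑-congAll ps e)

  ∑-0 : (xs : List A) → ∑ xs (λ _ → 0#) ≈ 0#
  ∑-0 []       = refl
  ∑-0 (x ∷ xs) = trans (+-identityˡ _) (∑-0 xs)

  ∑-zero : (xs : List A) {f : A → Carrier} → (∀ x → f x ≈ 0#) → ∑ xs f ≈ 0#
  ∑-zero xs e = trans (∑-cong xs e) (∑-0 xs)

  ∑-++ : (xs ys : List A) (f : A → Carrier) → ∑ (xs ++ ys) f ≈ ∑ xs f + ∑ ys f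
  ∑-++ []       ys f = sym (+-identityˡ _)
  ∑-++ (x ∷ xs) ys f = trans (+-congˡ (∑-++ xs ys f)) (sym (+-assoc _ _ _))

  ∑-map : (h : B → A) (xs : List B) (f : A → Carrier) → ∑ (map h xs) f ≡ ∑ xs (f ∘ h)
  ∑-map h []       f = ≡.refl
  ∑-map h (x ∷ xs) f = ≡.cong (f (h x) +_) (∑-map h xs f)

  ∑-concatMap : (h : B → List A) (xs : List B) (f : A → Carrier) →
                ∑ (concatMap h xs) f ≈ ∑ xs (λ x → ∑ (h x) f)
  ∑-concatMap h []       f = refl
  ∑-concatMap h (x ∷ xs) f = trans (∑-++ (h x) _ f) (+-congˡ (∑-concatMap h xs f))

  +-interchange : ∀ x y z w → (x + y) + (z + w) ≈ (x + z) + (y + w)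
  +-interchange = solve 4 (λ x y z w → (x :+ y) :+ (z :+ w) := (x :+ z) :+ (y :+ w)) refl

  ∑-+ : (xs : List A) (f g : A → Carrier) → ∑ xs (λ x → f x + g x) ≈ ∑ xs f + ∑ xs g
  ∑-+ []       f g = sym (+-identityˡ _)
  ∑-+ (x ∷ xs) f g = trans (+-congˡ (∑-+ xs f g)) (+-interchange _ _ _ _)

  ∑-*ˡ : (xs : List A) (k : Carrier) (f : A → Carrier) → ∑ xs (λ x → k * f x) ≈ k * ∑ xs f
  ∑-*ˡ []       k f = sym (zeroʳ k)
  ∑-*ˡ (x ∷ xs) k f = trans (+-congˡ (∑-*ˡ xs k f)) (sym (distribˡ _ _ _))

  Σ≤ : (ℕ → Carrier) → ℕ → Carrier
  Σ≤ = sumTo R 0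

  Σ≤-cong≤ : ∀ {f g : ℕ → Carrier} n → (∀ k → k ≤ n → f k ≈ g k) → Σ≤ f n ≈ Σ≤ g n
  Σ≤-cong≤ zero    e = e 0 z≤n
  Σ≤-cong≤ (suc n) e = +-cong (Σ≤-cong≤ n (λ k p → e k (ℕₚ.m≤n⇒m≤1+n p))) (e (suc n) ℕₚ.≤-refl)

  Σ≤-cong : ∀ {f g : ℕ → Carrier} n → (∀ k → f k ≈ g k) → Σ≤ f n ≈ Σ≤ g n
  Σ≤-cong n e = Σ≤-cong≤ n (λ k _ → e k)

  Σ≤-zero : ∀ {f : ℕ → Carrier} n → (∀ k → k ≤ n → f k ≈ 0#) → Σ≤ f n ≈ 0#
  Σ≤-zero zero    e = e 0 z≤n
  Σ≤-zero (suc n) e = trans (+-cong (Σ≤-zero n (λ k p → e k (ℕₚ.m≤n⇒m≤1+n p))) (e (suc n) ℕₚ.≤-refl)) (+-identityˡ _)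

  Σ≤-+ : ∀ (f g : ℕ → Carrier) n → Σ≤ (λ k → f k + g k) n ≈ Σ≤ f n + Σ≤ g n
  Σ≤-+ f g zero    = refl
  Σ≤-+ f g (suc n) = trans (+-congʳ (Σ≤-+ f g n)) (+-interchange _ _ _ _)

  Σ≤-*ˡ : ∀ x (f : ℕ → Carrier) n → Σ≤ (λ k → x * f k) n ≈ x * Σ≤ f n
  Σ≤-*ˡ x f zero    = refl
  Σ≤-*ˡ x f (suc n) = trans (+-congʳ (Σ≤-*ˡ x f n)) (sym (distribˡ _ _ _))

  Σ≤-*ʳ : ∀ x (f : ℕ → Carrier) n → Σ≤ (λ k → f k * x) n ≈ Σ≤ f n * x
  Σ≤-*ʳ x f zero    = refl
  Σ≤-*ʳ x f (suc n) = trans (+-congʳ (Σ≤-*ʳ x f n)) (sym (distribʳ _ _ _))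

  Σ≤-neg : ∀ (f : ℕ → Carrier) n → Σ≤ (λ k → - f k) n ≈ - Σ≤ f n
  Σ≤-neg f zero    = refl
  Σ≤-neg f (suc n) = trans (+-congʳ (Σ≤-neg f n)) (⁻¹-∙-comm _ _)

  Σ≤-head : ∀ (f : ℕ → Carrier) n → Σ≤ f (suc n) ≈ f 0 + Σ≤ (f ∘ suc) n
  Σ≤-head f zero    = refl
  Σ≤-head f (suc n) = trans (+-congʳ (Σ≤-head f n)) (+-assoc _ _ _)

  -- Enlarging the square by one adds a last row and a last column, which cancel term by term. The
  -- diagonal gets its own hypothesis, since antisymmetry bounds only twice a diagonal entry.
  Σ≤-antisymmetric : (F : ℕ → ℕ → Carrier) → (∀ k → F k k ≈ 0#) → (∀ k l → F k l ≈ - F l k) →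
                     ∀ n → Σ≤ (λ k → Σ≤ (F k) n) n ≈ 0#
  Σ≤-antisymmetric F d s zero    = d 0
  Σ≤-antisymmetric F d s (suc n) = begin
    Σ≤ (λ k → Σ≤ (F k) n + F k (suc n)) n + (Σ≤ (F (suc n)) n + F (suc n) (suc n))
      ≈⟨ +-cong (Σ≤-+ _ _ n) (trans (+-congˡ (d (suc n))) (+-identityʳ _)) ⟩
    (Σ≤ (λ k → Σ≤ (F k) n) n + Σ≤ (λ k → F k (suc n)) n) + Σ≤ (F (suc n)) n
      ≈⟨ +-congʳ (trans (+-congʳ (Σ≤-antisymmetric F d s n)) (+-identityˡ _)) ⟩
    Σ≤ (λ k → F k (suc n)) n + Σ≤ (F (suc n)) n
      ≈⟨ +-congʳ (trans (Σ≤-cong n (λ k → s k (suc n))) (Σ≤-neg _ n)) ⟩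
    - Σ≤ (F (suc n)) n + Σ≤ (F (suc n)) n
      ≈⟨ -‿inverseˡ _ ⟩
    0# ∎

  -- Here `g` is the part of `f` above the threshold `d`. This isolates the low terms, which
  -- alternation will kill; the limit `d + j` permits induction on `j`.
  Σ≤-split : ∀ (f g : ℕ → Carrier) d j →
             (∀ k → k ≤ d → g k ≈ 0#) → (∀ k → d < k → g k ≈ f k) →
             Σ≤ f (d ℕ.+ j) ≈ Σ≤ f d + Σ≤ g (d ℕ.+ j)
  Σ≤-split f g d zero    lo hi = begin
    Σ≤ f (d ℕ.+ 0)                  ≡⟨ ≡.cong (Σ≤ f) (ℕₚ.+-identityʳ d) ⟩
    Σ≤ f d                          ≈⟨ +-identityʳ _ ⟨
    Σ≤ f d + 0#                     ≈⟨ +-congˡ (Σ≤-zero d lo) ⟨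
    Σ≤ f d + Σ≤ g d                 ≡⟨ ≡.cong (λ t → Σ≤ f d + Σ≤ g t) (ℕₚ.+-identityʳ d) ⟨
    Σ≤ f d + Σ≤ g (d ℕ.+ 0)         ∎
  Σ≤-split f g d (suc j) lo hi rewrite ℕₚ.+-suc d j = begin
    Σ≤ f (d ℕ.+ j) + f (suc (d ℕ.+ j))
      ≈⟨ +-cong (Σ≤-split f g d j lo hi) (sym (hi _ (s≤s (ℕₚ.m≤m+n d j)))) ⟩
    (Σ≤ f d + Σ≤ g (d ℕ.+ j)) + g (suc (d ℕ.+ j))
      ≈⟨ +-assoc _ _ _ ⟩
    Σ≤ f d + (Σ≤ g (d ℕ.+ j) + g (suc (d ℕ.+ j))) ∎

  -- Determinants as alternating functions of a list of columns

  Φ : Set c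
  Φ = List ℕ → Carrier

  infix 4 _≋_
  _≋_ : {X : Set a} → (X → Carrier) → (X → Carrier) → Set _
  φ ≋ ψ = ∀ cs → φ cs ≈ ψ cs

  slice : ℕ → Φ → Φ
  slice c φ cs = φ (c ∷ cs)

  -- The exterior product of a linear form with a form, that is, Laplace expansion along a new first
  -- row `a`: either `a` takes the column `c`, or `c` is handed to `φ` and the subtraction supplies
  -- the sign.
  wedge : (ℕ → Carrier) → Φ → Φ
  wedge a φ []       = 0#
  wedge a φ (c ∷ cs) = a c * φ cs - wedge a (slice c φ) cs

  unit : Φ
  unit []      = 1#
  unit (_ ∷ _) = 0#

  -- The list of columns is the argument, so that a determinant is an alternating function of it.
  detL : List (ℕ → Carrier) → Φ
  detL = foldr wedge unit

  -‿cong₂ : ∀ {x y z w} → x ≈ y → z ≈ w → x - z ≈ y - w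
  -‿cong₂ p q = +-cong p (-‿cong q)

  -interchange : ∀ x y z w → (x + y) - (z + w) ≈ (x - z) + (y - w)
  -interchange x y z w = trans (+-congˡ (sym (⁻¹-∙-comm z w))) (+-interchange _ _ _ _)

  neg-sub : ∀ x y → - (x - y) ≈ - x + y
  neg-sub x y = trans (sym (⁻¹-∙-comm x (- y))) (+-congˡ (-‿involutive y))

  wedge-cong : ∀ {a b φ ψ} → a ≋ b → φ ≋ ψ → wedge a φ ≋ wedge b ψ
  wedge-cong p q []       = refl
  wedge-cong p q (c ∷ cs) = -‿cong₂ (*-cong (p c) (q cs)) (wedge-cong p (λ ds → q (c ∷ ds)) cs)

  wedge-congʳ : ∀ {a φ ψ} → φ ≋ ψ → wedge a φ ≋ wedge a ψ
  wedge-congʳ = wedge-cong (λ _ → refl)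

  wedge-+ˡ : ∀ a b φ → wedge (λ k → a k + b k) φ ≋ λ cs → wedge a φ cs + wedge b φ cs
  wedge-+ˡ a b φ []       = sym (+-identityˡ _)
  wedge-+ˡ a b φ (c ∷ cs) = trans (-‿cong₂ (distribʳ _ _ _) (wedge-+ˡ a b _ cs)) (-interchange _ _ _ _)

  wedge-+ʳ : ∀ a φ ψ → wedge a (λ cs → φ cs + ψ cs) ≋ λ cs → wedge a φ cs + wedge a ψ cs
  wedge-+ʳ a φ ψ []       = sym (+-identityˡ _)
  wedge-+ʳ a φ ψ (c ∷ cs) = trans (-‿cong₂ (distribˡ _ _ _) (wedge-+ʳ a _ _ cs)) (-interchange _ _ _ _)

  wedge-*ʳ : ∀ a k φ → wedge a (λ cs → k * φ cs) ≋ λ cs → k * wedge a φ cs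
  wedge-*ʳ a k φ []       = sym (zeroʳ k)
  wedge-*ʳ a k φ (c ∷ cs) = begin
    a c * (k * φ cs) - wedge a (λ ds → k * φ (c ∷ ds)) cs
      ≈⟨ -‿cong₂ (solve 3 (λ x y z → x :* (y :* z) := y :* (x :* z)) refl _ _ _) (wedge-*ʳ a k _ cs) ⟩
    k * (a c * φ cs) - k * wedge a (slice c φ) cs
      ≈⟨ x[y-z]≈xy-xz k _ _ ⟨
    k * (a c * φ cs - wedge a (slice c φ) cs) ∎

  wedge-*ˡ : ∀ a k φ → wedge (λ i → k * a i) φ ≋ λ cs → k * wedge a φ cs
  wedge-*ˡ a k φ []       = sym (zeroʳ k)
  wedge-*ˡ a k φ (c ∷ cs) = trans (-‿cong₂ (*-assoc _ _ _) (wedge-*ˡ a k _ cs)) (sym (x[y-z]≈xy-xz k _ _))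

  wedge-negˡ : ∀ a φ → wedge (λ i → - a i) φ ≋ λ cs → - wedge a φ cs
  wedge-negˡ a φ cs = begin
    wedge (λ i → - a i) φ cs        ≈⟨ wedge-cong (λ i → -1*x≈-x (a i)) (λ _ → refl) cs ⟨
    wedge (λ i → - 1# * a i) φ cs   ≈⟨ wedge-*ˡ a (- 1#) φ cs ⟩
    - 1# * wedge a φ cs             ≈⟨ -1*x≈-x _ ⟩
    - wedge a φ cs                  ∎

  wedge-negʳ : ∀ a φ → wedge a (λ cs → - φ cs) ≋ λ cs → - wedge a φ cs
  wedge-negʳ a φ cs = begin
    wedge a (λ ds → - φ ds) cs        ≈⟨ wedge-congʳ (λ i → -1*x≈-x (φ i)) cs ⟨
    wedge a (λ ds → - 1# * φ ds) cs   ≈⟨ wedge-*ʳ a (- 1#) φ cs ⟩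
    - 1# * wedge a φ cs               ≈⟨ -1*x≈-x _ ⟩
    - wedge a φ cs                    ∎

  wedge-0ʳ : ∀ a {φ} → φ ≋ (λ _ → 0#) → wedge a φ ≋ λ _ → 0#
  wedge-0ʳ a e cs = trans (wedge-congʳ (λ ds → trans (e ds) (sym (zeroˡ 0#))) cs)
                          (trans (wedge-*ʳ a 0# (λ _ → 0#) cs) (zeroˡ _))

  wedge-∑ : ∀ a (xs : List A) (F : A → Φ) → wedge a (λ cs → ∑ xs (λ x → F x cs)) ≋ λ cs → ∑ xs (λ x → wedge a (F x) cs)
  wedge-∑ a []       F cs = wedge-0ʳ a (λ _ → refl) cs
  wedge-∑ a (x ∷ xs) F cs = trans (wedge-+ʳ a (F x) _ cs) (+-congˡ (wedge-∑ a xs F cs))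

  wedge-Σ≤ : ∀ a (F : ℕ → Φ) n → wedge a (λ cs → Σ≤ (λ k → F k cs) n) ≋ λ cs → Σ≤ (λ k → wedge a (F k) cs) n
  wedge-Σ≤ a F zero    cs = refl
  wedge-Σ≤ a F (suc n) cs = trans (wedge-+ʳ a _ (F (suc n)) cs) (+-congʳ (wedge-Σ≤ a F n cs))

  -- wedge a is an antiderivation with respect to slice c, which turns anticommutation into an induction.
  wedge-anticomm : ∀ a b φ → wedge a (wedge b φ) ≋ λ cs → - wedge b (wedge a φ) cs
  wedge-anticomm a b φ []       = sym -0#≈0#
  wedge-anticomm a b φ (c ∷ cs) = begin
    a c * wedge b φ cs - wedge a (λ ds → b c * φ ds - wedge b (slice c φ) ds) cs
      ≈⟨ -‿cong₂ refl (expand a b) ⟩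
    a c * wedge b φ cs - (b c * wedge a φ cs - wedge a (wedge b (slice c φ)) cs)
      ≈⟨ +-congˡ (neg-sub _ _) ⟩
    a c * wedge b φ cs + (- (b c * wedge a φ cs) + wedge a (wedge b (slice c φ)) cs)
      ≈⟨ solve 3 (λ x y z → x :+ (y :+ z) := y :+ (x :+ z)) refl _ _ _ ⟩
    - (b c * wedge a φ cs) + (a c * wedge b φ cs + wedge a (wedge b (slice c φ)) cs)
      ≈⟨ +-congˡ (+-congˡ (wedge-anticomm a b _ cs)) ⟩
    - (b c * wedge a φ cs) + (a c * wedge b φ cs - wedge b (wedge a (slice c φ)) cs)
      ≈⟨ neg-sub _ _ ⟨
    - (b c * wedge a φ cs - (a c * wedge b φ cs - wedge b (wedge a (slice c φ)) cs))
      ≈⟨ -‿cong (-‿cong₂ refl (expand b a)) ⟨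
    - (b c * wedge a φ cs - wedge b (λ ds → a c * φ ds - wedge a (slice c φ) ds) cs) ∎
    where
    expand : ∀ a b → wedge a (λ ds → b c * φ ds - wedge b (slice c φ) ds) cs
                   ≈ b c * wedge a φ cs - wedge a (wedge b (slice c φ)) cs
    expand a b = trans (wedge-+ʳ a _ _ cs) (+-cong (wedge-*ʳ a _ _ cs) (wedge-negʳ a _ cs))

  wedges : List (ℕ → Carrier) → Φ → Φ
  wedges as φ = foldr wedge φ as

  sgn : ℕ → Carrier → Carrier
  sgn = signS R 0

  sgn-cong : ∀ m {x y} → x ≈ y → sgn m x ≈ sgn m y
  sgn-cong zero    e = e
  sgn-cong (suc m) e = -‿cong (sgn-cong m e)

  sgn-neg : ∀ m x → sgn m (- x) ≈ - sgn m x
  sgn-neg zero    x = refl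
  sgn-neg (suc m) x = -‿cong (sgn-neg m x)

  sgn-sgn : ∀ m x → sgn m (sgn m x) ≈ x
  sgn-sgn zero    x = refl
  sgn-sgn (suc m) x = trans (-‿cong (sgn-neg m _)) (trans (-‿involutive _) (sgn-sgn m x))

  wedge-sgnˡ : ∀ m a φ → wedge (λ i → sgn m (a i)) φ ≋ λ cs → sgn m (wedge a φ cs)
  wedge-sgnˡ zero    a φ cs = refl
  wedge-sgnˡ (suc m) a φ cs = trans (wedge-negˡ _ φ cs) (-‿cong (wedge-sgnˡ m a φ cs))

  wedge-past : ∀ b as φ → wedge b (wedges as φ) ≋ λ cs → sgn (length as) (wedges as (wedge b φ) cs)
  wedge-past b []       φ cs = refl
  wedge-past b (a ∷ as) φ cs = begin
    wedge b (wedge a (wedges as φ)) cs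
      ≈⟨ wedge-anticomm b a _ cs ⟩
    - wedge a (wedge b (wedges as φ)) cs
      ≈⟨ -‿cong (wedge-congʳ (wedge-past b as φ) cs) ⟩
    - wedge a (λ ds → sgn (length as) (wedges as (wedge b φ) ds)) cs
      ≈⟨ -‿cong (wedge-sgnʳ (length as) a _ cs) ⟩
    - sgn (length as) (wedge a (wedges as (wedge b φ)) cs) ∎
    where
    wedge-sgnʳ : ∀ m a φ → wedge a (λ cs → sgn m (φ cs)) ≋ λ cs → sgn m (wedge a φ cs)
    wedge-sgnʳ zero    a φ cs = refl
    wedge-sgnʳ (suc m) a φ cs = trans (wedge-negʳ a _ cs) (-‿cong (wedge-sgnʳ m a φ cs))

  -- `repeat` does not follow from `swap` when 2 is a zero divisor, so both are carried along.
  -- Adjacent columns suffice, because a weakly decreasing list that is not strict has two equal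
  -- neighbours.
  record Alternating (φ : Φ) : Set ℓ where
    field
      swap   : ∀ pre c d post → φ (pre ++ c ∷ d ∷ post) ≈ - φ (pre ++ d ∷ c ∷ post)
      repeat : ∀ pre c post → φ (pre ++ c ∷ c ∷ post) ≈ 0#
  open Alternating public

  slice-alternating : ∀ {φ} c → Alternating φ → Alternating (slice c φ)
  slice-alternating c A = record
    { swap   = λ pre → swap A (c ∷ pre)
    ; repeat = λ pre → repeat A (c ∷ pre)
    }

  unit-alternating : Alternating unit
  unit-alternating = record { swap = sw ; repeat = rp }
    where
    sw : ∀ pre c d post → unit (pre ++ c ∷ d ∷ post) ≈ - unit (pre ++ d ∷ c ∷ post)
    sw []      c d post = sym -0#≈0#
    sw (_ ∷ _) c d post = sym -0#≈0#
    rp : ∀ pre c post → unit (pre ++ c ∷ c ∷ post) ≈ 0#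
    rp []      c post = refl
    rp (_ ∷ _) c post = refl

  -- When the two columns stand in front, the terms in which `a` takes one of them trade places up
  -- to sign, or cancel if the columns agree; the term in which `a` takes neither is settled by `φ`.
  -- Deeper positions reduce to a slice of `φ`, hence the local quantification over `φ`.
  wedge-alternating : ∀ a {φ} → Alternating φ → Alternating (wedge a φ)
  wedge-alternating a {φ} A = record { swap = sw A ; repeat = rp A }
    where
    sw : ∀ {φ} → Alternating φ → ∀ pre c d post → wedge a φ (pre ++ c ∷ d ∷ post) ≈ - wedge a φ (pre ++ d ∷ c ∷ post)
    sw {φ} A [] c d post = begin
      a c * φ (d ∷ post) - (a d * φ (c ∷ post) - wedge a (slice d (slice c φ)) post)
        ≈⟨ +-congˡ (neg-sub _ _) ⟩
      a c * φ (d ∷ post) + (- (a d * φ (c ∷ post)) + wedge a (slice d (slice c φ)) post)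
        ≈⟨ solve 3 (λ x y z → x :+ (y :+ z) := y :+ (x :+ z)) refl _ _ _ ⟩
      - (a d * φ (c ∷ post)) + (a c * φ (d ∷ post) + wedge a (slice d (slice c φ)) post)
        ≈⟨ +-congˡ (+-congˡ (trans (wedge-congʳ (λ ds → swap A [] c d ds) post) (wedge-negʳ a _ post))) ⟩
      - (a d * φ (c ∷ post)) + (a c * φ (d ∷ post) - wedge a (slice c (slice d φ)) post)
        ≈⟨ neg-sub _ _ ⟨
      - (a d * φ (c ∷ post) - (a c * φ (d ∷ post) - wedge a (slice c (slice d φ)) post)) ∎
    sw A (p ∷ pre) c d post =
      trans (-‿cong₂ (trans (*-congˡ (swap A pre c d post)) (sym (-‿distribʳ-* _ _))) (sw (slice-alternating p A) pre c d post))
            (⁻¹-∙-comm _ _)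
    rp : ∀ {φ} → Alternating φ → ∀ pre c post → wedge a φ (pre ++ c ∷ c ∷ post) ≈ 0#
    rp {φ} A [] c post = begin
      a c * φ (c ∷ post) - (a c * φ (c ∷ post) - wedge a (slice c (slice c φ)) post)
        ≈⟨ +-congˡ (-‿cong (trans (+-congˡ (trans (-‿cong (wedge-0ʳ a (λ ds → repeat A [] c ds) post)) -0#≈0#)) (+-identityʳ _))) ⟩
      a c * φ (c ∷ post) - a c * φ (c ∷ post)
        ≈⟨ -‿inverseʳ _ ⟩
      0# ∎
    rp A (p ∷ pre) c post =
      trans (-‿cong₂ (trans (*-congˡ (repeat A pre c post)) (zeroʳ _)) (rp (slice-alternating p A) pre c post)) (-‿inverseʳ _)

  detL-alternating : ∀ as → Alternating (detL as)
  detL-alternating []       = unit-alternating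
  detL-alternating (a ∷ as) = wedge-alternating a (detL-alternating as)

  -- Multiplying by the same series in every variable

  conv : (ℕ → Carrier) → (ℕ → Carrier) → ℕ → Carrier
  conv = mulS R 1

  -- Multiplication by the product of the series s in each variable.
  scale : (ℕ → Carrier) → Φ → Φ
  scale s φ []       = φ []
  scale s φ (c ∷ cs) = Σ≤ (λ k → s (c ∸ k) * scale s (slice k φ) cs) c

  scale-cong : ∀ s {φ ψ} → φ ≋ ψ → scale s φ ≋ scale s ψ
  scale-cong s e []       = e []
  scale-cong s e (c ∷ cs) = Σ≤-cong c (λ k → *-congˡ (scale-cong s (λ ds → e (k ∷ ds)) cs))

  scale-unit : ∀ s → scale s unit ≋ unit
  scale-unit s []       = refl
  scale-unit s (c ∷ cs) = Σ≤-zero c (λ k _ → trans (*-congˡ (z cs)) (zeroʳ _))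
    where
    z : ∀ cs → scale s (λ _ → 0#) cs ≈ 0#
    z []       = refl
    z (c ∷ cs) = Σ≤-zero c (λ k _ → trans (*-congˡ (z cs)) (zeroʳ _))

  scale-lin : ∀ s x φ ψ → scale s (λ ds → x * φ ds - ψ ds) ≋ λ cs → x * scale s φ cs - scale s ψ cs
  scale-lin s x φ ψ []       = refl
  scale-lin s x φ ψ (c ∷ cs) = begin
    Σ≤ (λ k → s (c ∸ k) * scale s (λ ds → x * φ (k ∷ ds) - ψ (k ∷ ds)) cs) c
      ≈⟨ Σ≤-cong c (λ k → trans (*-congˡ (scale-lin s x _ _ cs)) (trans (x[y-z]≈xy-xz _ _ _)
            (+-congʳ (solve 3 (λ x y z → x :* (y :* z) := y :* (x :* z)) refl _ _ _)))) ⟩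
    Σ≤ (λ k → x * (s (c ∸ k) * scale s (slice k φ) cs) - s (c ∸ k) * scale s (slice k ψ) cs) c
      ≈⟨ trans (Σ≤-+ _ _ c) (+-cong (Σ≤-*ˡ x _ c) (Σ≤-neg _ c)) ⟩
    x * scale s φ (c ∷ cs) - scale s ψ (c ∷ cs) ∎

  -- The factor of a column follows that column: on the column taken by `a` it turns `a` into
  -- `conv a s`, on the remaining columns it scales `φ`.
  scale-wedge : ∀ s a φ → scale s (wedge a φ) ≋ wedge (conv a s) (scale s φ)
  scale-wedge s a φ []       = refl
  scale-wedge s a φ (c ∷ cs) = begin
    Σ≤ (λ k → s (c ∸ k) * scale s (λ ds → a k * φ ds - wedge a (slice k φ) ds) cs) c
      ≈⟨ Σ≤-cong c (λ k → trans (*-congˡ (trans (scale-lin s (a k) _ _ cs) (+-congˡ (-‿cong (scale-wedge s a (slice k φ) cs)))))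
                                (trans (x[y-z]≈xy-xz _ _ _)
            (+-congʳ (solve 3 (λ x y z → x :* (y :* z) := (y :* x) :* z) refl _ _ _)))) ⟩
    Σ≤ (λ k → (a k * s (c ∸ k)) * scale s φ cs - s (c ∸ k) * wedge (conv a s) (scale s (slice k φ)) cs) c
      ≈⟨ trans (Σ≤-+ _ _ c) (+-cong (Σ≤-*ʳ _ _ c) (Σ≤-neg _ c)) ⟩
    conv a s c * scale s φ cs - Σ≤ (λ k → s (c ∸ k) * wedge (conv a s) (scale s (slice k φ)) cs) c
      ≈⟨ +-congˡ (-‿cong (trans (wedge-Σ≤ _ _ c cs) (Σ≤-cong c (λ k → wedge-*ʳ _ _ _ cs)))) ⟨
    conv a s c * scale s φ cs - wedge (conv a s) (slice c (scale s φ)) cs ∎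

  scale-detL : ∀ s as → scale s (detL as) ≋ detL (map (λ a → conv a s) as)
  scale-detL s []       cs = scale-unit s cs
  scale-detL s (a ∷ as) cs = trans (scale-wedge s a _ cs) (wedge-congʳ (scale-detL s as) cs)

  scale-slice-neg : ∀ s {φ ψ} → (∀ cs → φ cs ≈ - ψ cs) → ∀ cs → scale s φ cs ≈ - scale s ψ cs
  scale-slice-neg s {φ} {ψ} e cs = begin
    scale s φ cs                         ≈⟨ scale-cong s (λ ds → trans (e ds) (sym (trans (+-congʳ (zeroˡ _)) (+-identityˡ _)))) cs ⟩
    scale s (λ ds → 0# * ψ ds - ψ ds) cs ≈⟨ scale-lin s 0# ψ ψ cs ⟩
    0# * scale s ψ cs - scale s ψ cs     ≈⟨ trans (+-congʳ (zeroˡ _)) (+-identityˡ _) ⟩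
    - scale s ψ cs                       ∎

  scale-0 : ∀ s {φ} → (∀ cs → φ cs ≈ 0#) → ∀ cs → scale s φ cs ≈ 0#
  scale-0 s e []       = e []
  scale-0 s e (c ∷ cs) = Σ≤-zero c (λ k _ → trans (*-congˡ (scale-0 s (λ ds → e (k ∷ ds)) cs)) (zeroʳ _))

  -- With equal limits the first two summations run over a square, and exchanging their indices
  -- changes the sign because `φ` alternates.
  scale-repeat : ∀ s {φ} → Alternating φ → ∀ d cs → scale s φ (d ∷ d ∷ cs) ≈ 0#
  scale-repeat s {φ} A d cs = trans (Σ≤-cong d (λ k → sym (Σ≤-*ˡ _ _ d))) (Σ≤-antisymmetric F diag anti d)
    where
    F : ℕ → ℕ → Carrier
    F k l = s (d ∸ k) * (s (d ∸ l) * scale s (slice l (slice k φ)) cs)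
    diag : ∀ k → F k k ≈ 0#
    diag k = trans (*-congˡ (trans (*-congˡ (scale-0 s (λ ds → repeat A [] k ds) cs)) (zeroʳ _))) (zeroʳ _)
    anti : ∀ k l → F k l ≈ - F l k
    anti k l = trans (*-congˡ (*-congˡ (scale-slice-neg s (λ ds → swap A [] k l ds) cs)))
              (trans (*-congˡ (sym (-‿distribʳ-* _ _))) (trans (sym (-‿distribʳ-* _ _))
              (-‿cong (solve 3 (λ x y z → x :* (y :* z) := y :* (x :* z)) refl _ _ _))))

-- Boolean comparisons and monotone lists

<ᵇ-true : ∀ {m n} → m < n → (m <ᵇ n) ≡ true
<ᵇ-true p = Equivalence.to T-≡ (ℕₚ.<⇒<ᵇ p)

<ᵇ-true⁻¹ : ∀ {m n} → (m <ᵇ n) ≡ true → m < n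
<ᵇ-true⁻¹ e = ℕₚ.<ᵇ⇒< _ _ (Equivalence.from T-≡ e)

<ᵇ-false : ∀ {m n} → n ≤ m → (m <ᵇ n) ≡ false
<ᵇ-false {m} {n} p with m <ᵇ n in eq
... | false = ≡.refl
... | true  = ⊥-elim (ℕₚ.<⇒≱ (<ᵇ-true⁻¹ eq) p)

≡ᵇ-refl : ∀ n → (n ≡ᵇ n) ≡ true
≡ᵇ-refl zero    = ≡.refl
≡ᵇ-refl (suc n) = ≡ᵇ-refl n

≡ᵇ-false : ∀ {m n} → m ≢ n → (m ≡ᵇ n) ≡ false
≡ᵇ-false {m} {n} p with m ≡ᵇ n in eq
... | false = ≡.refl
... | true  = ⊥-elim (p (ℕₚ.≡ᵇ⇒≡ m n (Equivalence.from T-≡ eq)))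

-- The tableau sum and the determinant both vanish on a list with two equal neighbours; this
-- dichotomy confines the recursion to strict lists.
repeat-or-strict : ∀ {m} → Linked _≥_ m → Linked _>_ m ⊎ (∃₂ λ pre c → ∃ λ post → m ≡ pre ++ c ∷ c ∷ post)
repeat-or-strict []  = inj₁ []
repeat-or-strict [-] = inj₁ [-]
repeat-or-strict {c ∷ d ∷ m} (p ∷ L) with repeat-or-strict L
... | inj₂ (pre , e , post , eq) = inj₂ (c ∷ pre , e , post , ≡.cong (c ∷_) eq)
... | inj₁ S with ℕₚ.m≤n⇒m<n∨m≡n p
...   | inj₁ d<c = inj₁ (d<c ∷ S)
...   | inj₂ ≡.refl = inj₂ ([] , c , m , ≡.refl)

strict-∷ʳ : ∀ m {l} → Linked _>_ (m ∷ʳ l) → Linked _>_ m × All (_> l) m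
strict-∷ʳ []          L       = [] , []
strict-∷ʳ (c ∷ [])    (p ∷ L) = [-] , p ∷ []
strict-∷ʳ (c ∷ d ∷ m) (p ∷ L) with strict-∷ʳ (d ∷ m) L
... | S , q ∷ qs = p ∷ S , ℕₚ.<-trans q p ∷ q ∷ qs

-- Separates the diagonal letter that equals the bound `K`; monotonicity leaves it no place but the
-- last.
split-last : ∀ K D → All (_≤ K) D → AllPairs _<_ D →
             All (_< K) D ⊎ (∃ λ D' → D ≡ D' ∷ʳ K × All (_< K) D' × AllPairs _<_ D')
split-last K []      _       _       = inj₁ []
split-last K (d ∷ D) (p ∷ b) (q ∷ i) with split-last K D b i
... | inj₂ (D' , ≡.refl , b' , i') = inj₂ (d ∷ D' , ≡.refl , last q ∷ b' , init q ∷ i')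
  where
  last : ∀ {D' d} → All (d <_) (D' ∷ʳ K) → d < K
  last {[]}    (q ∷ _) = q
  last {_ ∷ _} (_ ∷ q) = last q
  init : ∀ {D'} → All (d <_) (D' ∷ʳ K) → All (d <_) D'
  init {[]}    _       = []
  init {_ ∷ _} (q ∷ r) = q ∷ init r
... | inj₁ b' with ℕₚ.m≤n⇒m<n∨m≡n p
...   | inj₁ d<K = inj₁ (d<K ∷ b')
...   | inj₂ ≡.refl with D | q | b'
...     | []    | _     | _     = inj₂ ([] , ≡.refl , [] , [])
...     | _ ∷ _ | r ∷ _ | s ∷ _ = ⊥-elim (ℕₚ.<-asym r s)

-- Rows of a tableau and the copies of the largest letter in them

data Fits (K : ℕ) : List ℕ → List (List ℕ) → Set where
  []  : Fits K [] []
  row : ∀ {k w ks ws} → length w ≡ k → All (_< K) w → Fits K ks ws → Fits K (k ∷ ks) (w ∷ ws)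

-- Undoes the removal of a largest letter `K`: its copies can only occupy the end of a row, so the
-- row lengths before and after the removal determine all of them.
pad : ℕ → List ℕ → List ℕ → List (List ℕ) → List (List ℕ)
pad K (c ∷ cs) (k ∷ ks) (w ∷ ws) = (w ++ replicate (c ∸ k) K) ∷ pad K cs ks ws
pad K _        _        _        = []

-- Letters are natural numbers; pr marks the primed ones.
module Order (pr : ℕ → Bool) where

  -- `le` compares neighbours in a row, where only unprimed letters may repeat; `st` compares
  -- neighbours in a column, where only primed letters may repeat.
  le st : ℕ → ℕ → Bool
  le a b = (a <ᵇ b) ∨ ((a ≡ᵇ b) ∧ not (pr b))
  st a b = (a <ᵇ b) ∨ ((a ≡ᵇ b) ∧ pr b)

  link : ℕ → List ℕ → Bool
  link a []       = true
  link a (b ∷ bs) = le a b ∧ link b bs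

  -- `as` is the upper row without its diagonal box and `bs` the whole lower row: the shift puts a
  -- diagonal box under the second box of the row above. The value `false` for an overhanging `bs`
  -- builds the strict decrease of row lengths into the predicate.
  below? : List ℕ → List ℕ → Bool
  below? as       []       = true
  below? []       (b ∷ bs) = false
  below? (a ∷ as) (b ∷ bs) = st a b ∧ below? as bs

  next? : List ℕ → List ℕ → List (List ℕ) → Bool
  next? w []      []      = true
  next? w []      (_ ∷ _) = false
  next? w (_ ∷ _) []      = false
  next? w (e ∷ _) (v ∷ _) = below? w (e ∷ v)

  le-< : ∀ {a b} → a < b → le a b ≡ true
  le-< p rewrite <ᵇ-true p = ≡.refl

  st-< : ∀ {a b} → a < b → st a b ≡ true
  st-< p rewrite <ᵇ-true p = ≡.refl

  le-> : ∀ {a b} → b < a → le a b ≡ false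
  le-> {a} {b} p rewrite <ᵇ-false (ℕₚ.<⇒≤ p) | ≡ᵇ-false (ℕₚ.<⇒≢ p ∘ ≡.sym) = ≡.refl

  st-> : ∀ {a b} → b < a → st a b ≡ false
  st-> {a} {b} p rewrite <ᵇ-false (ℕₚ.<⇒≤ p) | ≡ᵇ-false (ℕₚ.<⇒≢ p ∘ ≡.sym) = ≡.refl

  le-refl : ∀ a → le a a ≡ not (pr a)
  le-refl a rewrite <ᵇ-false (ℕₚ.≤-refl {a}) | ≡ᵇ-refl a = ≡.refl

  st-refl : ∀ a → st a a ≡ pr a
  st-refl a rewrite <ᵇ-false (ℕₚ.≤-refl {a}) | ≡ᵇ-refl a = ≡.refl

  link-unprimed : ∀ {K} → pr K ≡ false → ∀ d v j → le d K ≡ true → All (_< K) v →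
                  link d (v ++ replicate j K) ≡ link d v
  link-unprimed {K} u d []      zero    p q = ≡.refl
  link-unprimed {K} u d []      (suc j) p q rewrite p = link-unprimed u K [] j (≡.trans (le-refl K) (≡.cong not u)) q
  link-unprimed {K} u d (a ∷ v) j       p (q ∷ qs) = ≡.cong (le d a ∧_) (link-unprimed u a v j (le-< q) qs)

  link-primed : ∀ {K} → pr K ≡ true → ∀ d v j → le d K ≡ true → All (_< K) v →
                link d (v ++ replicate j K) ≡ link d v ∧ (j <ᵇ 2)
  link-primed {K} u d []      0       p q = ≡.refl
  link-primed {K} u d []      1       p q rewrite p = ≡.refl
  link-primed {K} u d []      (suc (suc j)) p q rewrite p | le-refl K | u = ≡.refl
  link-primed {K} u d (a ∷ v) j       p (q ∷ qs) rewrite link-primed u a v j (le-< q) qs = ≡.sym (∧-assoc (le d a) _ _)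

  -- How many of the `j` copies of `K` ending an upper row can have another `K` below them.
  slack : ℕ → ℕ → ℕ
  slack K j = if pr K then j else 0

  below-replicate : ∀ K i j → below? (replicate j K) (replicate i K) ≡ (i <ᵇ suc (slack K j))
  below-replicate K zero    j       = ≡.refl
  below-replicate K (suc i) zero    with pr K
  ... | true  = ≡.refl
  ... | false = ≡.refl
  below-replicate K (suc i) (suc j) with below-replicate K i j
  ... | ih rewrite st-refl K with pr K
  ...   | true  = ih
  ...   | false = ≡.refl

  below-pad[] : ∀ K u i j → All (_< K) u → below? (u ++ replicate j K) (replicate i K) ≡ (i <ᵇ suc (length u ℕ.+ slack K j))
  below-pad[] K []      i       j q        = below-replicate K i j
  below-pad[] K (a ∷ u) zero    j q        = ≡.refl
  below-pad[] K (a ∷ u) (suc i) j (q ∷ qs) rewrite st-< q = below-pad[] K u i j qs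

  -- No letter of `v` may stand under a `K`, so `v` has to fit under `u` alone. The copies of `K` in
  -- the lower row may stand under letters of `u`, and under other copies of `K` only if `K` is
  -- primed; this is a condition on lengths.
  below-pad : ∀ K u v i j → All (_< K) u → All (λ b → st K b ≡ false) v →
              below? (u ++ replicate j K) (v ++ replicate i K) ≡
              below? u v ∧ (length v ℕ.+ i <ᵇ suc (length u ℕ.+ slack K j))
  below-pad K u       []      i j       q        r        = below-pad[] K u i j q
  below-pad K []      (b ∷ v) i zero    q        r        = ≡.refl
  below-pad K []      (b ∷ v) i (suc j) q        (r ∷ rs) rewrite r = ≡.refl
  below-pad K (a ∷ u) (b ∷ v) i j       (q ∷ qs) (r ∷ rs) rewrite below-pad K u v i j qs rs = ≡.sym (∧-assoc (st a b) _ _)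

  below-short : ∀ u v → length u < length v → below? u v ≡ false
  below-short []      (b ∷ v) p       = ≡.refl
  below-short (a ∷ u) (b ∷ v) (s≤s p) rewrite below-short u v p = ∧-zeroʳ _

  link-descent : ∀ {K x} d u z → x < K → link d (u ++ K ∷ x ∷ z) ≡ false
  link-descent {K} {x} d []      z p rewrite le-> p = ∧-zeroʳ _
  link-descent         d (y ∷ u) z p rewrite link-descent y u z p = ∧-zeroʳ _

-- Sums over fillings with a prescribed diagonal, and removal of the largest letter

module Tableaux {c ℓ} (R : CommutativeRing c ℓ) (pr : ℕ → Bool) (w : ℕ → CommutativeRing.Carrier R) where
  open CommutativeRing R hiding (zero)
  open import Algebra.Properties.Ring ring
  open import Algebra.Solver.Ring.NaturalCoefficients.Default commutativeSemiring using (solve; _:=_; _:+_; _:*_)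
  open import Relation.Binary.Reasoning.Setoid setoid
  open Sums R
  open Order pr

  -- The top index comes last, so that passing from `suc K` letters to `K` splits off the largest
  -- letter by definition.
  Σ< : ℕ → (ℕ → Carrier) → Carrier
  Σ< zero    f = 0#
  Σ< (suc K) f = Σ< K f + f K

  Σ<-cong : ∀ K {f g} → (∀ k → k < K → f k ≈ g k) → Σ< K f ≈ Σ< K g
  Σ<-cong zero    e = refl
  Σ<-cong (suc K) e = +-cong (Σ<-cong K (λ k p → e k (ℕₚ.m≤n⇒m≤1+n p))) (e K ℕₚ.≤-refl)

  Σ<-zero : ∀ K {f} → (∀ k → k < K → f k ≈ 0#) → Σ< K f ≈ 0#
  Σ<-zero zero    e = refl
  Σ<-zero (suc K) e = trans (+-cong (Σ<-zero K (λ k p → e k (ℕₚ.m≤n⇒m≤1+n p))) (e K ℕₚ.≤-refl)) (+-identityˡ _)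

  Σ<-+ : ∀ K f g → Σ< K (λ k → f k + g k) ≈ Σ< K f + Σ< K g
  Σ<-+ zero    f g = sym (+-identityˡ _)
  Σ<-+ (suc K) f g = trans (+-congʳ (Σ<-+ K f g)) (+-interchange _ _ _ _)

  Σ<-*ˡ : ∀ K x f → Σ< K (λ k → x * f k) ≈ x * Σ< K f
  Σ<-*ˡ zero    x f = sym (zeroʳ x)
  Σ<-*ˡ (suc K) x f = trans (+-congʳ (Σ<-*ˡ K x f)) (sym (distribˡ _ _ _))

  Words : ℕ → ℕ → (List ℕ → Carrier) → Carrier
  Words K zero    F = F []
  Words K (suc m) F = Σ< K (λ x → Words K m (λ v → F (x ∷ v)))

  Words-cong : ∀ K m {F G} → (∀ v → length v ≡ m → All (_< K) v → F v ≈ G v) → Words K m F ≈ Words K m G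
  Words-cong K zero    e = e [] ≡.refl []
  Words-cong K (suc m) e = Σ<-cong K λ x p → Words-cong K m λ v l q → e (x ∷ v) (≡.cong suc l) (p ∷ q)

  Words-zero : ∀ K m {F} → (∀ v → length v ≡ m → All (_< K) v → F v ≈ 0#) → Words K m F ≈ 0#
  Words-zero K zero    e = e [] ≡.refl []
  Words-zero K (suc m) e = Σ<-zero K λ x p → Words-zero K m λ v l q → e (x ∷ v) (≡.cong suc l) (p ∷ q)

  Words-+ : ∀ K m F G → Words K m (λ v → F v + G v) ≈ Words K m F + Words K m G
  Words-+ K zero    F G = refl
  Words-+ K (suc m) F G = trans (Σ<-cong K (λ x _ → Words-+ K m _ _)) (Σ<-+ K _ _)

  Words-*ˡ : ∀ K m x F → Words K m (λ v → x * F v) ≈ x * Words K m F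
  Words-*ˡ K zero    x F = refl
  Words-*ˡ K (suc m) x F = trans (Σ<-cong K (λ y _ → Words-*ˡ K m x _)) (Σ<-*ˡ K x _)

  Words-Σ≤ : ∀ K m (F : List ℕ → ℕ → Carrier) n → Words K m (λ v → Σ≤ (F v) n) ≈ Σ≤ (λ k → Words K m (λ v → F v k)) n
  Words-Σ≤ K m F zero    = refl
  Words-Σ≤ K m F (suc n) = trans (Words-+ K m _ _) (+-congʳ (Words-Σ≤ K m F n))

  Words-constant : ∀ K m F → (∀ j x z → x < K → F (replicate j K ++ K ∷ x ∷ z) ≈ 0#) →
                   Words (suc K) m (λ v → F (K ∷ v)) ≈ F (replicate (suc m) K)
  Words-constant K zero    F e = refl
  Words-constant K (suc m) F e =
    trans (+-cong (Σ<-zero K (λ x p → Words-zero (suc K) m (λ v _ _ → e 0 x v p)))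
                  (Words-constant K m (λ v → F (K ∷ v)) (λ j → e (suc j))))
          (+-identityˡ _)

  -- By the hypothesis the largest letter `K` can only fill the end of a word, and `k` counts the
  -- letters in front of it. A word that starts with `K` is constant; it is the term `k = 0` that
  -- `Σ≤-head` splits off.
  Words-peel : ∀ K m F → (∀ u x z → x < K → F (u ++ K ∷ x ∷ z) ≈ 0#) →
               Words (suc K) m F ≈ Σ≤ (λ k → Words K k (λ v → F (v ++ replicate (m ∸ k) K))) m
  Words-peel K zero    F e = refl
  Words-peel K (suc m) F e = begin
    Σ< K (λ x → Words (suc K) m (λ v → F (x ∷ v))) + Words (suc K) m (λ v → F (K ∷ v))
      ≈⟨ +-cong (Σ<-cong K (λ x _ → Words-peel K m _ (λ u → e (x ∷ u)))) (Words-constant K m F (λ j → e (replicate j K))) ⟩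
    Σ< K (λ x → Σ≤ (λ k → Words K k (λ v → F (x ∷ v ++ replicate (m ∸ k) K))) m) + F (replicate (suc m) K)
      ≈⟨ +-comm _ _ ⟩
    F (replicate (suc m) K) + Σ< K (λ x → Σ≤ (λ k → Words K k (λ v → F (x ∷ v ++ replicate (m ∸ k) K))) m)
      ≈⟨ +-congˡ (swap< K (λ x k → Words K k (λ v → F (x ∷ v ++ replicate (m ∸ k) K))) m) ⟩
    F (replicate (suc m) K) + Σ≤ (λ k → Words K (suc k) (λ v → F (v ++ replicate (m ∸ k) K))) m
      ≈⟨ Σ≤-head _ m ⟨
    Σ≤ (λ k → Words K k (λ v → F (v ++ replicate (suc m ∸ k) K))) (suc m) ∎
    where
    swap< : ∀ K (f : ℕ → ℕ → Carrier) n → Σ< K (λ x → Σ≤ (f x) n) ≈ Σ≤ (λ k → Σ< K (λ x → f x k)) n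
    swap< K f zero    = refl
    swap< K f (suc n) = trans (Σ<-+ K _ _) (+-congʳ (swap< K f n))

  Rows : ℕ → List ℕ → (List (List ℕ) → Carrier) → Carrier
  Rows K []      F = F []
  Rows K (k ∷ m) F = Words K k (λ v → Rows K m (λ vs → F (v ∷ vs)))

  Rows-cong : ∀ K m {F G} → (∀ vs → Fits K m vs → F vs ≈ G vs) → Rows K m F ≈ Rows K m G
  Rows-cong K []      e = e [] []
  Rows-cong K (k ∷ m) e = Words-cong K k λ v l b → Rows-cong K m λ vs f → e (v ∷ vs) (row l b f)

  Rows-zero : ∀ K m {F} → (∀ vs → Fits K m vs → F vs ≈ 0#) → Rows K m F ≈ 0#
  Rows-zero K []      e = e [] []
  Rows-zero K (k ∷ m) e = Words-zero K k λ v l b → Rows-zero K m λ vs f → e (v ∷ vs) (row l b f)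

  Rows-*ˡ : ∀ K m x F → Rows K m (λ vs → x * F vs) ≈ x * Rows K m F
  Rows-*ˡ K []      x F = refl
  Rows-*ˡ K (k ∷ m) x F = trans (Words-cong K k (λ v _ _ → Rows-*ˡ K m x _)) (Words-*ˡ K k x _)

  Rows-∷ʳ : ∀ K m l F → Rows K (m ∷ʳ l) F ≈ Rows K m (λ vs → Words K l (λ v → F (vs ∷ʳ v)))
  Rows-∷ʳ K []      l F = refl
  Rows-∷ʳ K (k ∷ m) l F = Words-cong K k λ v _ _ → Rows-∷ʳ K m l _

  Below : List ℕ → (List ℕ → Carrier) → Carrier
  Below []      F = F []
  Below (k ∷ m) F = Σ≤ (λ i → Below m (λ is → F (i ∷ is))) k

  Below-cong : ∀ m {F G} → (∀ ks → Pointwise _≤_ ks m → F ks ≈ G ks) → Below m F ≈ Below m G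
  Below-cong []      e = e [] []
  Below-cong (k ∷ m) e = Σ≤-cong≤ k λ i p → Below-cong m λ is ps → e (i ∷ is) (p ∷ ps)

  Below-*ˡ : ∀ m x F → Below m (λ ks → x * F ks) ≈ x * Below m F
  Below-*ˡ []      x F = refl
  Below-*ˡ (k ∷ m) x F = trans (Σ≤-cong k (λ i → Below-*ˡ m x _)) (Σ≤-*ˡ x _ k)

  Words-Below : ∀ K n m (F : List ℕ → List ℕ → Carrier) →
                Words K n (λ v → Below m (F v)) ≈ Below m (λ ks → Words K n (λ v → F v ks))
  Words-Below K n []      F = refl
  Words-Below K n (k ∷ m) F = trans (Words-Σ≤ K n _ k) (Σ≤-cong k (λ i → Words-Below K n m _))

  Rows-peel : ∀ K m F → (∀ pre u x z post → x < K → F (pre ++ (u ++ K ∷ x ∷ z) ∷ post) ≈ 0#) →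
              Rows (suc K) m F ≈ Below m (λ ks → Rows K ks (λ vs → F (pad K m ks vs)))
  Rows-peel K []      F e = refl
  Rows-peel K (k ∷ m) F e = begin
    Words (suc K) k (λ v → Rows (suc K) m (λ vs → F (v ∷ vs)))
      ≈⟨ Words-peel K k _ (λ u x z p → Rows-zero (suc K) m (λ vs _ → e [] u x z vs p)) ⟩
    Σ≤ (λ i → Words K i (λ v → Rows (suc K) m (λ vs → F ((v ++ replicate (k ∸ i) K) ∷ vs)))) k
      ≈⟨ Σ≤-cong k (λ i → trans (Words-cong K i (λ v _ _ → Rows-peel K m _ (λ pre → e (_ ∷ pre)))) (Words-Below K i m _)) ⟩
    Σ≤ (λ i → Below m (λ is → Words K i (λ v → Rows K is (λ vs → F ((v ++ replicate (k ∸ i) K) ∷ pad K m is vs))))) k ∎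

  ind : Bool → Carrier
  ind b = if b then 1# else 0#

  ind-∧ : ∀ b b' → ind (b ∧ b') ≈ ind b * ind b'
  ind-∧ true  b' = sym (*-identityˡ _)
  ind-∧ false b' = sym (zeroˡ _)

  wordWgt : List ℕ → Carrier
  wordWgt = foldr (λ x r → w x * r) 1#

  -- The first argument lists the diagonal letters, the second the rest of each row.
  val : List ℕ → List (List ℕ) → Carrier
  val []       []       = 1#
  val (d ∷ ds) (v ∷ vs) = (ind (link d v ∧ next? v ds vs) * wordWgt v) * val ds vs
  val _        _        = 0#

  S : ℕ → List ℕ → List ℕ → Carrier
  S K D m = Rows K m (val D)

  ser : ℕ → ℕ → Carrier
  ser K = if pr K then linU R (w K) else geomU R (w K)

  gap : List ℕ → ℕ → Bool
  gap []      x = true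
  gap (d ∷ _) x = d <ᵇ x

  -- The number of off-diagonal boxes of a row under which the next row may extend: the new length
  -- `c` for a primed letter, the old length `k` for an unprimed one. The strict inequality in `gap`
  -- leaves room for the diagonal box of the next row.
  reach : ℕ → ℕ → ℕ → ℕ
  reach K c k = if pr K then c else k

  -- The transfer weight from row lengths `ks` to row lengths after adding all copies of `K`. For an
  -- unprimed `K` the factor `gap` is the horizontal strip condition; for a primed `K` the vertical
  -- strip condition sits in `ser`, whose coefficients vanish from degree two on.
  coef : ℕ → List ℕ → List ℕ → Carrier
  coef K []       []       = 1#
  coef K (c ∷ cs) (k ∷ ks) = (ind (gap cs (reach K c k)) * ser K (c ∸ k)) * coef K cs ks
  coef K _        _        = 0#

  wordWgt-pad : ∀ K v j → wordWgt (v ++ replicate j K) ≈ wordWgt v * pow R (w K) j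
  wordWgt-pad K []      zero    = sym (*-identityˡ _)
  wordWgt-pad K []      (suc j) = trans (*-congˡ (trans (wordWgt-pad K [] j) (*-identityˡ _))) (sym (*-identityˡ _))
  wordWgt-pad K (x ∷ v) j       = trans (*-congˡ (wordWgt-pad K v j)) (sym (*-assoc _ _ _))

  link-pad : ∀ K d v j → le d K ≡ true → All (_< K) v →
             ind (link d (v ++ replicate j K)) * pow R (w K) j ≈ ind (link d v) * ser K j
  link-pad K d v j p q = go (pr K) ≡.refl
    where
    lin : ∀ j → ind (j <ᵇ 2) * pow R (w K) j ≈ linU R (w K) j
    lin zero          = *-identityˡ _
    lin (suc zero)    = trans (*-identityˡ _) (*-identityʳ _)
    lin (suc (suc j)) = zeroˡ _
    go : ∀ b → pr K ≡ b → ind (link d (v ++ replicate j K)) * pow R (w K) j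
                        ≈ ind (link d v) * (if b then linU R (w K) else geomU R (w K)) j
    go false u rewrite link-unprimed u d v j p q = refl
    go true  u rewrite link-primed u d v j p q = trans (*-congʳ (ind-∧ _ _)) (trans (*-assoc _ _ _) (*-congˡ (lin j)))

  -- What an unprimed diagonal letter `d` up to and including `K` satisfies: a `K` may stand to its
  -- right, and `d` may not stand under a `K`.
  Diag : ℕ → ℕ → Set
  Diag K d = le d K ≡ true × st K d ≡ false

  next-pad : ∀ K {c k cs ks v vs} ds → k ≤ c → Pointwise _≤_ ks cs → Fits K (k ∷ ks) (v ∷ vs) → All (Diag K) ds →
             next? (v ++ replicate (c ∸ k) K) ds (pad K cs ks vs) ≡ next? v ds vs ∧ gap cs (reach K c k)
  next-pad K []      p []        (row l b [])            D = ≡.refl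
  next-pad K []      p (q ∷ qs)  (row l b (row l' b' f)) D = ≡.refl
  next-pad K (e ∷ _) p []        (row l b [])            D = ≡.refl
  next-pad K {c} {k} {c' ∷ _} {k' ∷ _} {v} {v' ∷ _} (e ∷ _) p (q ∷ qs) (row l b (row l' b' f)) (D ∷ _) =
    ≡.trans (below-pad K v (e ∷ v') (c' ∸ k') (c ∸ k) b (proj₂ D ∷ All.map st-> b'))
            (≡.cong (below? v (e ∷ v') ∧_) (≡.cong₂ _<ᵇ_ (≡.trans (≡.cong (ℕ._+ (c' ∸ k')) l') (ℕₚ.m+[n∸m]≡n q)) rch))
    where
    rch : length v ℕ.+ slack K (c ∸ k) ≡ reach K c k
    rch with pr K
    ... | true  = ≡.trans (≡.cong (ℕ._+ (c ∸ k)) l) (ℕₚ.m+[n∸m]≡n p)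
    ... | false = ≡.trans (ℕₚ.+-identityʳ _) l

  -- Given legal rows in smaller letters, whether copies of `K` can be added depends only on the row
  -- lengths, and so does their weight. Both therefore leave the value as a factor.
  val-pad : ∀ K D m ks vs → Pointwise _≤_ ks m → Fits K ks vs → All (Diag K) D →
            val D (pad K m ks vs) ≈ coef K m ks * val D vs
  val-pad K []      []      []       []       []       []            q        = sym (*-identityˡ _)
  val-pad K []      (c ∷ m) (k ∷ ks) (v ∷ vs) (p ∷ ps) f             q        = sym (zeroʳ _)
  val-pad K (d ∷ D) []      []       []       []       []            q        = sym (zeroʳ _)
  val-pad K (d ∷ D) (c ∷ m) (k ∷ ks) (v ∷ vs) (p ∷ ps) (row l b f) (q ∷ qs) = begin
    (ind (link d (v ++ replicate (c ∸ k) K) ∧ next? (v ++ replicate (c ∸ k) K) D (pad K m ks vs)) * wordWgt (v ++ replicate (c ∸ k) K))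
      * val D (pad K m ks vs)
      ≡⟨ ≡.cong (λ t → (ind (link d (v ++ replicate (c ∸ k) K) ∧ t) * wordWgt (v ++ replicate (c ∸ k) K)) * val D (pad K m ks vs))
                (next-pad K D p ps (row l b f) qs) ⟩
    (ind (link d (v ++ replicate (c ∸ k) K) ∧ (next? v D vs ∧ γ)) * wordWgt (v ++ replicate (c ∸ k) K)) * val D (pad K m ks vs)
      ≈⟨ *-cong (*-cong (trans (ind-∧ _ _) (*-congˡ (ind-∧ _ _))) (wordWgt-pad K v (c ∸ k))) (val-pad K D m ks vs ps f qs) ⟩
    ((ind (link d (v ++ replicate (c ∸ k) K)) * (ind (next? v D vs) * ind γ)) * (wordWgt v * pow R (w K) (c ∸ k))) * (coef K m ks * val D vs)
      -- The power of `w K` is brought next to the row condition: for a primed letter only their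
      -- product yields a coefficient of `ser K`.
      ≈⟨ solve 7 (λ x n t ω π κ y → ((x :* (n :* t)) :* (ω :* π)) :* (κ :* y) := (x :* π) :* ((n :* t) :* (ω :* (κ :* y)))) refl _ _ _ _ _ _ _ ⟩
    (ind (link d (v ++ replicate (c ∸ k) K)) * pow R (w K) (c ∸ k)) * ((ind (next? v D vs) * ind γ) * (wordWgt v * (coef K m ks * val D vs)))
      ≈⟨ *-congʳ (link-pad K d v (c ∸ k) (proj₁ q) b) ⟩
    (ind (link d v) * ser K (c ∸ k)) * ((ind (next? v D vs) * ind γ) * (wordWgt v * (coef K m ks * val D vs)))
      ≈⟨ solve 7 (λ x n t ω σ κ y → (x :* σ) :* ((n :* t) :* (ω :* (κ :* y))) := ((t :* σ) :* κ) :* (((x :* n) :* ω) :* y)) refl _ _ _ _ _ _ _ ⟩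
    ((ind γ * ser K (c ∸ k)) * coef K m ks) * (((ind (link d v) * ind (next? v D vs)) * wordWgt v) * val D vs)
      ≈⟨ *-congˡ (*-congʳ (*-congʳ (ind-∧ _ _))) ⟨
    ((ind γ * ser K (c ∸ k)) * coef K m ks) * ((ind (link d v ∧ next? v D vs) * wordWgt v) * val D vs) ∎
    where γ = gap m (reach K c k)

  ind*-zero : ∀ {b x y} → b ≡ false → (ind b * x) * y ≈ 0#
  ind*-zero ≡.refl = trans (*-congʳ (zeroˡ _)) (zeroˡ _)

  val-descent : ∀ K D pre u x z post → x < K → val D (pre ++ (u ++ K ∷ x ∷ z) ∷ post) ≈ 0#
  val-descent K []      []      u x z post p = refl
  val-descent K []      (_ ∷ _) u x z post p = refl
  val-descent K (d ∷ D) []      u x z post p = ind*-zero (≡.cong (_∧ next? (u ++ K ∷ x ∷ z) D post) (link-descent d u z p))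
  val-descent K (d ∷ D) (_ ∷ pre) u x z post p = trans (*-congˡ (val-descent K D pre u x z post p)) (zeroʳ _)

  S-peel : ∀ K D m → All (Diag K) D → S (suc K) D m ≈ Below m (λ ks → coef K m ks * S K D ks)
  S-peel K D m q = trans (Rows-peel K m (val D) (val-descent K D))
    (Below-cong m λ ks ps → trans (Rows-cong K ks λ vs f → val-pad K D m ks vs ps f q) (Rows-*ˡ K ks _ _))

  -- With its diagonal box the lower row has `k + 1` boxes, but only `k` off-diagonal boxes lie
  -- above them.
  S-repeat : ∀ K D pre k post → S K D (pre ++ k ∷ k ∷ post) ≈ 0#
  S-repeat K D pre k post = Rows-zero K (pre ++ k ∷ k ∷ post) (go D pre)
    where
    go : ∀ D pre vs → Fits K (pre ++ k ∷ k ∷ post) vs → val D vs ≈ 0#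
    go []          []        (v ∷ vs)      f = refl
    go []          (_ ∷ pre) (v ∷ vs)      f = refl
    go (d ∷ D)     []        (v ∷ [])      (row _ _ ())
    go (d ∷ [])    []        (v ∷ v' ∷ vs) f = ind*-zero (∧-zeroʳ _)
    go (d ∷ e ∷ D) []        (v ∷ v' ∷ vs) (row ≡.refl b (row l' b' f)) =
      ind*-zero (≡.trans (≡.cong (link d v ∧_) (below-short v (e ∷ v') (s≤s (ℕₚ.≤-reflexive (≡.sym l'))))) (∧-zeroʳ _))
    go (d ∷ D)     (_ ∷ pre) (v ∷ vs)      (row l b f) = trans (*-congˡ (go D pre vs f)) (zeroʳ _)

  -- A last row that is just the diagonal box `K` fits under every filling in smaller letters: if
  -- there is a previous row, it has an off-diagonal box because the parts of `m` are positive, and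
  -- that box holds a letter smaller than `K`.
  S-last-0 : ∀ K D m → length D ≡ length m → All (_≥ 1) m → S K (D ∷ʳ K) (m ∷ʳ 0) ≈ S K D m
  S-last-0 K D m e q = trans (Rows-∷ʳ K m 0 _) (Rows-cong K m λ vs f → go D m vs e q f)
    where
    next-last : ∀ D m v vs → length D ≡ length m → Fits K m vs → length v ≥ 1 → All (_< K) v →
                next? v (D ∷ʳ K) (vs ∷ʳ []) ≡ next? v D vs
    next-last []      []      (x ∷ v) []       e [] q (b ∷ _) rewrite st-< b = ≡.refl
    next-last (_ ∷ _) (_ ∷ _) v       (_ ∷ _)  e f  q b       = ≡.refl
    go : ∀ D m vs → length D ≡ length m → All (_≥ 1) m → Fits K m vs → val (D ∷ʳ K) (vs ∷ʳ []) ≈ val D vs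
    go []      []      []       e q        []          = trans (*-identityʳ _) (*-identityʳ _)
    go (d ∷ D) (k ∷ m) (v ∷ vs) e (q ∷ qs) (row ≡.refl b f)
      rewrite next-last D m v vs (ℕₚ.suc-injective e) f q b = *-congˡ (go D m vs (ℕₚ.suc-injective e) qs f)

  -- A letter to the right of the diagonal entry `K` would have to be at least `K`, but only smaller
  -- letters are left.
  S-last-suc : ∀ K D m l → length D ≡ length m → S K (D ∷ʳ K) (m ∷ʳ suc l) ≈ 0#
  S-last-suc K D m l e = trans (Rows-∷ʳ K m (suc l) _)
    (Rows-zero K m λ vs f → Words-zero K (suc l) {λ v → val (D ∷ʳ K) (vs ∷ʳ v)} λ { (x ∷ v) _ (b ∷ _) → go D m vs x v e f b })
    where
    go : ∀ D m vs x v → length D ≡ length m → Fits K m vs → x < K → val (D ∷ʳ K) (vs ∷ʳ (x ∷ v)) ≈ 0#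
    go []      []      []       x v e []          b rewrite le-> b = ind*-zero ≡.refl
    go (d ∷ D) (k ∷ m) (u ∷ vs) x v e (row _ _ f) b = trans (*-congˡ (go D m vs x v (ℕₚ.suc-injective e) f b)) (zeroʳ _)

  -- Determinants with a prescribed diagonal

  δ : ℕ → Carrier
  δ = cU R 1#

  -- The product of the factors of the letters from `d` up to, but excluding, `K`: those that may
  -- stand to the right of the diagonal letter `d`. It starts at `d` itself because an unprimed
  -- letter may repeat in its row.
  series : ℕ → ℕ → ℕ → Carrier
  series d zero    = δ
  series d (suc K) = if d ≤ᵇ K then conv (series d K) (ser K) else δ

  Det : ℕ → List ℕ → Φ
  Det K D = detL (map (λ d → series d K) D)

  series-suc : ∀ {d K} → d ≤ K → series d (suc K) ≡ conv (series d K) (ser K)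
  series-suc p rewrite Equivalence.to T-≡ (ℕₚ.≤⇒≤ᵇ p) = ≡.refl

  series-self : ∀ K → series K K ≡ δ
  series-self zero = ≡.refl
  series-self (suc K) rewrite <ᵇ-false (ℕₚ.≤-refl {K}) = ≡.refl

  Det-suc : ∀ K D → All (_≤ K) D → Det (suc K) D ≡ detL (map (λ a → conv a (ser K)) (map (λ d → series d K) D))
  Det-suc K D b = ≡.cong detL (go D b)
    where
    go : ∀ D → All (_≤ K) D → map (λ d → series d (suc K)) D ≡ map (λ a → conv a (ser K)) (map (λ d → series d K) D)
    go []      []       = ≡.refl
    go (d ∷ D) (b ∷ bs) = ≡.cong₂ _∷_ (series-suc b) (go D bs)

  -- The tableau recursion in the shape of `scale`, so that the two differ only by the strip
  -- condition.
  scaleGap : ℕ → Φ → Φ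
  scaleGap K φ []       = φ []
  scaleGap K φ (c ∷ cs) = Σ≤ (λ k → (ind (gap cs (reach K c k)) * ser K (c ∸ k)) * scaleGap K (slice k φ) cs) c

  scaleGap-Below : ∀ K φ m → scaleGap K φ m ≈ Below m (λ ks → coef K m ks * φ ks)
  scaleGap-Below K φ []       = sym (*-identityˡ _)
  scaleGap-Below K φ (c ∷ cs) = Σ≤-cong c λ k → trans (*-congˡ (scaleGap-Below K (slice k φ) cs))
    (trans (sym (Below-*ˡ cs _ _)) (Below-cong cs λ ks _ → sym (*-assoc _ _ _)))

  pow-+ : ∀ x i j → pow R x (i ℕ.+ j) ≈ pow R x i * pow R x j
  pow-+ x zero    j = sym (*-identityˡ _)
  pow-+ x (suc i) j = trans (*-congˡ (pow-+ x i j)) (sym (*-assoc _ _ _))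

  -- For an unprimed letter the terms with k ≤ d add up to a multiple of the value at the
  -- repeated column d, d, which vanishes; what remains is the horizontal strip condition.
  scale-gap : ∀ K {φ} m → Alternating φ → Linked _>_ m → scale (ser K) φ m ≈ scaleGap K φ m
  scale-gap K []           A L       = refl
  scale-gap K (c ∷ [])     A L       = Σ≤-cong c λ k → *-congʳ (sym (*-identityˡ _))
  scale-gap K {φ} (c ∷ d ∷ cs) A (p ∷ L) =
    trans main (Σ≤-cong c λ k → *-congˡ (scale-gap K (d ∷ cs) (slice-alternating k A) L))
    where
    X : ℕ → Carrier
    X k = scale (ser K) (slice k φ) (d ∷ cs)
    main : Σ≤ (λ k → ser K (c ∸ k) * X k) c ≈ Σ≤ (λ k → (ind (d <ᵇ reach K c k) * ser K (c ∸ k)) * X k) c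
    main = go (pr K) ≡.refl
      where
      lhs rhs : ℕ → Carrier
      lhs k = ser K (c ∸ k) * X k
      rhs k = (ind (d <ᵇ k) * ser K (c ∸ k)) * X k
      ser-pow : pr K ≡ false → ∀ j → ser K j ≡ pow R (w K) j
      ser-pow u j rewrite u = ≡.refl
      low : pr K ≡ false → Σ≤ lhs d ≈ 0#
      low u = begin
        Σ≤ lhs d
          ≈⟨ Σ≤-cong≤ d (λ k q → trans (*-congʳ (begin
               ser K (c ∸ k)
                 ≡⟨ ser-pow u (c ∸ k) ⟩
               pow R (w K) (c ∸ k)
                 ≡⟨ ≡.cong (pow R (w K)) (≡.trans (≡.cong (_∸ k) (≡.sym (ℕₚ.m∸n+n≡m (ℕₚ.<⇒≤ p)))) (ℕₚ.+-∸-assoc (c ∸ d) q)) ⟩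
               pow R (w K) ((c ∸ d) ℕ.+ (d ∸ k))
                 ≈⟨ pow-+ _ (c ∸ d) (d ∸ k) ⟩
               pow R (w K) (c ∸ d) * pow R (w K) (d ∸ k)
                 ≡⟨ ≡.cong (pow R (w K) (c ∸ d) *_) (ser-pow u (d ∸ k)) ⟨
               pow R (w K) (c ∸ d) * ser K (d ∸ k) ∎)) (*-assoc _ _ _)) ⟩
        Σ≤ (λ k → pow R (w K) (c ∸ d) * (ser K (d ∸ k) * X k)) d
          ≈⟨ Σ≤-*ˡ _ _ d ⟩
        pow R (w K) (c ∸ d) * Σ≤ (λ k → ser K (d ∸ k) * X k) d
          ≈⟨ trans (*-congˡ (scale-repeat (ser K) A d cs)) (zeroʳ _) ⟩
        0# ∎
      go : ∀ b → pr K ≡ b → Σ≤ lhs c ≈ Σ≤ (λ k → (ind (d <ᵇ (if b then c else k)) * ser K (c ∸ k)) * X k) c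
      -- For a primed letter the condition reads `d < c`, which is the strictness of the list.
      go true  u rewrite <ᵇ-true p = Σ≤-cong c λ k → *-congʳ (sym (*-identityˡ _))
      go false u = ≡.subst (λ t → Σ≤ lhs t ≈ Σ≤ rhs t) (ℕₚ.m+[n∸m]≡n (ℕₚ.<⇒≤ p))
          (trans (Σ≤-split lhs rhs d (c ∸ d)
                    (λ k q → ind*-zero (<ᵇ-false q))
                    (λ k q → *-congʳ (trans (*-congʳ (reflexive (≡.cong ind (<ᵇ-true q)))) (*-identityˡ _))))
                 (trans (+-congʳ (low u)) (+-identityˡ _)))

  -- This keeps the recursion among weakly decreasing lists. An unprimed strip gives `l ≤ d < k`. A
  -- primed strip shortens a row by at most one, so that `l ≤ d ≤ c - 1 ≤ k`, where equality can
  -- occur throughout.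
  coef-weak : ∀ K {ks m} → Pointwise _≤_ ks m → Linked _>_ m → Linked _≥_ ks ⊎ coef K m ks ≈ 0#
  coef-weak K []            L       = inj₁ []
  coef-weak K (_ ∷ [])      L       = inj₁ [-]
  coef-weak K {k ∷ l ∷ ks} {c ∷ d ∷ m} (p ∷ q ∷ qs) (r ∷ L) with coef-weak K (q ∷ qs) L
  ... | inj₂ z = inj₂ (trans (*-congˡ z) (zeroʳ _))
  ... | inj₁ W = go (pr K) ≡.refl
    where
    head-zero : ∀ {x y z} → x * y ≈ 0# → (x * y) * z ≈ 0#
    head-zero e = trans (*-congʳ e) (zeroˡ _)
    lin-zero : ∀ j → 2 ≤ j → linU R (w K) j ≈ 0#
    lin-zero (suc (suc j)) _ = refl
    lin-zero (suc zero) (s≤s ())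
    ser-lin : pr K ≡ true → ∀ j → ser K j ≡ linU R (w K) j
    ser-lin u j rewrite u = ≡.refl
    go : ∀ b → pr K ≡ b → Linked _≥_ (k ∷ l ∷ ks) ⊎
         (ind (d <ᵇ (if b then c else k)) * ser K (c ∸ k)) * coef K (d ∷ m) (l ∷ ks) ≈ 0#
    go false u with d ℕ.<? k
    ... | yes d<k = inj₁ (ℕₚ.<⇒≤ (ℕₚ.≤-<-trans q d<k) ∷ W)
    ... | no d≮k  = inj₂ (ind*-zero (<ᵇ-false (ℕₚ.≮⇒≥ d≮k)))
    go true u with (c ∸ k) ℕ.<? 2
    ... | no  j≮2 = inj₂ (head-zero (trans (*-congˡ (trans (reflexive (ser-lin u _)) (lin-zero _ (ℕₚ.≮⇒≥ j≮2)))) (zeroʳ _)))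
    ... | yes j<2 = inj₁ (ℕₚ.≤-trans q (ℕₚ.≤-pred (ℕₚ.≤-trans r (ℕₚ.≤-trans (ℕₚ.m≤n+m∸n c k)
                      (ℕₚ.≤-trans (ℕₚ.+-monoʳ-≤ k (ℕₚ.≤-pred j<2)) (ℕₚ.≤-reflexive (ℕₚ.+-comm k 1)))))) ∷ W)

  -- `Vanishing` and `Restricts` describe a form with last row `δ`: it needs a column 0, and a
  -- column 0 in final position is taken by that row.
  Vanishing : Φ → Set ℓ
  Vanishing φ = ∀ m → All (_≥ 1) m → φ m ≈ 0#

  Restricts : Φ → Φ → Set ℓ
  Restricts φ ψ = ∀ m → All (_≥ 1) m → φ (m ∷ʳ 0) ≈ ψ m

  wedge-vanishing : ∀ a {φ} → Vanishing φ → Vanishing (wedge a φ)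
  wedge-vanishing a v []      q        = refl
  wedge-vanishing a v (c ∷ m) (q ∷ qs) =
    trans (-‿cong₂ (trans (*-congˡ (v m qs)) (zeroʳ _)) (wedge-vanishing a (λ m' q' → v (c ∷ m') (q ∷ q')) m qs)) (-‿inverseʳ 0#)

  -- If `a` took the final column 0, only positive columns would be left to `φ`, which then
  -- vanishes; so the column 0 passes on to `φ`.
  wedge-restricts : ∀ a {φ ψ} → Vanishing φ → Restricts φ ψ → Restricts (wedge a φ) (wedge a ψ)
  wedge-restricts a v r []      q        = trans (-‿cong₂ (trans (*-congˡ (v [] [])) (zeroʳ _)) refl) (-‿inverseʳ 0#)
  wedge-restricts a v r (c ∷ m) (q ∷ qs) =
    -‿cong₂ (*-congˡ (r m qs)) (wedge-restricts a (λ m' q' → v (c ∷ m') (q ∷ q')) (λ m' q' → r (c ∷ m') (q ∷ q')) m qs)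

  δ-vanishing : Vanishing (wedge δ unit)
  δ-vanishing []          q = refl
  δ-vanishing (zero ∷ m) (() ∷ _)
  δ-vanishing (suc c ∷ m) q = trans (-‿cong₂ (zeroˡ _) (wedge-0ʳ δ (λ _ → refl) m)) (-‿inverseʳ 0#)

  δ-restricts : Restricts (wedge δ unit) unit
  δ-restricts []          q = trans (+-cong (*-identityʳ _) -0#≈0#) (+-identityʳ _)
  δ-restricts (zero ∷ m) (() ∷ _)
  δ-restricts (suc c ∷ m) q = trans (-‿cong₂ (zeroˡ _) (wedge-0ʳ δ (λ _ → refl) (m ∷ʳ 0))) (-‿inverseʳ 0#)

  Det-last : ∀ K D → Vanishing (Det K (D ∷ʳ K)) × Restricts (Det K (D ∷ʳ K)) (Det K D)
  Det-last K []      rewrite series-self K = δ-vanishing , δ-restricts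
  Det-last K (d ∷ D) with Det-last K D
  ... | v , r = wedge-vanishing _ v , wedge-restricts _ v r

  -- The induction on the largest letter

  private
    snoc-view : ∀ (xs : List ℕ) n → length xs ≡ suc n → ∃₂ λ ys y → xs ≡ ys ∷ʳ y × length ys ≡ n
    snoc-view (x ∷ [])     zero    e = [] , x , ≡.refl , ≡.refl
    snoc-view (x ∷ y ∷ xs) (suc n) e with snoc-view (y ∷ xs) n (ℕₚ.suc-injective e)
    ... | ys , z , eq , l = x ∷ ys , z , ≡.cong (x ∷_) eq , ≡.cong suc l

    length-snoc : ∀ (xs : List ℕ) {x} → length (xs ∷ʳ x) ≡ suc (length xs)
    length-snoc xs = ≡.trans (length-++ xs) (ℕₚ.+-comm _ 1)

  -- Peeling a letter off `S≈Det (suc K)` leads to `S≈Det-≤ K`, where a diagonal entry may equal the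
  -- new bound `K`. `S≈Det-strict` removes such an entry together with the last row and returns to
  -- `S≈Det K`, so the mutual recursion descends on `K`.
  S≈Det : ∀ K D m → All (_< K) D → All (λ d → pr d ≡ false) D → AllPairs _<_ D → length D ≡ length m → Linked _≥_ m →
          S K D m ≈ Det K D m
  S≈Det-≤ : ∀ K D m → All (_≤ K) D → All (λ d → pr d ≡ false) D → AllPairs _<_ D → length D ≡ length m → Linked _≥_ m →
            S K D m ≈ Det K D m
  S≈Det-strict : ∀ K D m → All (_≤ K) D → All (λ d → pr d ≡ false) D → AllPairs _<_ D → length D ≡ length m → Linked _>_ m →
                 S K D m ≈ Det K D m

  S≈Det zero    []      []      b u i e L = refl
  S≈Det zero    (_ ∷ _) m       (() ∷ _) u i e L
  S≈Det (suc K) D m b u i e L with repeat-or-strict L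
  ... | inj₂ (pre , k , post , ≡.refl) =
    trans (S-repeat (suc K) D pre k post) (sym (repeat (detL-alternating (map (λ d → series d (suc K)) D)) pre k post))
  ... | inj₁ L' = begin
    S (suc K) D m                                  ≈⟨ S-peel K D m (All.zipWith diag (b , u)) ⟩
    Below m (λ ks → coef K m ks * S K D ks)        ≈⟨ Below-cong m step ⟩
    Below m (λ ks → coef K m ks * Det K D ks)      ≈⟨ scaleGap-Below K (Det K D) m ⟨
    scaleGap K (Det K D) m                         ≈⟨ scale-gap K m (detL-alternating (map (λ d → series d K) D)) L' ⟨
    scale (ser K) (Det K D) m                      ≈⟨ scale-detL (ser K) (map (λ d → series d K) D) m ⟩
    detL (map (λ a → conv a (ser K)) (map (λ d → series d K) D)) m
                                                   ≡⟨ ≡.cong-app (Det-suc K D (All.map ℕₚ.≤-pred b)) m ⟨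
    Det (suc K) D m                                ∎
    where
    diag : ∀ {d} → d < suc K × pr d ≡ false → Diag K d
    diag {d} (p , u) with ℕₚ.m≤n⇒m<n∨m≡n (ℕₚ.≤-pred p)
    ... | inj₁ d<K    = le-< d<K , st-> d<K
    ... | inj₂ ≡.refl = ≡.trans (le-refl d) (≡.cong not u) , ≡.trans (st-refl d) u
    len : ∀ {ks m} → Pointwise _≤_ ks m → length ks ≡ length m
    len []       = ≡.refl
    len (_ ∷ ps) = ≡.cong suc (len ps)
    step : ∀ ks → Pointwise _≤_ ks m → coef K m ks * S K D ks ≈ coef K m ks * Det K D ks
    step ks ps with coef-weak K ps L'
    ... | inj₁ W = *-congˡ (S≈Det-≤ K D ks (All.map ℕₚ.≤-pred b) u i (≡.trans e (≡.sym (len ps))) W)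
    ... | inj₂ z = trans (*-congʳ z) (trans (zeroˡ _) (sym (trans (*-congʳ z) (zeroˡ _))))

  S≈Det-≤ K D m b u i e L with repeat-or-strict L
  ... | inj₂ (pre , k , post , ≡.refl) =
    trans (S-repeat K D pre k post) (sym (repeat (detL-alternating (map (λ d → series d K) D)) pre k post))
  ... | inj₁ L' = S≈Det-strict K D m b u i e L'

  S≈Det-strict K D m b u i e L with split-last K D b i
  ... | inj₁ b' = S≈Det K D m b' u i e (Linked.map ℕₚ.<⇒≤ L)
  ... | inj₂ (D' , ≡.refl , b' , i') with snoc-view m (length D') (≡.trans (≡.sym e) (length-snoc D'))
  -- The last part of a strict list is the smallest; if it is positive, all parts are, and both
  -- sides vanish.
  ...   | m' , suc l , ≡.refl , e' =
          trans (S-last-suc K D' m' l (≡.sym e')) (sym (proj₁ (Det-last K D') (m' ∷ʳ suc l) (positive m' (proj₂ (strict-∷ʳ m' L)))))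
    where
    positive : ∀ m' → All (_> suc l) m' → All (_≥ 1) (m' ∷ʳ suc l)
    positive []       _        = s≤s z≤n ∷ []
    positive (_ ∷ m') (p ∷ ps) = ℕₚ.≤-trans (s≤s z≤n) p ∷ positive m' ps
  ...   | m' , zero , ≡.refl , e' with strict-∷ʳ m' L
  ...     | L' , q = trans (S-last-0 K D' m' (≡.sym e') q)
             (trans (S≈Det K D' m' b' (unprimed D' u) i' (≡.sym e') (Linked.map ℕₚ.<⇒≤ L'))
                    (sym (proj₂ (Det-last K D') m' q)))
    where
    unprimed : ∀ D' → All (λ d → pr d ≡ false) (D' ∷ʳ K) → All (λ d → pr d ≡ false) D'
    unprimed []       _        = []
    unprimed (_ ∷ D') (p ∷ ps) = p ∷ unprimed D' ps

-- Coefficient extraction from the determinant of power series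

update : ∀ {m} → (Fin m → ℕ) → Fin m → ℕ → Fin m → ℕ
update e zero    x zero    = x
update e zero    x (suc i) = e (suc i)
update e (suc l) x zero    = e zero
update e (suc l) x (suc i) = update (e ∘ suc) l x i

update-≡ : ∀ {m} (e : Fin m → ℕ) l x → update e l x l ≡ x
update-≡ e zero    x = ≡.refl
update-≡ e (suc l) x = update-≡ (e ∘ suc) l x

update-≢ : ∀ {m} (e : Fin m → ℕ) {l i} x → l ≢ i → update e l x i ≡ e i
update-≢ e {zero}  {zero}  x p = ⊥-elim (p ≡.refl)
update-≢ e {zero}  {suc i} x p = ≡.refl
update-≢ e {suc l} {zero}  x p = ≡.refl
update-≢ e {suc l} {suc i} x p = update-≢ (e ∘ suc) x (p ∘ ≡.cong suc)

module Coefficients {c ℓ} (R : CommutativeRing c ℓ) where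
  open CommutativeRing R hiding (zero)
  open import Algebra.Properties.Ring ring
  open import Relation.Binary.Reasoning.Setoid setoid
  open Sums R

  ∑-tabulate-suc : ∀ k (F : Fin (suc k) → Carrier) → ∑ (tabulate suc) F ≡ ∑ (allFin k) (F ∘ suc)
  ∑-tabulate-suc k F = ≡.trans (≡.cong (λ t → ∑ t F) (≡.sym (map-tabulate id suc))) (∑-map suc (allFin k) F)

  Σ≤-first : ∀ (F : ℕ → Carrier) n → (∀ i → F (suc i) ≈ 0#) → Σ≤ F n ≈ F 0
  Σ≤-first F zero    z = refl
  Σ≤-first F (suc n) z = trans (+-cong (Σ≤-first F n z) (z n)) (+-identityʳ _)

  Σ≤-last : ∀ (F : ℕ → Carrier) n → (∀ i → i < n → F i ≈ 0#) → Σ≤ F n ≈ F n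
  Σ≤-last F zero    z = refl
  Σ≤-last F (suc n) z = trans (+-congʳ (Σ≤-zero n (λ k p → z k (s≤s p)))) (+-identityˡ _)

  coeff-add : ∀ m (s t : Ser R m) e → coeff R m (addS R m s t) e ≈ coeff R m s e + coeff R m t e
  coeff-add zero    s t e = refl
  coeff-add (suc m) s t e = coeff-add m (s (e zero)) (t (e zero)) (e ∘ suc)

  coeff-neg : ∀ m (s : Ser R m) e → coeff R m (negS R m s) e ≈ - coeff R m s e
  coeff-neg zero    s e = refl
  coeff-neg (suc m) s e = coeff-neg m (s (e zero)) (e ∘ suc)

  coeff-zeroS : ∀ m e → coeff R m (zeroS R m) e ≈ 0#
  coeff-zeroS zero    e = refl
  coeff-zeroS (suc m) e = coeff-zeroS m (e ∘ suc)

  coeff-sign : ∀ m k (s : Ser R m) e → coeff R m (signS R m k s) e ≈ sgn k (coeff R m s e)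
  coeff-sign m zero    s e = refl
  coeff-sign m (suc k) s e = trans (coeff-neg m _ e) (-‿cong (coeff-sign m k s e))

  coeff-sumTo : ∀ m (F : ℕ → Ser R m) k e → coeff R m (sumTo R m F k) e ≈ Σ≤ (λ i → coeff R m (F i) e) k
  coeff-sumTo m F zero    e = refl
  coeff-sumTo m F (suc k) e = trans (coeff-add m _ _ e) (+-congʳ (coeff-sumTo m F k e))

  coeff-sumFin : ∀ m k (F : Fin k → Ser R m) e → coeff R m (sumFin R m k F) e ≈ ∑ (allFin k) (λ j → coeff R m (F j) e)
  coeff-sumFin m k F e = go (allFin k)
    where
    go : ∀ js → coeff R m (foldr (λ j r → addS R m (F j) r) (zeroS R m) js) e ≈ ∑ js (λ j → coeff R m (F j) e)
    go []       = coeff-zeroS m e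
    go (j ∷ js) = trans (coeff-add m _ _ e) (+-congˡ (go js))

  coeff-mul-zeroS : ∀ m (t : Ser R m) e → coeff R m (mulS R m (zeroS R m) t) e ≈ 0#
  coeff-mul-zeroS zero    t e = zeroˡ t
  coeff-mul-zeroS (suc m) t e = trans (coeff-sumTo m _ (e zero) _) (Σ≤-zero (e zero) λ i _ → coeff-mul-zeroS m _ _)

  coeff-mul-constS : ∀ m x (t : Ser R m) e → coeff R m (mulS R m (constS R m x) t) e ≈ x * coeff R m t e
  coeff-mul-constS zero    x t e = refl
  coeff-mul-constS (suc m) x t e =
    trans (coeff-sumTo m _ (e zero) _)
    (trans (Σ≤-first _ (e zero) λ i → coeff-mul-zeroS m _ _) (coeff-mul-constS m x _ _))

  coeff-constS-zero : ∀ m x e l → e l ≢ 0 → coeff R m (constS R m x) e ≈ 0#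
  coeff-constS-zero (suc m) x e zero p with e zero
  ... | zero  = ⊥-elim (p ≡.refl)
  ... | suc _ = coeff-zeroS m (e ∘ suc)
  coeff-constS-zero (suc m) x e (suc l) p with e zero
  ... | zero  = coeff-constS-zero m x (e ∘ suc) l p
  ... | suc _ = coeff-zeroS m (e ∘ suc)

  coeff-constS : ∀ m x e → (∀ l → e l ≡ 0) → coeff R m (constS R m x) e ≈ x
  coeff-constS zero    x e z = refl
  coeff-constS (suc m) x e z with e zero | z zero
  ... | zero | _ = coeff-constS m x (e ∘ suc) (z ∘ suc)

  coeff-mul-embed : ∀ m l (a : U R) (t : Ser R m) e →
    coeff R m (mulS R m (embed R m l a) t) e ≈ Σ≤ (λ i → a i * coeff R m t (update e l (e l ∸ i))) (e l)
  coeff-mul-embed (suc m) zero    a t e =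
    trans (coeff-sumTo m _ (e zero) _) (Σ≤-cong (e zero) λ i → coeff-mul-constS m (a i) _ _)
  coeff-mul-embed (suc m) (suc l) a t e =
    trans (coeff-sumTo m _ (e zero) _)
    (trans (Σ≤-first _ (e zero) λ i → coeff-mul-zeroS m _ _) (coeff-mul-embed m l a _ _))

  module _ {n : ℕ} where

    -- Each row carries one univariate series and only the variable depends on the column, so a
    -- minor is given by its row series `a` and the variables `σ` of its columns.
    minor : ∀ k → (Fin k → U R) → (Fin k → Fin n) → Ser R n
    minor k a σ = det R n k (λ r j → embed R n (σ j) (a r))

    minor-expand : ∀ k (a : Fin (suc k) → U R) (σ : Fin (suc k) → Fin n) e →
      coeff R n (minor (suc k) a σ) e ≈
      ∑ (allFin (suc k)) (λ j → sgn (toℕ j) (Σ≤ (λ i → a zero i *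
        coeff R n (minor k (a ∘ suc) (σ ∘ punchIn j)) (update e (σ j) (e (σ j) ∸ i))) (e (σ j))))
    minor-expand k a σ e = trans (coeff-sumFin n (suc k) _ e) (∑-cong (allFin (suc k)) λ j →
      trans (coeff-sign n (toℕ j) _ e) (sgn-cong (toℕ j) (coeff-mul-embed n (σ j) (a zero) _ e)))

    sgn-zero : ∀ m {x} → x ≈ 0# → sgn m x ≈ 0#
    sgn-zero zero    e = e
    sgn-zero (suc m) e = trans (-‿cong (sgn-zero m e)) -0#≈0#

    -- Minors stay series in all `n` variables, so the absence of a variable has to be expressed
    -- through coefficients.
    minor-free : ∀ k a σ e l → (∀ j → σ j ≢ l) → e l ≢ 0 → coeff R n (minor k a σ) e ≈ 0#
    minor-free zero    a σ e l p q = coeff-constS-zero n 1# e l q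
    minor-free (suc k) a σ e l p q = trans (minor-expand k a σ e) (∑-zero (allFin (suc k)) λ j →
      sgn-zero (toℕ j) (Σ≤-zero (e (σ j)) λ i _ →
        trans (*-congˡ (minor-free k (a ∘ suc) (σ ∘ punchIn j) _ l (p ∘ punchIn j)
                         (q ∘ ≡.trans (≡.sym (update-≢ e _ (p j)))))) (zeroʳ _)))

    -- `punchIn` deletes a column by its index `j`, `wedge` by walking along the list; the sign of
    -- `j` is spread over `j` nested subtractions.
    laplace : ∀ k a φ (e : Fin (suc k) → ℕ) →
      ∑ (allFin (suc k)) (λ j → sgn (toℕ j) (a (e j) * φ (tabulate (e ∘ punchIn j)))) ≈ wedge a φ (tabulate e)
    laplace zero    a φ e = +-congˡ (sym -0#≈0#)
    laplace (suc k) a φ e = +-congˡ (begin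
      ∑ (tabulate suc) (λ j → sgn (toℕ j) (a (e j) * φ (tabulate (e ∘ punchIn j))))
        ≡⟨ ∑-tabulate-suc (suc k) _ ⟩
      ∑ (allFin (suc k)) (λ j → - sgn (toℕ j) (a (e (suc j)) * φ (e zero ∷ tabulate (e ∘ suc ∘ punchIn j))))
        ≈⟨ trans (∑-cong (allFin (suc k)) (λ j → sym (-1*x≈-x _))) (trans (∑-*ˡ (allFin (suc k)) (- 1#) _) (-1*x≈-x _)) ⟩
      - ∑ (allFin (suc k)) (λ j → sgn (toℕ j) (a (e (suc j)) * φ (e zero ∷ tabulate (e ∘ suc ∘ punchIn j))))
        ≈⟨ -‿cong (laplace k a (slice (e zero) φ) (e ∘ suc)) ⟩
      - wedge a (slice (e zero) φ) (tabulate (e ∘ suc)) ∎)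

    -- The minors of row expansion do not involve the variable of the expanded column, so the
    -- coefficient of that variable is taken in the expanded entry alone.
    coeff-minor : ∀ k a σ e → (∀ {i j} → σ i ≡ σ j → i ≡ j) → (∀ l → (∀ j → σ j ≢ l) → e l ≡ 0) →
                  coeff R n (minor k a σ) e ≈ detL (tabulate a) (tabulate (e ∘ σ))
    coeff-minor zero    a σ e inj z = coeff-constS n 1# e (λ l → z l (λ ()))
    coeff-minor (suc k) a σ e inj z = trans (minor-expand k a σ e)
      (trans (∑-cong (allFin (suc k)) λ j → sgn-cong (toℕ j) (entry-coeff j))
             (laplace k (a zero) (detL (tabulate (a ∘ suc))) (e ∘ σ)))
      where
      -- The smaller minor no longer covers the variable `σ j`, but its exponent has been reset to
      -- 0, so the hypothesis on uncovered variables survives.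
      missed : ∀ j l → (∀ i → σ (punchIn j i) ≢ l) → update e (σ j) 0 l ≡ 0
      missed j l p with σ j Fin.≟ l
      ... | yes ≡.refl = update-≡ e (σ j) 0
      ... | no  σj≢l   = ≡.trans (update-≢ e 0 σj≢l) (z l λ i eq → miss i eq)
        where
        miss : ∀ i → σ i ≢ l
        miss i eq with j Fin.≟ i
        ... | yes ≡.refl = σj≢l eq
        ... | no  j≢i    = p (punchOut j≢i) (≡.trans (≡.cong σ (Finₚ.punchIn-punchOut j≢i)) eq)
      entry-coeff : ∀ j → Σ≤ (λ i → a zero i * coeff R n (minor k (a ∘ suc) (σ ∘ punchIn j)) (update e (σ j) (e (σ j) ∸ i))) (e (σ j))
                    ≈ a zero (e (σ j)) * detL (tabulate (a ∘ suc)) (tabulate (e ∘ σ ∘ punchIn j))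
      entry-coeff j = trans
        (Σ≤-last _ (e (σ j)) λ i p → trans (*-congˡ (minor-free k (a ∘ suc) (σ ∘ punchIn j) _ (σ j)
            (λ i' eq → Finₚ.punchInᵢ≢i j i' (inj eq))
            (λ eq → ℕₚ.m<n⇒n≢0 (ℕₚ.m<n⇒0<n∸m p) (≡.trans (≡.sym (update-≡ e (σ j) _)) eq)))) (zeroʳ _))
        (*-congˡ (begin
          coeff R n (minor k (a ∘ suc) (σ ∘ punchIn j)) (update e (σ j) (e (σ j) ∸ e (σ j)))
            ≡⟨ ≡.cong (λ t → coeff R n (minor k (a ∘ suc) (σ ∘ punchIn j)) (update e (σ j) t)) (ℕₚ.n∸n≡0 (e (σ j))) ⟩
          coeff R n (minor k (a ∘ suc) (σ ∘ punchIn j)) (update e (σ j) 0)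
            ≈⟨ coeff-minor k (a ∘ suc) (σ ∘ punchIn j) (update e (σ j) 0) (Finₚ.punchIn-injective j _ _ ∘ inj) (missed j) ⟩
          detL (tabulate (a ∘ suc)) (tabulate (update e (σ j) 0 ∘ σ ∘ punchIn j))
            ≡⟨ ≡.cong (detL (tabulate (a ∘ suc))) (tabulate-cong λ i → update-≢ e 0 (λ eq → Finₚ.punchInᵢ≢i j i (inj (≡.sym eq)))) ⟩
          detL (tabulate (a ∘ suc)) (tabulate (e ∘ σ ∘ punchIn j)) ∎))

  detCoeff≈detL : ∀ {n} (p : Params R n) lam → detCoeff R p lam ≈ detL (tabulate (h R p)) (tabulate lam)
  detCoeff≈detL p lam = coeff-minor _ (h R p) id lam id (λ l missed → ⊥-elim (missed l ≡.refl))

-- Letters encoded as natural numbers, and the list of diagonals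

double : ℕ → ℕ
double zero    = zero
double (suc r) = suc (suc (double r))

-- Primed letters have even codes, as `key` puts the primed letter of a base just before the
-- unprimed one.
isPrimed : ℕ → Bool
isPrimed zero          = true
isPrimed (suc zero)    = false
isPrimed (suc (suc k)) = isPrimed k

half-double : ∀ r → ⌊ double r /2⌋ ≡ r
half-double zero    = ≡.refl
half-double (suc r) = ≡.cong suc (half-double r)

half-suc-double : ∀ r → ⌊ suc (double r) /2⌋ ≡ r
half-suc-double zero    = ≡.refl
half-suc-double (suc r) = ≡.cong suc (half-suc-double r)

isPrimed-double : ∀ r → isPrimed (double r) ≡ true
isPrimed-double zero    = ≡.refl
isPrimed-double (suc r) = isPrimed-double r

isPrimed-suc-double : ∀ r → isPrimed (suc (double r)) ≡ false
isPrimed-suc-double zero    = ≡.refl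
isPrimed-suc-double (suc r) = isPrimed-suc-double r

double-mono-≤ : ∀ {r s} → r ≤ s → double r ≤ double s
double-mono-≤ z≤n     = z≤n
double-mono-≤ (s≤s p) = s≤s (s≤s (double-mono-≤ p))

lookupOr : ∀ {A : Set} {n} → A → (Fin n → A) → ℕ → A
lookupOr {n = zero}  d e _       = d
lookupOr {n = suc n} d e zero    = e zero
lookupOr {n = suc n} d e (suc i) = lookupOr d (e ∘ suc) i

lookupOr-toℕ : ∀ {A : Set} {n} (d : A) (e : Fin n → A) k → lookupOr d e (toℕ k) ≡ e k
lookupOr-toℕ d e zero    = ≡.refl
lookupOr-toℕ d e (suc k) = lookupOr-toℕ d (e ∘ suc) k

lookupOr-≥ : ∀ {A : Set} {n} (d : A) (e : Fin n → A) {k} → n ≤ k → lookupOr d e k ≡ d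
lookupOr-≥ {n = zero}  d e p       = ≡.refl
lookupOr-≥ {n = suc n} d e (s≤s p) = lookupOr-≥ d (e ∘ suc) p

-- The rank `n` of the letter zero lies outside the range of `num` and is caught by the default
-- value `zer`.
unrank : (n : ℕ) → ℕ → Base n
unrank n r = if r <ᵇ suc n then lookupOr zer num r else lookupOr zer bar ((n ℕ.+ n) ∸ r)

rank-bar> : ∀ {n} (k : Fin n) → n < rank (bar k)
rank-bar> {n} k = ≡.subst (ℕ._≤ n ℕ.+ (n ∸ toℕ k)) (ℕₚ.+-comm n 1) (ℕₚ.+-monoʳ-≤ n (ℕₚ.m<n⇒0<n∸m (Finₚ.toℕ<n k)))

unrank-rank : ∀ {n} (b : Base n) → unrank n (rank b) ≡ b
unrank-rank {n} (num k) rewrite <ᵇ-true (ℕₚ.m≤n⇒m≤1+n (Finₚ.toℕ<n k)) = lookupOr-toℕ zer num k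
unrank-rank {n} zer rewrite <ᵇ-true (ℕₚ.≤-refl {suc n}) = lookupOr-≥ zer num ℕₚ.≤-refl
unrank-rank {n} (bar k) rewrite <ᵇ-false (rank-bar> k) =
  ≡.trans (≡.cong (lookupOr zer bar) (≡.trans (ℕₚ.[m+n]∸[m+o]≡n∸o n n (n ∸ toℕ k)) (ℕₚ.m∸[m∸n]≡n (ℕₚ.<⇒≤ (Finₚ.toℕ<n k)))))
          (lookupOr-toℕ zer bar k)

rank≤ : ∀ {n} (b : Base n) → rank b ≤ n ℕ.+ n
rank≤ {n} (num k) = ℕₚ.≤-trans (ℕₚ.<⇒≤ (Finₚ.toℕ<n k)) (ℕₚ.m≤m+n n n)
rank≤ {n} zer     = ℕₚ.m≤m+n n n
rank≤ {n} (bar k) = ℕₚ.+-monoʳ-≤ n (ℕₚ.m∸n≤m n (toℕ k))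

diagKey : ∀ {n} → Base n → ℕ
diagKey b = suc (double (rank b))

-- The admissible diagonals: the smallest remaining k is either the unbarred first entry or the barred last one.
diagonals : ∀ {n} → List (Fin n) → List (List (Base n))
diagonals []       = [] ∷ []
diagonals (k ∷ ks) = map (num k ∷_) (diagonals ks) ++ map (_∷ʳ bar k) (diagonals ks)

-- Final segments of `allFin n`, described by what the sign of the g-row of `k` requires: its
-- exponent is the number of rows that come after.
Suffix : ∀ {n} → List (Fin n) → Set
Suffix     []       = ⊤
Suffix {n} (k ∷ ks) = n ∸ suc (toℕ k) ≡ length ks × Suffix ks

suffix-allFin : ∀ n → Suffix (allFin n)
suffix-allFin n = go n id λ i → ≡.refl
  where
  go : ∀ m (e : Fin m → Fin n) → (∀ i → n ∸ suc (toℕ (e i)) ≡ m ∸ suc (toℕ i)) → Suffix (tabulate e)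
  go zero    e p = tt
  go (suc m) e p = ≡.trans (p zero) (≡.sym (length-tabulate (e ∘ suc))) , go m (e ∘ suc) (p ∘ suc)

-- The convolution monoid of univariate power series

module Convolution {c ℓ} (R : CommutativeRing c ℓ) where
  open CommutativeRing R hiding (zero)
  open import Algebra.Solver.Ring.NaturalCoefficients.Default commutativeSemiring using (solve; _:=_; _:+_; _:*_)
  open import Relation.Binary.Reasoning.Setoid setoid
  open Sums R

  conv-cong : ∀ {a b a' b'} → a ≋ a' → b ≋ b' → conv a b ≋ conv a' b'
  conv-cong p q n = Σ≤-cong n λ i → *-cong (p i) (q (n ∸ i))

  conv-tailˡ : ∀ a b n → conv a b (suc n) ≈ a 0 * b (suc n) + conv (a ∘ suc) b n
  conv-tailˡ a b n = Σ≤-head _ n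

  conv-tailʳ : ∀ a b n → conv a b (suc n) ≈ conv a (b ∘ suc) n + a (suc n) * b 0
  conv-tailʳ a b n = +-cong (Σ≤-cong≤ n λ i p → *-congˡ (reflexive (≡.cong b (ℕₚ.+-∸-assoc 1 p))))
                            (*-congˡ (reflexive (≡.cong b (ℕₚ.n∸n≡0 n))))

  conv-comm : ∀ a b → conv a b ≋ conv b a
  conv-comm a b zero    = *-comm _ _
  conv-comm a b (suc n) = trans (conv-tailˡ a b n)
    (trans (+-cong (*-comm _ _) (conv-comm (a ∘ suc) b n)) (trans (+-comm _ _) (sym (conv-tailʳ b a n))))

  conv-linˡ : ∀ x a b d → conv (λ i → x * a i + b i) d ≋ λ n → x * conv a d n + conv b d n
  conv-linˡ x a b d n =
    trans (Σ≤-cong n λ i → trans (distribʳ _ _ _) (+-congʳ (*-assoc _ _ _))) (trans (Σ≤-+ _ _ n) (+-congʳ (Σ≤-*ˡ x _ n)))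

  conv-assoc : ∀ a b d → conv (conv a b) d ≋ conv a (conv b d)
  conv-assoc a b d zero    = *-assoc _ _ _
  conv-assoc a b d (suc n) = begin
    conv (conv a b) d (suc n)
      ≈⟨ conv-tailˡ (conv a b) d n ⟩
    (a 0 * b 0) * d (suc n) + conv (conv a b ∘ suc) d n
      ≈⟨ +-congˡ (trans (conv-cong {b = d} (conv-tailˡ a b) (λ _ → refl) n) (conv-linˡ (a 0) (b ∘ suc) (conv (a ∘ suc) b) d n)) ⟩
    (a 0 * b 0) * d (suc n) + (a 0 * conv (b ∘ suc) d n + conv (conv (a ∘ suc) b) d n)
      ≈⟨ +-congˡ (+-congˡ (conv-assoc (a ∘ suc) b d n)) ⟩
    (a 0 * b 0) * d (suc n) + (a 0 * conv (b ∘ suc) d n + conv (a ∘ suc) (conv b d) n)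
      ≈⟨ solve 5 (λ x y z u v → (x :* y) :* z :+ (x :* u :+ v) := x :* (y :* z :+ u) :+ v) refl _ _ _ _ _ ⟩
    a 0 * (b 0 * d (suc n) + conv (b ∘ suc) d n) + conv (a ∘ suc) (conv b d) n
      ≈⟨ +-congʳ (*-congˡ (conv-tailˡ b d n)) ⟨
    a 0 * conv b d (suc n) + conv (a ∘ suc) (conv b d) n
      ≈⟨ conv-tailˡ a (conv b d) n ⟨
    conv a (conv b d) (suc n) ∎

  conv-constˡ : ∀ x a → conv (cU R x) a ≋ λ n → x * a n
  conv-constˡ x a zero    = refl
  conv-constˡ x a (suc n) = trans (conv-tailˡ _ a n)
    (trans (+-congˡ (Σ≤-zero n λ _ _ → zeroˡ _)) (+-identityʳ _))

  conv-identityˡ : ∀ a → conv (cU R 1#) a ≋ a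
  conv-identityˡ a n = trans (conv-constˡ 1# a n) (*-identityˡ _)

  conv-qU : ∀ a n → conv (qU R) a (suc n) ≈ a n
  conv-qU a n = trans (conv-tailˡ _ a n) (trans (trans (+-congʳ (zeroˡ _)) (+-identityˡ _))
    (trans (conv-cong {b = a} δ-tail (λ _ → refl) n) (conv-identityˡ a n)))
    where
    δ-tail : (qU R ∘ suc) ≋ cU R 1#
    δ-tail zero    = refl
    δ-tail (suc _) = refl

  convMonoid : CommutativeMonoid c ℓ
  convMonoid = record
    { Carrier = ℕ → Carrier ; _≈_ = _≋_ ; _∙_ = conv ; ε = cU R 1#
    ; isCommutativeMonoid = record
      { isMonoid = record
        { isSemigroup = record
          { isMagma = record
            { isEquivalence = record { refl = λ _ → refl ; sym = λ e i → sym (e i) ; trans = λ e e' i → trans (e i) (e' i) }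
            ; ∙-cong = conv-cong }
          ; assoc = conv-assoc }
        ; identity = conv-identityˡ , λ a i → trans (conv-comm a _ i) (conv-identityˡ a i) }
      ; comm = conv-comm } }

-- Range products in a commutative monoid, applied to series and to ring sums alike

module RangeProducts {c ℓ} (M : CommutativeMonoid c ℓ) where
  open CommutativeMonoid M
  open import Relation.Binary.Reasoning.Setoid setoid

  ∏< : ℕ → (ℕ → Carrier) → Carrier
  ∏< zero    F = ε
  ∏< (suc n) F = F 0 ∙ ∏< n (F ∘ suc)

  ∏<-cong : ∀ n {F G : ℕ → Carrier} → (∀ i → i < n → F i ≈ G i) → ∏< n F ≈ ∏< n G
  ∏<-cong zero    e = refl
  ∏<-cong (suc n) e = ∙-cong (e 0 (s≤s z≤n)) (∏<-cong n λ i p → e (suc i) (s≤s p))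

  ∏<-ε : ∀ n → ∏< n (λ _ → ε) ≈ ε
  ∏<-ε zero    = refl
  ∏<-ε (suc n) = trans (identityˡ _) (∏<-ε n)

  ∏<-+ : ∀ m n (F : ℕ → Carrier) → ∏< (m ℕ.+ n) F ≈ ∏< m F ∙ ∏< n (λ i → F (m ℕ.+ i))
  ∏<-+ zero    n F = sym (identityˡ _)
  ∏<-+ (suc m) n F = trans (∙-congˡ (∏<-+ m n (F ∘ suc))) (sym (assoc _ _ _))

  ∏<-snoc : ∀ n (F : ℕ → Carrier) → ∏< (suc n) F ≈ ∏< n F ∙ F n
  ∏<-snoc zero    F = trans (identityʳ _) (sym (identityˡ _))
  ∏<-snoc (suc n) F = trans (∙-congˡ (∏<-snoc n (F ∘ suc))) (sym (assoc _ _ _))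

  -- Barred letters are ordered against their indices, which calls for a reversal whenever ranks are
  -- compared with indices.
  ∏<-reverse : ∀ n (F : ℕ → Carrier) → ∏< n (λ i → F (n ∸ suc i)) ≈ ∏< n F
  ∏<-reverse zero    F = refl
  ∏<-reverse (suc n) F = trans (∙-congˡ (∏<-reverse n F)) (trans (comm _ _) (sym (∏<-snoc n F)))

  ∏<-below : ∀ n k (F : ℕ → Carrier) → k ≤ n → ∏< n (λ i → if i <ᵇ k then F i else ε) ≈ ∏< k F
  ∏<-below n       zero    F p       = ∏<-ε n
  ∏<-below (suc n) (suc k) F (s≤s p) = ∙-congˡ (∏<-below n k (F ∘ suc) p)

  ∏<-above : ∀ n k (F : ℕ → Carrier) → k < n → ∏< n (λ i → if k <ᵇ i then F i else ε) ≈ ∏< (n ∸ suc k) (λ i → F (suc k ℕ.+ i))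
  ∏<-above (suc n) zero    F p       = identityˡ _
  ∏<-above (suc n) (suc k) F (s≤s p) = trans (identityˡ _) (∏<-above n k (F ∘ suc) p)

  prod : ∀ {A : Set} → List A → (A → Carrier) → Carrier
  prod L H = foldr (λ x r → H x ∙ r) ε L

  prod-tabulate : ∀ {A : Set} m (e : Fin m → A) (H : A → Carrier) (F : ℕ → Carrier) → (∀ i → H (e i) ≈ F (toℕ i)) → prod (tabulate e) H ≈ ∏< m F
  prod-tabulate zero    e H F p = refl
  prod-tabulate (suc m) e H F p = ∙-cong (p zero) (prod-tabulate m (e ∘ suc) H (F ∘ suc) (p ∘ suc))

  prod-filter : ∀ {A : Set} m (e : Fin m → A) (q : A → Bool) (Q : ℕ → Bool) (H : A → Carrier) (F : ℕ → Carrier) →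
                (∀ i → q (e i) ≡ Q (toℕ i)) → (∀ i → H (e i) ≈ F (toℕ i)) →
                prod (filterᵇ q (tabulate e)) H ≈ ∏< m (λ i → if Q i then F i else ε)
  prod-filter zero    e q Q H F r p = refl
  prod-filter (suc m) e q Q H F r p with q (e zero) | Q 0 | r zero
  ... | true  | true  | _ = ∙-cong (p zero) (prod-filter m (e ∘ suc) q (Q ∘ suc) H (F ∘ suc) (r ∘ suc) (p ∘ suc))
  ... | false | false | _ = trans (prod-filter m (e ∘ suc) q (Q ∘ suc) H (F ∘ suc) (r ∘ suc) (p ∘ suc)) (sym (identityˡ _))

-- The rows f and g as products over the alphabet, and the expansion of the determinant

module Expansion {c ℓ} (R : CommutativeRing c ℓ) {n : ℕ} (p : Params R n) where
  open CommutativeRing R hiding (zero)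
  open import Algebra.Properties.Ring ring
  open Params p
  open Sums R
  open Convolution R
  module CM = CommutativeMonoid convMonoid
  open RangeProducts convMonoid

  weight : ℕ → Carrier
  weight k = wgtOff R p (mkL (unrank n ⌊ k /2⌋) (isPrimed k))

  open Tableaux R isPrimed weight public

  -- Two letters for each rank from 0 to 2n: `n` unbarred bases, the zero and `n` barred bases.
  size : ℕ
  size = double (suc (n ℕ.+ n))

  factor : ℕ → U R
  factor r = conv (linU R (wgtOff R p (mkL (unrank n r) true))) (geomU R (wgtOff R p (mkL (unrank n r) false)))

  ser-double : ∀ r → ser (double r) ≡ linU R (wgtOff R p (mkL (unrank n r) true))
  ser-double r rewrite isPrimed-double r | half-double r = ≡.refl

  ser-suc-double : ∀ r → ser (suc (double r)) ≡ geomU R (wgtOff R p (mkL (unrank n r) false))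
  ser-suc-double r rewrite isPrimed-suc-double r | half-suc-double r = ≡.refl

  -- The base of the diagonal letter contributes only its unprimed letter, since the primed one is
  -- smaller than the diagonal entry; each later rank contributes both. This is why the factor
  -- belonging to `k` itself in f and g has no companion of the form 1 + wq.
  series-product : ∀ r j → series (suc (double r)) (double (suc r ℕ.+ j)) ≋
                   conv (geomU R (wgtOff R p (mkL (unrank n r) false))) (∏< j (λ i → factor (suc r ℕ.+ i)))
  series-product r zero rewrite ℕₚ.+-identityʳ r = begin
    series (suc (double r)) (suc (suc (double r)))
      ≡⟨ series-suc (ℕₚ.≤-refl {suc (double r)}) ⟩
    conv (series (suc (double r)) (suc (double r))) (ser (suc (double r)))
      ≡⟨ ≡.cong₂ conv (series-self (suc (double r))) (ser-suc-double r) ⟩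
    conv δ (geomU R (wgtOff R p (mkL (unrank n r) false)))
      ≈⟨ CM.comm δ _ ⟩
    conv (geomU R (wgtOff R p (mkL (unrank n r) false))) δ ∎
    where open import Relation.Binary.Reasoning.Setoid CM.setoid
  series-product r (suc j) rewrite ℕₚ.+-suc r j = begin
    series d (suc (suc (double s)))
      ≡⟨ series-suc (ℕₚ.m≤n⇒m≤1+n d≤) ⟩
    conv (series d (suc (double s))) (ser (suc (double s)))
      ≡⟨ ≡.cong₂ conv (series-suc d≤) (ser-suc-double s) ⟩
    conv (conv (series d (double s)) (ser (double s))) Z
      ≡⟨ ≡.cong (λ t → conv (conv (series d (double s)) t) Z) (ser-double s) ⟩
    conv (conv (series d (double s)) L) Z
      ≈⟨ CM.assoc (series d (double s)) L Z ⟩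
    conv (series d (double s)) (factor s)
      ≈⟨ CM.∙-congʳ {factor s} (series-product r j) ⟩
    conv (conv G P) (factor s)
      ≈⟨ CM.assoc G P (factor s) ⟩
    conv G (conv P (factor s))
      ≈⟨ CM.∙-congˡ {G} (∏<-snoc j (λ i → factor (suc r ℕ.+ i))) ⟨
    conv G (∏< (suc j) (λ i → factor (suc r ℕ.+ i))) ∎
    where
    open import Relation.Binary.Reasoning.Setoid CM.setoid
    d = suc (double r)
    s = suc (r ℕ.+ j)
    G = geomU R (wgtOff R p (mkL (unrank n r) false))
    Z = geomU R (wgtOff R p (mkL (unrank n s) false))
    L = linU R (wgtOff R p (mkL (unrank n s) true))
    P = ∏< j (λ i → factor (suc r ℕ.+ i))
    d≤ : d ≤ double s
    d≤ = ℕₚ.≤-trans (ℕₚ.n≤1+n d) (double-mono-≤ (s≤s (ℕₚ.m≤m+n r j)))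

  rowSeries : Base n → U R
  rowSeries b = series (diagKey b) size

  rowSeries-product : ∀ b j → suc (rank b) ℕ.+ j ≡ suc (n ℕ.+ n) →
    rowSeries b ≋ conv (geomU R (wgtOff R p (mkL b false))) (∏< j (λ i → factor (suc (rank b) ℕ.+ i)))
  rowSeries-product b j e = ≡.subst₂
    (λ t b' → series (diagKey b) (double t) ≋
              conv (geomU R (wgtOff R p (mkL b' false))) (∏< j (λ i → factor (suc (rank b) ℕ.+ i))))
    e (unrank-rank b) (series-product (rank b) j)

  factor-rank : ∀ b → factor (rank b) ≡ conv (linU R (wgtOff R p (mkL b true))) (geomU R (wgtOff R p (mkL b false)))
  factor-rank b rewrite unrank-rank b = ≡.refl

  numFactor barFactor : Fin n → U R
  numFactor i = conv (linU R (y i)) (geomU R (x i))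
  barFactor i = conv (linU R (xb i)) (geomU R (yb i))

  barRank : ℕ → U R
  barRank i = factor (n ℕ.+ (n ∸ i))

  ≡⇒≋ : ∀ {a b : U R} → a ≡ b → a ≋ b
  ≡⇒≋ ≡.refl _ = refl

  above-product : ∀ k → prodU R (above R k) numFactor ≋ ∏< (n ∸ suc (toℕ k)) (λ i → factor (suc (toℕ k) ℕ.+ i))
  above-product k = CM.trans
    (prod-filter n id _ (toℕ k <ᵇ_) numFactor factor (λ _ → ≡.refl) (λ i → ≡⇒≋ (≡.sym (factor-rank (num i)))))
    (∏<-above n (toℕ k) factor (Finₚ.toℕ<n k))

  below-product : ∀ k → prodU R (below R k) barFactor ≋ ∏< (toℕ k) barRank
  below-product k = CM.trans
    (prod-filter n id _ (_<ᵇ toℕ k) barFactor barRank (λ _ → ≡.refl) (λ i → ≡⇒≋ (≡.sym (factor-rank (bar i)))))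
    (∏<-below n (toℕ k) barRank (ℕₚ.<⇒≤ (Finₚ.toℕ<n k)))

  all-product : prodU R (allFin n) barFactor ≋ ∏< n barRank
  all-product = prod-tabulate n id barFactor barRank (λ i → ≡⇒≋ (≡.sym (factor-rank (bar i))))

  -- The ranks after `n + (n - k)` belong to the barred letters with 0-based indices from `k - 1`
  -- down to 0, so the first `k` barred factors appear in reverse order.
  bar-product : ∀ k → k ≤ n → ∏< k (λ i → factor (suc (n ℕ.+ (n ∸ k)) ℕ.+ i)) ≋ ∏< k barRank
  bar-product k k≤n = CM.trans (∏<-cong k λ i i<k → ≡⇒≋ (≡.cong factor (shift i i<k))) (∏<-reverse k barRank)
    where
    shift : ∀ i → i < k → suc (n ℕ.+ (n ∸ k)) ℕ.+ i ≡ n ℕ.+ (n ∸ (k ∸ suc i))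
    shift i i<k = begin
      suc (n ℕ.+ (n ∸ k) ℕ.+ i)     ≡⟨ ℕₚ.+-suc (n ℕ.+ (n ∸ k)) i ⟨
      n ℕ.+ (n ∸ k) ℕ.+ suc i       ≡⟨ ℕₚ.+-assoc n (n ∸ k) (suc i) ⟩
      n ℕ.+ ((n ∸ k) ℕ.+ suc i)     ≡⟨ ≡.cong (n ℕ.+_) (≡.trans (≡.sym (ℕₚ.m+n∸n≡m _ (k ∸ suc i))) (≡.cong (_∸ (k ∸ suc i)) inner)) ⟩
      n ℕ.+ (n ∸ (k ∸ suc i))       ∎
      where
      open ≡.≡-Reasoning
      inner : (n ∸ k) ℕ.+ suc i ℕ.+ (k ∸ suc i) ≡ n
      inner = ≡.trans (ℕₚ.+-assoc (n ∸ k) (suc i) _) (≡.trans (≡.cong ((n ∸ k) ℕ.+_) (ℕₚ.m+[n∸m]≡n i<k)) (ℕₚ.m∸n+n≡m k≤n))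

  -- After the letter `k` come the later unbarred bases, the zero and all barred bases: the three
  -- groups of factors in f. The factor q of f accounts for the step from `suc m` to `m`.
  f-series : ∀ k m → f R p k (suc m) ≈ u R p k * rowSeries (num k) m
  f-series k m = trans (regroup (suc m)) (trans (conv-assoc (cU R (u R p k)) (qU R) X (suc m))
    (trans (conv-constˡ (u R p k) (conv (qU R) X) (suc m)) (*-congˡ (trans (conv-qU X m) (sym (assembled m))))))
    where
    open import Relation.Binary.Reasoning.Setoid CM.setoid
    N = n ∸ suc (toℕ k)
    C = conv (cU R (u R p k)) (qU R)
    G = geomU R (x k)
    P = prodU R (above R k) numFactor
    L = linU R z0b
    Z = geomU R z0
    Q = prodU R (allFin n) barFactor
    X = conv G (conv P (conv (conv L Z) Q))
    N+ : suc (toℕ k) ℕ.+ N ≡ n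
    N+ = ℕₚ.m+[n∸m]≡n (Finₚ.toℕ<n k)
    regroup : conv (conv (conv (conv (conv C G) P) L) Z) Q ≋ conv C (conv G (conv P (conv (conv L Z) Q)))
    regroup = begin
      conv (conv (conv (conv (conv C G) P) L) Z) Q  ≈⟨ CM.∙-congʳ {Q} (CM.assoc (conv (conv C G) P) L Z) ⟩
      conv (conv (conv (conv C G) P) (conv L Z)) Q  ≈⟨ CM.assoc (conv (conv C G) P) (conv L Z) Q ⟩
      conv (conv (conv C G) P) (conv (conv L Z) Q)  ≈⟨ CM.assoc (conv C G) P (conv (conv L Z) Q) ⟩
      conv (conv C G) (conv P (conv (conv L Z) Q))  ≈⟨ CM.assoc C G (conv P (conv (conv L Z) Q)) ⟩
      conv C (conv G (conv P (conv (conv L Z) Q)))  ∎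
    assembled : rowSeries (num k) ≋ conv G (conv P (conv (conv L Z) Q))
    assembled = begin
      rowSeries (num k)
        -- There are `N` later unbarred ranks, one rank for zero and `n` barred ranks.
        ≈⟨ rowSeries-product (num k) (N ℕ.+ suc n) (≡.trans (≡.sym (ℕₚ.+-assoc (suc (toℕ k)) N (suc n)))
             (≡.trans (≡.cong (ℕ._+ suc n) N+) (ℕₚ.+-suc n n))) ⟩
      conv G (∏< (N ℕ.+ suc n) F)
        ≈⟨ CM.∙-congˡ {G} (∏<-+ N (suc n) F) ⟩
      conv G (conv (∏< N F) (∏< (suc n) (λ i → F (N ℕ.+ i))))
        ≈⟨ CM.∙-congˡ {G} (CM.∙-cong (CM.sym (above-product k)) (CM.∙-cong zero-factor bars)) ⟩
      conv G (conv P (conv (conv L Z) Q)) ∎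
      where
      F : ℕ → U R
      F i = factor (suc (toℕ k) ℕ.+ i)
      F≡ : ∀ i → F (N ℕ.+ i) ≡ factor (n ℕ.+ i)
      F≡ i = ≡.cong factor (≡.trans (≡.sym (ℕₚ.+-assoc (suc (toℕ k)) N i)) (≡.cong (ℕ._+ i) N+))
      zero-factor : F (N ℕ.+ 0) ≋ conv L Z
      zero-factor = ≡⇒≋ (≡.trans (F≡ 0) (≡.trans (≡.cong factor (ℕₚ.+-identityʳ n)) (factor-rank zer)))
      bars : ∏< n (λ i → F (N ℕ.+ suc i)) ≋ Q
      bars = CM.trans (∏<-cong n λ i _ → ≡⇒≋ (≡.trans (F≡ (suc i)) (≡.cong factor (≡.trans (ℕₚ.+-suc n i)
                 (≡.cong (λ t → suc (t ℕ.+ i)) (≡.sym (≡.trans (≡.cong (n ℕ.+_) (ℕₚ.n∸n≡0 n)) (ℕₚ.+-identityʳ n))))))))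
             (CM.trans (bar-product n ℕₚ.≤-refl) (CM.sym all-product))

  -- A barred letter is followed only by the barred letters of smaller index.
  g-series : ∀ k m → g R p k (suc m) ≈ rowSeries (bar k) m
  g-series k m = trans (conv-assoc (qU R) G P (suc m)) (trans (conv-qU (conv G P) m) (sym (assembled m)))
    where
    open import Relation.Binary.Reasoning.Setoid CM.setoid
    G = geomU R (yb k)
    P = prodU R (below R k) barFactor
    k≤n = ℕₚ.<⇒≤ (Finₚ.toℕ<n k)
    assembled : rowSeries (bar k) ≋ conv G (prodU R (below R k) barFactor)
    assembled = begin
      rowSeries (bar k)
        ≈⟨ rowSeries-product (bar k) (toℕ k) (≡.cong suc (≡.trans (ℕₚ.+-assoc n (n ∸ toℕ k) (toℕ k)) (≡.cong (n ℕ.+_) (ℕₚ.m∸n+n≡m k≤n)))) ⟩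
      conv G (∏< (toℕ k) (λ i → factor (suc (n ℕ.+ (n ∸ toℕ k)) ℕ.+ i)))
        ≈⟨ CM.∙-congˡ {G} (CM.trans (bar-product (toℕ k) k≤n) (CM.sym (below-product k))) ⟩
      conv G (prodU R (below R k) barFactor) ∎

  signS-U : ∀ j (a : U R) m → signS R 1 j a m ≡ sgn j (a m)
  signS-U zero    a m = ≡.refl
  signS-U (suc j) a m = ≡.cong -_ (signS-U j a m)

  h-series : ∀ k m → h R p k (suc m) ≈ u R p k * rowSeries (num k) m + sgn (n ∸ suc (toℕ k)) (rowSeries (bar k) m)
  h-series k m = +-cong (f-series k m)
    (trans (reflexive (signS-U (n ∸ suc (toℕ k)) (g R p k) (suc m))) (sgn-cong (n ∸ suc (toℕ k)) (g-series k m)))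

  diagWgt : List (Base n) → Carrier
  diagWgt = foldr (λ b r → wgtDiag R p (mkL b false) * r) 1#

  diagWgt-bar : ∀ D k → diagWgt (D ∷ʳ bar k) ≈ diagWgt D
  diagWgt-bar []      k = *-identityʳ _
  diagWgt-bar (b ∷ D) k = *-congˡ (diagWgt-bar D k)

  shifted : Fin n → U R
  shifted k = h R p k ∘ suc

  -- Moving the row of a barred k behind the |ks| later rows cancels the sign (-1)^(n-k).
  wedges-shifted : ∀ ks → Suffix ks → ∀ φ →
    wedges (map shifted ks) φ ≋ λ cs → ∑ (diagonals ks) (λ D → diagWgt D * wedges (map rowSeries D) φ cs)
  wedges-shifted []       _       φ cs = sym (trans (+-identityʳ _) (*-identityˡ _))
  wedges-shifted (k ∷ ks) (e , s) φ cs = begin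
    wedge (shifted k) Φks cs
      ≈⟨ trans (wedge-cong (h-series k) (λ _ → refl) cs) (wedge-+ˡ _ _ Φks cs) ⟩
    wedge (λ m → u R p k * rowSeries (num k) m) Φks cs + wedge (λ m → sgn (n ∸ suc (toℕ k)) (rowSeries (bar k) m)) Φks cs
      ≈⟨ +-cong (wedge-*ˡ _ _ Φks cs) (trans (wedge-sgnˡ (n ∸ suc (toℕ k)) _ Φks cs)
           (sgn-cong (n ∸ suc (toℕ k)) (trans (wedge-past (rowSeries (bar k)) (map shifted ks) φ cs)
             (reflexive (≡.cong (λ t → sgn t (wedges (map shifted ks) (wedge (rowSeries (bar k)) φ) cs)) len))))) ⟩
    u R p k * wedge (rowSeries (num k)) Φks cs + sgn (n ∸ suc (toℕ k)) (sgn (n ∸ suc (toℕ k)) (wedges (map shifted ks) (wedge (rowSeries (bar k)) φ) cs))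
      ≈⟨ +-cong (trans (*-congˡ (trans (wedge-congʳ (wedges-shifted ks s φ) cs) (wedge-∑ _ (diagonals ks) _ cs))) (sym (∑-*ˡ (diagonals ks) _ _)))
                (trans (sgn-sgn (n ∸ suc (toℕ k)) _) (wedges-shifted ks s _ cs)) ⟩
    ∑ (diagonals ks) (λ D → u R p k * wedge (rowSeries (num k)) (λ cs → diagWgt D * wedges (map rowSeries D) φ cs) cs)
    + ∑ (diagonals ks) (λ D → diagWgt D * wedges (map rowSeries D) (wedge (rowSeries (bar k)) φ) cs)
      ≈⟨ +-cong (∑-cong (diagonals ks) λ D → trans (*-congˡ (wedge-*ʳ _ _ _ cs)) (sym (*-assoc _ _ _)))
                (∑-cong (diagonals ks) λ D → *-cong (sym (diagWgt-bar D k)) (reflexive (≡.sym (≡.trans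
                   (≡.cong (λ t → wedges t φ cs) (map-++ rowSeries D _)) (≡.cong-app (foldr-++ wedge φ (map rowSeries D) _) cs))))) ⟩
    ∑ (diagonals ks) (λ D → diagWgt (num k ∷ D) * wedges (map rowSeries (num k ∷ D)) φ cs)
    + ∑ (diagonals ks) (λ D → diagWgt (D ∷ʳ bar k) * wedges (map rowSeries (D ∷ʳ bar k)) φ cs)
      ≡⟨ ≡.cong₂ _+_ (∑-map (num k ∷_) (diagonals ks) _) (∑-map (_∷ʳ bar k) (diagonals ks) _) ⟨
    ∑ (map (num k ∷_) (diagonals ks)) (λ D → diagWgt D * wedges (map rowSeries D) φ cs)
    + ∑ (map (_∷ʳ bar k) (diagonals ks)) (λ D → diagWgt D * wedges (map rowSeries D) φ cs)
      ≈⟨ ∑-++ (map (num k ∷_) (diagonals ks)) _ _ ⟨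
    ∑ (diagonals (k ∷ ks)) (λ D → diagWgt D * wedges (map rowSeries D) φ cs) ∎
    where
    open import Relation.Binary.Reasoning.Setoid setoid
    Φks = wedges (map shifted ks) φ
    len : length (map shifted ks) ≡ n ∸ suc (toℕ k)
    len = ≡.trans (length-map shifted ks) (≡.sym e)

  wedge-shift : ∀ a φ cs → wedge a φ (map suc cs) ≈ wedge (a ∘ suc) (φ ∘ map suc) cs
  wedge-shift a φ []       = refl
  wedge-shift a φ (c ∷ cs) = +-congˡ (-‿cong (wedge-shift a _ cs))

  detL-shift : ∀ as cs → detL as (map suc cs) ≈ detL (map (_∘ suc) as) cs
  detL-shift []       []       = refl
  detL-shift []       (_ ∷ _)  = refl
  detL-shift (a ∷ as) cs       = trans (wedge-shift a _ cs) (wedge-congʳ (detL-shift as) cs)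

  detCoeff-expand : ∀ lam m → (∀ i → lam i ≡ suc (m i)) → detCoeff R p lam ≈
    ∑ (diagonals (allFin n)) (λ D → diagWgt D * Det size (map diagKey D) (tabulate m))
  detCoeff-expand lam m e = begin
    detCoeff R p lam
      ≈⟨ Coefficients.detCoeff≈detL R p lam ⟩
    detL (tabulate (h R p)) (tabulate lam)
      ≡⟨ ≡.cong (detL (tabulate (h R p))) (≡.trans (tabulate-cong e) (≡.sym (map-tabulate m suc))) ⟩
    detL (tabulate (h R p)) (map suc (tabulate m))
      ≈⟨ detL-shift (tabulate (h R p)) (tabulate m) ⟩
    detL (map (_∘ suc) (tabulate (h R p))) (tabulate m)
      ≡⟨ ≡.cong (λ t → detL t (tabulate m)) (≡.trans (map-tabulate (h R p) (_∘ suc)) (≡.sym (map-tabulate id shifted))) ⟩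
    wedges (map shifted (allFin n)) unit (tabulate m)
      ≈⟨ wedges-shifted (allFin n) (suffix-allFin n) unit (tabulate m) ⟩
    ∑ (diagonals (allFin n)) (λ D → diagWgt D * wedges (map rowSeries D) unit (tabulate m))
      ≈⟨ ∑-cong (diagonals (allFin n)) (λ D → *-congˡ (reflexive (≡.cong (λ t → detL t (tabulate m)) (map-∘ D)))) ⟩
    ∑ (diagonals (allFin n)) (λ D → diagWgt D * Det size (map diagKey D) (tabulate m)) ∎
    where open import Relation.Binary.Reasoning.Setoid setoid

-- Characterisation of the main diagonals of valid fillings

_<ᴿ_ : ∀ {n} → Base n → Base n → Set
a <ᴿ b = rank a < rank b

rank-injective : ∀ {n} {a b : Base n} → rank a ≡ rank b → a ≡ b
rank-injective {n} {a} {b} e = ≡.trans (≡.sym (unrank-rank a)) (≡.trans (≡.cong (unrank n) e) (unrank-rank b))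

isOf : ∀ {n} → Fin n → Base n → Bool
isOf k (num j) = toℕ k ≡ᵇ toℕ j
isOf k zer     = false
isOf k (bar j) = toℕ k ≡ᵇ toℕ j

count : ∀ {n} → Fin n → List (Base n) → ℕ
count k D = length (filterᵇ (isOf k) D)

bool→ℕ : Bool → ℕ
bool→ℕ b = if b then 1 else 0

count-∷ : ∀ {n} (k : Fin n) b D → count k (b ∷ D) ≡ bool→ℕ (isOf k b) ℕ.+ count k D
count-∷ k b D with isOf k b
... | true  = ≡.refl
... | false = ≡.refl

count-∷ʳ : ∀ {n} (k : Fin n) D b → count k (D ∷ʳ b) ≡ bool→ℕ (isOf k b) ℕ.+ count k D
count-∷ʳ k []      b = count-∷ k b []
count-∷ʳ k (a ∷ D) b = begin
  count k (a ∷ (D ∷ʳ b))                                            ≡⟨ count-∷ k a (D ∷ʳ b) ⟩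
  bool→ℕ (isOf k a) ℕ.+ count k (D ∷ʳ b)                            ≡⟨ ≡.cong (bool→ℕ (isOf k a) ℕ.+_) (count-∷ʳ k D b) ⟩
  bool→ℕ (isOf k a) ℕ.+ (bool→ℕ (isOf k b) ℕ.+ count k D)           ≡⟨ ℕₚ.+-assoc (bool→ℕ (isOf k a)) _ _ ⟨
  bool→ℕ (isOf k a) ℕ.+ bool→ℕ (isOf k b) ℕ.+ count k D             ≡⟨ ≡.cong (ℕ._+ count k D) (ℕₚ.+-comm (bool→ℕ (isOf k a)) _) ⟩
  bool→ℕ (isOf k b) ℕ.+ bool→ℕ (isOf k a) ℕ.+ count k D             ≡⟨ ℕₚ.+-assoc (bool→ℕ (isOf k b)) _ _ ⟩
  bool→ℕ (isOf k b) ℕ.+ (bool→ℕ (isOf k a) ℕ.+ count k D)           ≡⟨ ≡.cong (bool→ℕ (isOf k b) ℕ.+_) (count-∷ k a D) ⟨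
  bool→ℕ (isOf k b) ℕ.+ count k (a ∷ D)                             ∎
  where open ≡.≡-Reasoning

count-none : ∀ {n} (k : Fin n) {D} → All (λ b → isOf k b ≡ false) D → count k D ≡ 0
count-none k []               = ≡.refl
count-none k {b ∷ D} (p ∷ ps) = ≡.trans (count-∷ k b D) (≡.cong₂ ℕ._+_ (≡.cong bool→ℕ p) (count-none k ps))

count-none⁻¹ : ∀ {n} (k : Fin n) {D} → count k D ≡ 0 → All (λ b → isOf k b ≡ false) D
count-none⁻¹ k {[]}    e = []
count-none⁻¹ k {b ∷ D} e with isOf k b in eq
... | false = eq ∷ count-none⁻¹ k e

data Within {n} (ks : List (Fin n)) : Base n → Set where
  num : ∀ {j} → j ∈ ks → Within ks (num j)
  zer : Within ks zer
  bar : ∀ {j} → j ∈ ks → Within ks (bar j)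

_<ᶠ_ : ∀ {n} → Fin n → Fin n → Set
i <ᶠ j = toℕ i < toℕ j

module _ {n : ℕ} where

  isOf-self : ∀ (k : Fin n) → (toℕ k ≡ᵇ toℕ k) ≡ true
  isOf-self k = ≡ᵇ-refl (toℕ k)

  isOf-≢ : ∀ {j k : Fin n} → j ≢ k → (toℕ k ≡ᵇ toℕ j) ≡ false
  isOf-≢ p = ≡ᵇ-false (p ∘ Finₚ.toℕ-injective ∘ ≡.sym)

  ≢-head : ∀ {k : Fin n} {ks j} → All (k <ᶠ_) ks → j ∈ ks → j ≢ k
  ≢-head q j∈ks ≡.refl = ℕₚ.<-irrefl ≡.refl (All.lookup q j∈ks)

  within-weaken : ∀ {k : Fin n} {ks b} → Within ks b → Within (k ∷ ks) b
  within-weaken (num p) = num (there p)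
  within-weaken zer     = zer
  within-weaken (bar p) = bar (there p)

  within-strengthen : ∀ {k : Fin n} {ks b} → isOf k b ≡ false → Within (k ∷ ks) b → Within ks b
  within-strengthen e (num (there p)) = num p
  within-strengthen e zer             = zer
  within-strengthen e (bar (there p)) = bar p
  within-strengthen {k} e (num (here ≡.refl)) with () ← ≡.trans (≡.sym e) (isOf-self k)
  within-strengthen {k} e (bar (here ≡.refl)) with () ← ≡.trans (≡.sym e) (isOf-self k)

  not-of-head : ∀ {k : Fin n} {ks b} → All (k <ᶠ_) ks → Within ks b → isOf k b ≡ false
  not-of-head q (num p) = isOf-≢ (≢-head q p)
  not-of-head q zer     = ≡.refl
  not-of-head q (bar p) = isOf-≢ (≢-head q p)

  -- Unbarred letters are ordered along their indices and barred letters against them, with zero in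
  -- between. Hence the least remaining index supplies both extreme letters, `num k` here and
  -- `bar k` in `bar-greatest`.
  num-least : ∀ {k : Fin n} {ks b} → All (k <ᶠ_) ks → Within (k ∷ ks) b → b ≢ num k → num k <ᴿ b
  num-least q (num (here ≡.refl)) p = ⊥-elim (p ≡.refl)
  num-least q (num (there j))   p = All.lookup q j
  num-least {k} q zer           p = Finₚ.toℕ<n k
  num-least {k} q (bar {j} _)   p = ℕₚ.<-trans (Finₚ.toℕ<n k) (rank-bar> j)

  bar-greatest : ∀ {k : Fin n} {ks b} → All (k <ᶠ_) ks → Within (k ∷ ks) b → b ≢ bar k → b <ᴿ bar k
  bar-greatest q (bar (here ≡.refl)) p = ⊥-elim (p ≡.refl)
  bar-greatest q (bar (there j))   p = ℕₚ.+-monoʳ-< n (ℕₚ.∸-monoʳ-< (All.lookup q j) (ℕₚ.<⇒≤ (Finₚ.toℕ<n _)))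
  bar-greatest {k} q zer           p = rank-bar> k
  bar-greatest {k} q (num {j} _)   p = ℕₚ.<-trans (Finₚ.toℕ<n j) (rank-bar> k)

  num≢bar : ∀ {k : Fin n} → num k ≢ bar k
  num≢bar ()

  record Admissible (ks : List (Fin n)) (D : List (Base n)) : Set where
    constructor admissible
    field
      increasing : AllPairs _<ᴿ_ D
      within     : All (Within ks) D
      len        : length D ≡ length ks
      once       : ∀ {j} → j ∈ ks → count j D ≡ 1
  open Admissible public

  diagonals-admissible : ∀ {ks} → AllPairs _<ᶠ_ ks → All (Admissible ks) (diagonals ks)
  diagonals-admissible []             = admissible [] [] ≡.refl (λ ()) ∷ []
  diagonals-admissible {k ∷ ks} (q ∷ qs) =
    Allₚ.++⁺ (Allₚ.map⁺ (All.map first (diagonals-admissible qs))) (Allₚ.map⁺ (All.map last (diagonals-admissible qs)))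
    where
    first : ∀ {D} → Admissible ks D → Admissible (k ∷ ks) (num k ∷ D)
    first {D} A = admissible
      (All.map (λ {b} w → num-least q (within-weaken w) (λ { ≡.refl → num-self w })) (within A) ∷ increasing A)
      (num (here ≡.refl) ∷ All.map within-weaken (within A))
      (≡.cong suc (len A))
      λ { (here ≡.refl) → ≡.trans (count-∷ k (num k) D) (≡.cong₂ ℕ._+_ (≡.cong bool→ℕ (isOf-self k)) (count-none k (All.map (not-of-head q) (within A))))
        ; {j} (there p) → ≡.trans (count-∷ j (num k) D) (≡.cong₂ ℕ._+_ (≡.cong bool→ℕ (isOf-≢ (≢-head q p ∘ ≡.sym))) (once A p)) }
      where
      num-self : ¬ Within ks (num k)
      num-self (num p) = ≢-head q p ≡.refl
    last : ∀ {D} → Admissible ks D → Admissible (k ∷ ks) (D ∷ʳ bar k)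
    last {D} A = admissible
      (AllPairsₚ.++⁺ (increasing A) ([] ∷ []) (All.map (λ {b} w → bar-greatest q (within-weaken w) (λ { ≡.refl → bar-self w }) ∷ []) (within A)))
      (Allₚ.++⁺ (All.map within-weaken (within A)) (bar (here ≡.refl) ∷ []))
      (≡.trans (length-++ D) (≡.trans (ℕₚ.+-comm (length D) 1) (≡.cong suc (len A))))
      λ { (here ≡.refl) → ≡.trans (count-∷ʳ k D (bar k)) (≡.cong₂ ℕ._+_ (≡.cong bool→ℕ (isOf-self k)) (count-none k (All.map (not-of-head q) (within A))))
        ; {j} (there p) → ≡.trans (count-∷ʳ j D (bar k)) (≡.cong₂ ℕ._+_ (≡.cong bool→ℕ (isOf-≢ (≢-head q p ∘ ≡.sym))) (once A p)) }
      where
      bar-self : ¬ Within ks (bar k)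
      bar-self (bar p) = ≢-head q p ≡.refl

  -- Guarantees that a valid filling is counted for one diagonal only. The two halves are disjoint:
  -- in the second one every entry but the last has an index beyond `k`, and the last is barred.
  diagonals-unique : ∀ {ks : List (Fin n)} → AllPairs _<ᶠ_ ks → Unique (diagonals ks)
  diagonals-unique []       = [] ∷ []
  diagonals-unique {k ∷ ks} (q ∷ qs) = Uniqueₚ.++⁺
    (Uniqueₚ.map⁺ ∷-injectiveʳ (diagonals-unique qs))
    (Uniqueₚ.map⁺ (λ {D} {D'} → ∷ʳ-injectiveˡ D D') (diagonals-unique qs))
    λ { (p₁ , p₂) → clash (∈-map⁻ (num k ∷_) p₁) (∈-map⁻ (_∷ʳ bar k) p₂) }
    where
    clash : ∀ {D} → (∃ λ D₁ → D₁ ∈ diagonals ks × D ≡ num k ∷ D₁) → (∃ λ D₂ → D₂ ∈ diagonals ks × D ≡ D₂ ∷ʳ bar k) → ⊥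
    clash (D₁ , _ , ≡.refl) ([]     , _ , e) = num≢bar (∷-injectiveˡ e)
    clash (D₁ , _ , ≡.refl) (b ∷ D₂ , p , e) with ∷-injectiveˡ e | within (All.lookup (diagonals-admissible qs) p)
    ... | ≡.refl | num j ∷ _ = ≢-head q j ≡.refl

  increasing-∷ʳ : ∀ D {b : Base n} → AllPairs _<ᴿ_ (D ∷ʳ b) → AllPairs _<ᴿ_ D × All (_<ᴿ b) D
  increasing-∷ʳ []      _        = [] , []
  increasing-∷ʳ (a ∷ D) (p ∷ ps) with increasing-∷ʳ D ps | Allₚ.++⁻ D p
  ... | i , l | q , (r ∷ []) = q ∷ i , r ∷ l

  snoc-viewᴮ : ∀ (b : Base n) D → ∃₂ λ D' b' → b ∷ D ≡ D' ∷ʳ b'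
  snoc-viewᴮ b []      = [] , b , ≡.refl
  snoc-viewᴮ b (c ∷ D) with snoc-viewᴮ c D
  ... | D' , b' , e = b ∷ D' , b' , ≡.cong (b ∷_) e

  isOf-false : ∀ {k : Fin n} {b} → b ≢ num k → b ≢ bar k → isOf k b ≡ false
  isOf-false {b = num j} p q = isOf-≢ (p ∘ ≡.cong num)
  isOf-false {b = zer}   p q = ≡.refl
  isOf-false {b = bar j} p q = isOf-≢ (q ∘ ≡.cong bar)

  _≟ᴮ_ : (a b : Base n) → (a ≡ b) ⊎ (a ≢ b)
  a ≟ᴮ b with rank a ℕ.≟ rank b
  ... | yes e = inj₁ (rank-injective e)
  ... | no ne = inj₂ (ne ∘ ≡.cong rank)

  -- Some entry has index `k`. By `num-least` it comes first if unbarred, by `bar-greatest` last if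
  -- barred, and deleting it leaves an admissible list for `ks`.
  admissible-∈ : ∀ {ks} → AllPairs _<ᶠ_ ks → ∀ {D} → Admissible ks D → D ∈ diagonals ks
  admissible-∈ {[]}     []       {[]}    A = here ≡.refl
  admissible-∈ {k ∷ ks} (q ∷ qs) {b ∷ D} A with b ≟ᴮ num k
  ... | inj₁ ≡.refl = ∈-++⁺ˡ (∈-map⁺ (num k ∷_) (admissible-∈ qs (admissible (AllPairs.tail (increasing A))
          (All.zipWith (λ (e , w) → within-strengthen e w) (none , All.tail (within A)))
          (ℕₚ.suc-injective (len A))
          λ {j} p → ≡.trans (≡.sym (≡.trans (count-∷ j (num k) D) (≡.cong (λ t → bool→ℕ t ℕ.+ count j D) (isOf-≢ (≢-head q p ∘ ≡.sym))))) (once A (there p)))))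
    where
    none : All (λ b → isOf k b ≡ false) D
    none = count-none⁻¹ k (ℕₚ.suc-injective (≡.trans (≡.sym (≡.trans (count-∷ k (num k) D)
             (≡.cong (λ t → bool→ℕ t ℕ.+ count k D) (isOf-self k)))) (once A (here ≡.refl))))
  ... | inj₂ b≢ with snoc-viewᴮ b D
  ...   | D' , b' , e with b' ≟ᴮ bar k
  ...     | inj₁ ≡.refl = ≡.subst (_∈ diagonals (k ∷ ks)) (≡.sym e) (∈-++⁺ʳ (map (num k ∷_) (diagonals ks)) (∈-map⁺ (_∷ʳ bar k)
            (admissible-∈ qs (admissible (proj₁ (increasing-∷ʳ D' (≡.subst (AllPairs _<ᴿ_) e (increasing A))))
              (All.zipWith (λ (e , w) → within-strengthen e w) (none , Allₚ.++⁻ˡ D' (≡.subst (All (Within (k ∷ ks))) e (within A))))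
              (ℕₚ.suc-injective (≡.trans (≡.sym (≡.trans (length-++ D') (ℕₚ.+-comm (length D') 1))) (≡.trans (≡.cong length (≡.sym e)) (len A))))
              λ {j} p → ≡.trans (≡.sym (≡.trans (count-∷ʳ j D' (bar k)) (≡.cong (λ t → bool→ℕ t ℕ.+ count j D') (isOf-≢ (≢-head q p ∘ ≡.sym)))))
                                (≡.trans (≡.cong (count j) (≡.sym e)) (once A (there p)))))))
    where
    none : All (λ b → isOf k b ≡ false) D'
    none = count-none⁻¹ k (ℕₚ.suc-injective (≡.trans (≡.sym (≡.trans (count-∷ʳ k D' (bar k))
             (≡.cong (λ t → bool→ℕ t ℕ.+ count k D') (isOf-self k)))) (≡.trans (≡.cong (count k) (≡.sym e)) (once A (here ≡.refl)))))
  -- If the first entry is not `num k` and the last is not `bar k`, neither letter occurs anywhere,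
  -- against `once`.
  ...     | inj₂ b'≢ = ⊥-elim (ℕₚ.0≢1+n (≡.trans (≡.sym (count-none k (All.zipWith (λ (p , q) → isOf-false p q) (no-num , no-bar)))) (once A (here ≡.refl))))
    where
    no-num : All (_≢ num k) (b ∷ D)
    no-num = b≢ ∷ All.map (λ { b<a ≡.refl → ℕₚ.<-asym b<a (num-least q (All.head (within A)) b≢) }) (AllPairs.head (increasing A))
    no-bar : All (_≢ bar k) (b ∷ D)
    no-bar = ≡.subst (All (_≢ bar k)) (≡.sym e) (Allₚ.++⁺
      (All.map (λ { a<b' ≡.refl → ℕₚ.<-asym a<b' (bar-greatest q (All.head (Allₚ.++⁻ʳ D' (≡.subst (All (Within (k ∷ ks))) e (within A)))) b'≢) })
               (proj₂ (increasing-∷ʳ D' (≡.subst (AllPairs _<ᴿ_) e (increasing A)))))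
      (b'≢ ∷ []))

-- Validity of a filling reduced to neighbouring boxes

open Order isPrimed

2*≡double : ∀ r → 2 ℕ.* r ≡ double r
2*≡double zero    = ≡.refl
2*≡double (suc r) = ≡.cong suc (≡.trans (ℕₚ.+-suc r (r ℕ.+ 0)) (≡.cong suc (2*≡double r)))

key-primed : ∀ {n} (b : Base n) → key (mkL b true) ≡ double (rank b)
key-primed b = ≡.trans (ℕₚ.+-identityʳ _) (2*≡double (rank b))

key-unprimed : ∀ {n} (b : Base n) → key (mkL b false) ≡ diagKey b
key-unprimed b = ≡.trans (ℕₚ.+-comm _ 1) (≡.cong suc (2*≡double (rank b)))

isPrimed-key : ∀ {n} (a : Letter n) → isPrimed (key a) ≡ primed a
isPrimed-key (mkL b true)  = ≡.trans (≡.cong isPrimed (key-primed b)) (isPrimed-double (rank b))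
isPrimed-key (mkL b false) = ≡.trans (≡.cong isPrimed (key-unprimed b)) (isPrimed-suc-double (rank b))

half-key : ∀ {n} (a : Letter n) → ⌊ key a /2⌋ ≡ rank (base a)
half-key (mkL b true)  = ≡.trans (≡.cong ⌊_/2⌋ (key-primed b)) (half-double (rank b))
half-key (mkL b false) = ≡.trans (≡.cong ⌊_/2⌋ (key-unprimed b)) (half-suc-double (rank b))

double-cancel-< : ∀ {r s} → double r < double s → r < s
double-cancel-< {r} {s} p = ℕₚ.≰⇒> λ s≤r → ℕₚ.<⇒≱ p (double-mono-≤ s≤r)

diagKey-injective : ∀ {n} {a b : Base n} → diagKey a ≡ diagKey b → a ≡ b
diagKey-injective {a = a} {b} e =
  rank-injective (≡.trans (≡.sym (half-suc-double (rank a))) (≡.trans (≡.cong ⌊_/2⌋ e) (half-suc-double (rank b))))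

∧-true⁻ : ∀ {a b} → a ∧ b ≡ true → a ≡ true × b ≡ true
∧-true⁻ {true} e = ≡.refl , e

∧-true⁺ : ∀ {a b} → a ≡ true → b ≡ true → a ∧ b ≡ true
∧-true⁺ ≡.refl e = e

not-true : ∀ {b} → not b ≡ true → b ≡ false
not-true {false} _ = ≡.refl

not-false : ∀ {b} → not b ≡ false → b ≡ true
not-false {true} _ = ≡.refl

implies⁻ : ∀ {a b} → not a ∨ b ≡ true → a ≡ true → b ≡ true
implies⁻ e ≡.refl = e

implies⁺ : ∀ {a b} → (a ≡ true → b ≡ true) → not a ∨ b ≡ true
implies⁺ {true}  e = e ≡.refl
implies⁺ {false} e = ≡.refl

allFinB⁻ : ∀ m {p} → allFinB m p ≡ true → ∀ i → p i ≡ true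
allFinB⁻ m {p} = go m id
  where
  go : ∀ k (e : Fin k → Fin m) → foldr (λ i r → p i ∧ r) true (tabulate e) ≡ true → ∀ i → p (e i) ≡ true
  go (suc k) e q zero    = proj₁ (∧-true⁻ q)
  go (suc k) e q (suc i) = go k (e ∘ suc) (proj₂ (∧-true⁻ {p (e zero)} q)) i

allFinB⁺ : ∀ m {p} → (∀ i → p i ≡ true) → allFinB m p ≡ true
allFinB⁺ m {p} h = go (allFin m)
  where
  go : ∀ is → foldr (λ i r → p i ∧ r) true is ≡ true
  go []       = ≡.refl
  go (i ∷ is) = ∧-true⁺ (h i) (go is)

allBelow⁻ : ∀ m {p} → allBelow m p ≡ true → ∀ {c} → c < m → p c ≡ true
allBelow⁻ (suc m) {p} q {c} (s≤s c≤m) with ∧-true⁻ {allBelow m p} q | ℕₚ.m≤n⇒m<n∨m≡n c≤m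
... | r , s | inj₁ c<m  = allBelow⁻ m r c<m
... | r , s | inj₂ ≡.refl = s

allBelow⁺ : ∀ m {p} → (∀ {c} → c < m → p c ≡ true) → allBelow m p ≡ true
allBelow⁺ zero    h = ≡.refl
allBelow⁺ (suc m) h = ∧-true⁺ (allBelow⁺ m (h ∘ ℕₚ.m≤n⇒m≤1+n)) (h ℕₚ.≤-refl)

rel⁻ : ∀ {n} {r : Letter n → Letter n → Bool} {x y a b} → rel r x y ≡ true → x ≡ just a → y ≡ just b → r a b ≡ true
rel⁻ e ≡.refl ≡.refl = e

rel⁺ : ∀ {n} {r : Letter n → Letter n → Bool} {x y} → (∀ {a b} → x ≡ just a → y ≡ just b → r a b ≡ true) → rel r x y ≡ true
rel⁺ {x = just a}  {just b}  h = h ≡.refl ≡.refl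
rel⁺ {x = just a}  {nothing} h = ≡.refl
rel⁺ {x = nothing} {just b}  h = ≡.refl
rel⁺ {x = nothing} {nothing} h = ≡.refl

vget-< : ∀ {A : Set} {k} (v : Vec A k) c {a} → vget v c ≡ just a → c < k
vget-< (x ∷ v) zero    e = s≤s z≤n
vget-< (x ∷ v) (suc c) e = s≤s (vget-< v c e)

vget-just : ∀ {A : Set} {k} (v : Vec A k) c → c < k → ∃ λ a → vget v c ≡ just a
vget-just (x ∷ v) zero    p       = x , ≡.refl
vget-just (x ∷ v) (suc c) (s≤s p) = vget-just v c p

Le St : ℕ → ℕ → Set
Le a b = a < b ⊎ (a ≡ b × isPrimed a ≡ false)
St a b = a < b ⊎ (a ≡ b × isPrimed a ≡ true)

le⁻ : ∀ {a b} → le a b ≡ true → Le a b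
le⁻ {a} {b} e with ℕₚ.<-cmp a b
... | tri< p _ _ = inj₁ p
... | tri> _ _ p with () ← ≡.trans (≡.sym e) (le-> p)
le⁻ {a} e | tri≈ _ ≡.refl _ = inj₂ (≡.refl , not-true (≡.trans (≡.sym (le-refl a)) e))

le⁺ : ∀ {a b} → Le a b → le a b ≡ true
le⁺ (inj₁ p)              = le-< p
le⁺ {a} (inj₂ (≡.refl , u)) = ≡.trans (le-refl a) (≡.cong not u)

st⁻ : ∀ {a b} → st a b ≡ true → St a b
st⁻ {a} {b} e with ℕₚ.<-cmp a b
... | tri< p _ _ = inj₁ p
... | tri> _ _ p with () ← ≡.trans (≡.sym e) (st-> p)
st⁻ {a} e | tri≈ _ ≡.refl _ = inj₂ (≡.refl , ≡.trans (≡.sym (st-refl a)) e)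

st⁺ : ∀ {a b} → St a b → st a b ≡ true
st⁺ (inj₁ p)              = st-< p
st⁺ {a} (inj₂ (≡.refl , u)) = ≡.trans (st-refl a) u

Le⇒≤ : ∀ {a b} → Le a b → a ≤ b
Le⇒≤ (inj₁ p)          = ℕₚ.<⇒≤ p
Le⇒≤ (inj₂ (≡.refl , _)) = ℕₚ.≤-refl

St⇒≤ : ∀ {a b} → St a b → a ≤ b
St⇒≤ (inj₁ p)          = ℕₚ.<⇒≤ p
St⇒≤ (inj₂ (≡.refl , _)) = ℕₚ.≤-refl

Le-trans : ∀ {a b c} → Le a b → Le b c → Le a c
Le-trans (inj₁ p)          q = inj₁ (ℕₚ.<-≤-trans p (Le⇒≤ q))
Le-trans (inj₂ (≡.refl , _)) q = q

St-trans : ∀ {a b c} → St a b → St b c → St a c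
St-trans (inj₁ p)          q = inj₁ (ℕₚ.<-≤-trans p (St⇒≤ q))
St-trans (inj₂ (≡.refl , _)) q = q

-- A diagonal step is a step to the right followed by a step down. Equality in both would make one
-- letter unprimed and primed at once.
Le-St-< : ∀ {a b c} → Le a b → St b c → a < c
Le-St-< (inj₁ p)          q                 = ℕₚ.<-≤-trans p (St⇒≤ q)
Le-St-< (inj₂ (≡.refl , _)) (inj₁ q)          = q
Le-St-< (inj₂ (≡.refl , u)) (inj₂ (≡.refl , v)) with () ← ≡.trans (≡.sym u) v

-- The default 0 is never reached on a filling of a strict shape, where each row contains its
-- diagonal box.
head₀ : List ℕ → ℕ
head₀ []      = 0
head₀ (x ∷ _) = x

module _ {n : ℕ} where

  ≤L⁻ : ∀ (a b : Letter n) → (a ≤L b) ≡ true → key a ≤ key b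
  ≤L⁻ a b e = ℕₚ.≤ᵇ⇒≤ _ _ (Equivalence.from T-≡ e)

  ≤L⁺ : ∀ {a b : Letter n} → key a ≤ key b → (a ≤L b) ≡ true
  ≤L⁺ p = Equivalence.to T-≡ (ℕₚ.≤⇒≤ᵇ p)

  key-≡ᵇ : ∀ {a b : Letter n} → key a ≡ key b → (a =L b) ≡ true
  key-≡ᵇ {b = b} q = ≡.trans (≡.cong (_≡ᵇ key b) q) (≡ᵇ-refl (key b))

  Le-intro : ∀ (a b : Letter n) → key a ≤ key b → not ((a =L b) ∧ primed a) ≡ true → Le (key a) (key b)
  Le-intro a b p e with ℕₚ.m≤n⇒m<n∨m≡n p
  ... | inj₁ q = inj₁ q
  ... | inj₂ q = inj₂ (q , ≡.trans (isPrimed-key a) (not-true (≡.trans (≡.cong (λ t → not (t ∧ primed a)) (≡.sym (key-≡ᵇ {a} {b} q))) e)))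

  Le-elim : ∀ (a b : Letter n) → Le (key a) (key b) → not ((a =L b) ∧ primed a) ≡ true
  Le-elim a b (inj₁ p) rewrite ≡ᵇ-false (ℕₚ.<⇒≢ p) = ≡.refl
  Le-elim a b (inj₂ (e , u)) = ≡.trans (≡.cong (λ t → not ((a =L b) ∧ t)) (≡.trans (≡.sym (isPrimed-key a)) u)) (≡.cong not (∧-zeroʳ (a =L b)))

  St-intro : ∀ (a b : Letter n) → key a ≤ key b → not ((a =L b) ∧ not (primed a)) ≡ true → St (key a) (key b)
  St-intro a b p e with ℕₚ.m≤n⇒m<n∨m≡n p
  ... | inj₁ q = inj₁ q
  ... | inj₂ q = inj₂ (q , ≡.trans (isPrimed-key a) (not-false (not-true (≡.trans (≡.cong (λ t → not (t ∧ not (primed a))) (≡.sym (key-≡ᵇ {a} {b} q))) e))))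

  St-elim : ∀ (a b : Letter n) → St (key a) (key b) → not ((a =L b) ∧ not (primed a)) ≡ true
  St-elim a b (inj₁ p) rewrite ≡ᵇ-false (ℕₚ.<⇒≢ p) = ≡.refl
  St-elim a b (inj₂ (e , u)) =
    ≡.trans (≡.cong (λ t → not ((a =L b) ∧ not t)) (≡.trans (≡.sym (isPrimed-key a)) u)) (≡.cong not (∧-zeroʳ (a =L b)))

  keys : ∀ {k} → Vec (Letter n) k → List ℕ
  keys v = map key (toList v)

  headBase : ∀ {k} → Vec (Letter n) k → Base n
  headBase []      = zer
  headBase (a ∷ _) = base a

  RowNice : ∀ {k} → Vec (Letter n) k → Set
  RowNice v = ∀ c {a b} → vget v c ≡ just a → vget v (suc c) ≡ just b → Le (key a) (key b)

  -- Positions count from the diagonal box of each row, so box `c` of a row lies under box `suc c`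
  -- of the previous one.
  AdjNice : ∀ {k k'} → Vec (Letter n) k → Vec (Letter n) k' → Set
  AdjNice v v' = ∀ c {a b} → vget v (suc c) ≡ just a → vget v' c ≡ just b → St (key a) (key b)

  row⇒link : ∀ {k} (v : Vec (Letter n) k) → RowNice v → link (head₀ (keys v)) (drop 1 (keys v)) ≡ true
  row⇒link []          r = ≡.refl
  row⇒link (a ∷ [])    r = ≡.refl
  row⇒link (a ∷ b ∷ v) r = ∧-true⁺ (le⁺ (r 0 ≡.refl ≡.refl)) (row⇒link (b ∷ v) (λ c → r (suc c)))

  link⇒row : ∀ {k} (v : Vec (Letter n) k) → link (head₀ (keys v)) (drop 1 (keys v)) ≡ true → RowNice v
  link⇒row (a ∷ b ∷ v) e zero    ≡.refl ≡.refl = le⁻ (proj₁ (∧-true⁻ e))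
  link⇒row (a ∷ b ∷ v) e (suc c) p    q    = link⇒row (b ∷ v) (proj₂ (∧-true⁻ {le (key a) (key b)} e)) c p q

  adj⇒below : ∀ {k k'} (v : Vec (Letter n) k) (v' : Vec (Letter n) k') → k' < k → AdjNice v v' →
              below? (drop 1 (keys v)) (keys v') ≡ true
  adj⇒below (a ∷ v)     []       p       r = ≡.refl
  adj⇒below (a ∷ [])    (b ∷ v') (s≤s ()) r
  adj⇒below (a ∷ x ∷ v) (b ∷ v') (s≤s p) r = ∧-true⁺ (st⁺ (r 0 ≡.refl ≡.refl)) (adj⇒below (x ∷ v) v' p (λ c → r (suc c)))

  below⇒adj : ∀ {k k'} (v : Vec (Letter n) k) (v' : Vec (Letter n) k') →
              below? (drop 1 (keys v)) (keys v') ≡ true → AdjNice v v'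
  below⇒adj (a ∷ x ∷ v) (b ∷ v') e zero    ≡.refl ≡.refl = st⁻ (proj₁ (∧-true⁻ e))
  below⇒adj (a ∷ x ∷ v) (b ∷ v') e (suc c) p    q    = below⇒adj (x ∷ v) v' (proj₂ (∧-true⁻ {st (key x) (key b)} e)) c p q

  head-drop : ∀ {k} (v : Vec (Letter n) k) → 0 < k → head₀ (keys v) ∷ drop 1 (keys v) ≡ keys v
  head-drop (a ∷ v) p = ≡.refl

-- The conditions tested by the indicators in `val`, stated without the ring: a value is either a
-- plain product of weights or zero.
data Good : List ℕ → List (List ℕ) → Set where
  []  : Good [] []
  row : ∀ {d v ds vs} → link d v ≡ true → next? v ds vs ≡ true → Good ds vs → Good (d ∷ ds) (v ∷ vs)

good⁺ : ∀ m (d : Fin m → ℕ) (t : Fin m → List ℕ) → (∀ i → link (d i) (t i) ≡ true) →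
        (∀ i i' → toℕ i' ≡ suc (toℕ i) → below? (t i) (d i' ∷ t i') ≡ true) → Good (tabulate d) (tabulate t)
good⁺ zero          d t l b = []
good⁺ (suc zero)    d t l b = row (l zero) ≡.refl []
good⁺ (suc (suc m)) d t l b = row (l zero) (b zero (suc zero) ≡.refl)
  (good⁺ (suc m) (d ∘ suc) (t ∘ suc) (l ∘ suc) (λ i i' e → b (suc i) (suc i') (≡.cong suc e)))

good⁻ : ∀ m (d : Fin m → ℕ) (t : Fin m → List ℕ) → Good (tabulate d) (tabulate t) →
        (∀ i → link (d i) (t i) ≡ true) × (∀ i i' → toℕ i' ≡ suc (toℕ i) → below? (t i) (d i' ∷ t i') ≡ true)
good⁻ zero          d t []          = (λ ()) , (λ ())
good⁻ (suc zero)    d t (row l b G) = (λ { zero → l }) , λ { zero zero () }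
good⁻ (suc (suc m)) d t (row l b G) with good⁻ (suc m) (d ∘ suc) (t ∘ suc) G
... | ls , bs = (λ { zero → l ; (suc i) → ls i })
              , λ { zero (suc zero) e → b ; (suc i) (suc i') e → bs i i' (ℕₚ.suc-injective e) }

count-tabulate : ∀ {A B : Set} m (e : Fin m → A) (e' : Fin m → B) {q : A → Bool} {r : B → Bool} → (∀ i → q (e i) ≡ r (e' i)) →
                 length (filterᵇ q (tabulate e)) ≡ length (filterᵇ r (tabulate e'))
count-tabulate zero    e e' h = ≡.refl
count-tabulate (suc m) e e' {q} {r} h with q (e zero) | r (e' zero) | h zero
... | true  | true  | _ = ≡.cong suc (count-tabulate m (e ∘ suc) (e' ∘ suc) (h ∘ suc))
... | false | false | _ = count-tabulate m (e ∘ suc) (e' ∘ suc) (h ∘ suc)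

linked-tabulate : ∀ {A : Set} {_~_ : A → A → Set} m (e : Fin m → A) → (∀ i i' → toℕ i' ≡ suc (toℕ i) → e i ~ e i') → Linked _~_ (tabulate e)
linked-tabulate zero          e h = []
linked-tabulate (suc zero)    e h = [-]
linked-tabulate (suc (suc m)) e h = h zero (suc zero) ≡.refl ∷ linked-tabulate (suc m) (e ∘ suc) (λ i i' p → h (suc i) (suc i') (≡.cong suc p))

module Validity {n : ℕ} {lam : Fin n → ℕ} (strict : StrictPartition n lam) (P : Filling n lam) where

  -- Rows and columns are constrained through neighbours only. Transitivity recovers the conditions
  -- of `valid` on distant boxes, and a row step followed by a column step recovers the strict
  -- diagonals.
  record Nice : Set where
    field
      rows     : ∀ i → RowNice (P i)
      adjacent : ∀ i i' → toℕ i' ≡ suc (toℕ i) → AdjNice (P i) (P i')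
      unprimed : ∀ i {a} → vget (P i) 0 ≡ just a → primed a ≡ false
      once     : ∀ k → countFin n (λ i → isKorBar P k (diagEntry P i)) ≡ 1
  open Nice public

  entry-at : ∀ i c → entry P i (toℕ i ℕ.+ c) ≡ vget (P i) c
  entry-at i c rewrite Equivalence.to T-≡ (ℕₚ.≤⇒≤ᵇ (ℕₚ.m≤m+n (toℕ i) c)) | ℕₚ.m+n∸m≡n (toℕ i) c = ≡.refl

  entry-suc : ∀ i c → entry P i (suc (toℕ i ℕ.+ c)) ≡ vget (P i) (suc c)
  entry-suc i c = ≡.trans (≡.cong (entry P i) (≡.sym (ℕₚ.+-suc (toℕ i) c))) (entry-at i (suc c))

  entry-below : ∀ (i i' : Fin n) → toℕ i' ≡ suc (toℕ i) → ∀ c → entry P i' (suc (toℕ i ℕ.+ c)) ≡ vget (P i') c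
  entry-below i i' e c = ≡.trans (≡.cong (λ t → entry P i' (t ℕ.+ c)) (≡.sym e)) (entry-at i' c)

  entry-left : ∀ (i i' : Fin n) → toℕ i' ≡ suc (toℕ i) → entry P i' (toℕ i ℕ.+ 0) ≡ nothing
  entry-left i i' e rewrite ℕₚ.+-identityʳ (toℕ i) | e | <ᵇ-false (ℕₚ.≤-refl {toℕ i}) = ≡.refl

  diagEntry≡ : ∀ i → diagEntry P i ≡ vget (P i) 0
  diagEntry≡ i = ≡.trans (≡.cong (entry P i) (≡.sym (ℕₚ.+-identityʳ (toℕ i)))) (entry-at i 0)

  allBoxes⁻ : {p : Fin n → ℕ → Bool} → allBoxes P p ≡ true → ∀ i {c} → c < lam i → p i (toℕ i ℕ.+ c) ≡ true
  allBoxes⁻ e i q = allBelow⁻ (lam i) (allFinB⁻ n e i) q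

  allBoxes⁺ : {p : Fin n → ℕ → Bool} → (∀ i {c} → c < lam i → p i (toℕ i ℕ.+ c) ≡ true) → allBoxes P p ≡ true
  allBoxes⁺ h = allFinB⁺ n λ i → allBelow⁺ (lam i) (h i)

  step : Fin n → ℕ → Bool
  step i j =
      rel _≤L_ (entry P i j) (entry P i (suc j))
    ∧ allFinB n (λ i' → not (toℕ i' ≡ᵇ suc (toℕ i)) ∨ (rel _≤L_ (entry P i j) (entry P i' j) ∧ rel _<L_ (entry P i j) (entry P i' (suc j))))

  rowPair colPair : Fin n → ℕ → Fin n → ℕ → Bool
  rowPair i j i' j' = not ((toℕ i ≡ᵇ toℕ i') ∧ (j <ᵇ j')) ∨ rel (λ a b → not ((a =L b) ∧ primed a)) (entry P i j) (entry P i' j')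
  colPair i j i' j' = not ((toℕ i <ᵇ toℕ i') ∧ (j ≡ᵇ j')) ∨ rel (λ a b → not ((a =L b) ∧ not (primed a))) (entry P i j) (entry P i' j')

  pairs⁻ : (pair : Fin n → ℕ → Fin n → ℕ → Bool) → allBoxes P (λ i j → allBoxes P (pair i j)) ≡ true →
           ∀ {i c i' c'} → c < lam i → c' < lam i' → pair i (toℕ i ℕ.+ c) i' (toℕ i' ℕ.+ c') ≡ true
  pairs⁻ pair e {i} {c} {i'} q q' = allBoxes⁻ {pair i (toℕ i ℕ.+ c)} (allBoxes⁻ {λ i j → allBoxes P (pair i j)} e i q) i' q'

  pairs⁺ : (pair : Fin n → ℕ → Fin n → ℕ → Bool) → (∀ i c i' c' → pair i (toℕ i ℕ.+ c) i' (toℕ i' ℕ.+ c') ≡ true) → allBoxes P (λ i j → allBoxes P (pair i j)) ≡ true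
  pairs⁺ pair h = allBoxes⁺ {λ i j → allBoxes P (pair i j)} λ i {c} _ → allBoxes⁺ {pair i (toℕ i ℕ.+ c)} λ i' {c'} _ → h i c i' c'

  lam-suc : ∀ {i i' : Fin n} → toℕ i' ≡ suc (toℕ i) → lam i' < lam i
  lam-suc {i} {i'} e = proj₁ strict i i' (ℕₚ.≤-reflexive (≡.sym e))

  valid⇒nice : valid P ≡ true → Nice
  valid⇒nice v with ∧-true⁻ {monotone P} v
  ... | mono , v₁ with ∧-true⁻ {rowPrimed P} v₁
  ...   | rowP , v₂ with ∧-true⁻ {colUnprimed P} v₂
  ...     | colU , diag with ∧-true⁻ {allFinB n (λ i → rel (λ a _ → not (primed a)) (diagEntry P i) (diagEntry P i))} diag
  ...       | unp , cnt = record
    { rows     = row-nice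
    ; adjacent = adj-nice
    ; unprimed = λ i {a} e → not-true (rel⁻ (allFinB⁻ n unp i) (≡.trans (diagEntry≡ i) e) (≡.trans (diagEntry≡ i) e))
    ; once     = λ k → ℕₚ.≡ᵇ⇒≡ _ 1 (Equivalence.from T-≡ (allFinB⁻ n cnt k))
    }
    where
    row-nice : ∀ i → RowNice (P i)
    row-nice i c {a} {b} p q = Le-intro a b
      (≤L⁻ a b (rel⁻ (proj₁ (∧-true⁻ (allBoxes⁻ {step} mono i c<))) (≡.trans (entry-at i c) p) (≡.trans (entry-suc i c) q)))
      (rel⁻ (implies⁻ (pairs⁻ rowPair rowP {i} {c} {i} {suc c} c< sc<)
               (∧-true⁺ (≡ᵇ-refl (toℕ i)) (<ᵇ-true (ℕₚ.+-monoʳ-< (toℕ i) (ℕₚ.≤-refl {suc c})))))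
            (≡.trans (entry-at i c) p) (≡.trans (entry-at i (suc c)) q))
      where
      c< : c < lam i
      c< = vget-< (P i) c p
      sc< : suc c < lam i
      sc< = vget-< (P i) (suc c) q
    adj-nice : ∀ i i' → toℕ i' ≡ suc (toℕ i) → AdjNice (P i) (P i')
    adj-nice i i' e c {a} {b} p q = St-intro a b
      (≤L⁻ a b (rel⁻ (proj₁ (∧-true⁻ (implies⁻ (allFinB⁻ n (proj₂ (∧-true⁻ {rel _≤L_ (entry P i (toℕ i ℕ.+ suc c)) _} (allBoxes⁻ {step} mono i sc<))) i')
                                       (≡.trans (≡.cong (_≡ᵇ suc (toℕ i)) e) (≡ᵇ-refl (toℕ i))))))
                     (≡.trans (entry-at i (suc c)) p)
                     (≡.trans (≡.cong (entry P i') (ℕₚ.+-suc (toℕ i) c)) (≡.trans (entry-below i i' e c) q))))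
      (rel⁻ (implies⁻ (pairs⁻ colPair colU {i} {suc c} {i'} {c} sc< c<)
               (∧-true⁺ (<ᵇ-true (ℕₚ.≤-reflexive (≡.sym e)))
                        (≡.trans (≡.cong₂ _≡ᵇ_ (ℕₚ.+-suc (toℕ i) c) (≡.cong (ℕ._+ c) e)) (≡ᵇ-refl (toℕ i ℕ.+ c)))))
            (≡.trans (entry-at i (suc c)) p) (≡.trans (entry-at i' c) q))
      where
      sc< : suc c < lam i
      sc< = vget-< (P i) (suc c) p
      c< : c < lam i'
      c< = vget-< (P i') c q

  row-chain : ∀ {k} (v : Vec (Letter n) k) → RowNice v → ∀ c d {a b} → vget v c ≡ just a → vget v (suc (d ℕ.+ c)) ≡ just b → Le (key a) (key b)
  row-chain v r c zero    p q = r c p q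
  row-chain v r c (suc d) p q with vget-just v (suc (d ℕ.+ c)) (ℕₚ.<⇒≤ (vget-< v (suc (suc (d ℕ.+ c))) q))
  ... | x , e = Le-trans (row-chain v r c d p e) (r (suc (d ℕ.+ c)) e q)

  column-chain : (∀ i i' → toℕ i' ≡ suc (toℕ i) → AdjNice (P i) (P i')) →
                 ∀ d i i' c {a b} → toℕ i' ≡ suc (d ℕ.+ toℕ i) →
                 vget (P i) (suc (d ℕ.+ c)) ≡ just a → vget (P i') c ≡ just b → St (key a) (key b)
  column-chain adj zero    i i' c e p q = adj i i' e c p q
  -- The intermediate box belongs to the diagram: row `j`, directly above row `i'`, is longer than
  -- row `i'` and so reaches position `suc c`.
  column-chain adj (suc d) i i' c {a} e p q with vget-just (P j) (suc c) (ℕₚ.≤-<-trans (vget-< (P i') c q) (lam-suc j-suc))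
    where
    j< : suc (d ℕ.+ toℕ i) < n
    j< = ℕₚ.<⇒≤ (≡.subst (ℕ._< n) e (Finₚ.toℕ<n i'))
    j : Fin n
    j = Fin.fromℕ< j<
    j-suc : toℕ i' ≡ suc (toℕ j)
    j-suc = ≡.trans e (≡.cong suc (≡.sym (Finₚ.toℕ-fromℕ< j<)))
  ... | x , f = St-trans
    (column-chain adj d i _ (suc c) (Finₚ.toℕ-fromℕ< _) (≡.trans (≡.cong (vget (P i) ∘ suc) (ℕₚ.+-suc d c)) p) f)
    (adj _ i' (≡.trans e (≡.cong suc (≡.sym (Finₚ.toℕ-fromℕ< _)))) c f q)

  nice⇒valid : Nice → valid P ≡ true
  nice⇒valid N = ∧-true⁺ mono (∧-true⁺ rowP (∧-true⁺ colU (∧-true⁺ unp cnt)))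
    where
    mono : monotone P ≡ true
    mono = allBoxes⁺ {step} λ i {c} c< → ∧-true⁺
      (rel⁺ λ {a} {b} p q → ≤L⁺ {a = a} {b} (Le⇒≤ (rows N i c (≡.trans (≡.sym (entry-at i c)) p) (≡.trans (≡.sym (entry-suc i c)) q))))
      (allFinB⁺ n λ i' → implies⁺ λ e → let e' = ℕₚ.≡ᵇ⇒≡ _ _ (Equivalence.from T-≡ e) in
        ∧-true⁺ (rel⁺ λ {a} {b} p q → ≤L⁺ {a = a} {b} (down i i' e' c p q))
                (rel⁺ λ {a} {b} p q → <ᵇ-true (diagonal i i' e' c c< (≡.trans (≡.sym (entry-at i c)) p) (≡.trans (≡.sym (entry-below i i' e' c)) q))))
      where
      down : ∀ i i' → toℕ i' ≡ suc (toℕ i) → ∀ c {a b} → entry P i (toℕ i ℕ.+ c) ≡ just a → entry P i' (toℕ i ℕ.+ c) ≡ just b → key a ≤ key b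
      -- The place directly below a diagonal box lies outside the shifted diagram.
      down i i' e zero p q with () ← ≡.trans (≡.sym q) (entry-left i i' e)
      down i i' e (suc c) p q = St⇒≤ (adjacent N i i' e c (≡.trans (≡.sym (entry-at i (suc c))) p)
        (≡.trans (≡.sym (entry-below i i' e c)) (≡.trans (≡.cong (entry P i') (≡.sym (ℕₚ.+-suc (toℕ i) c))) q)))
      diagonal : ∀ i i' → toℕ i' ≡ suc (toℕ i) → ∀ c {a b} → c < lam i → vget (P i) c ≡ just a → vget (P i') c ≡ just b → key a < key b
      diagonal i i' e c c< p q with vget-just (P i) (suc c) (ℕₚ.≤-<-trans (vget-< (P i') c q) (lam-suc e))
      ... | x , f = Le-St-< (rows N i c p f) (adjacent N i i' e c f q)
    rowP : rowPrimed P ≡ true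
    rowP = pairs⁺ rowPair λ i c i' c' → implies⁺ λ e → rel⁺ λ {a} {b} p q →
      go i i' c c' (Finₚ.toℕ-injective (ℕₚ.≡ᵇ⇒≡ _ _ (Equivalence.from T-≡ (proj₁ (∧-true⁻ e)))))
         (<ᵇ-true⁻¹ (proj₂ (∧-true⁻ {toℕ i ≡ᵇ toℕ i'} e))) (≡.trans (≡.sym (entry-at i c)) p) (≡.trans (≡.sym (entry-at i' c')) q)
      where
      go : ∀ i i' c c' {a b} → i ≡ i' → toℕ i ℕ.+ c < toℕ i' ℕ.+ c' → vget (P i) c ≡ just a → vget (P i') c' ≡ just b →
           not ((a =L b) ∧ primed a) ≡ true
      go i i' c c' {a} {b} ≡.refl l p q = Le-elim a b (row-chain (P i) (rows N i) c (c' ∸ suc c) p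
        (≡.trans (≡.cong (vget (P i)) (≡.trans (≡.sym (ℕₚ.+-suc (c' ∸ suc c) c)) (ℕₚ.m∸n+n≡m (ℕₚ.+-cancelˡ-< (toℕ i) c c' l)))) q))
    colU : colUnprimed P ≡ true
    colU = pairs⁺ colPair λ i c i' c' → implies⁺ λ e → rel⁺ λ {a} {b} p q →
      go i i' c c' (<ᵇ-true⁻¹ (proj₁ (∧-true⁻ e))) (ℕₚ.≡ᵇ⇒≡ _ _ (Equivalence.from T-≡ (proj₂ (∧-true⁻ {toℕ i <ᵇ toℕ i'} e))))
         (≡.trans (≡.sym (entry-at i c)) p) (≡.trans (≡.sym (entry-at i' c')) q)
      where
      go : ∀ i i' c c' {a b} → toℕ i < toℕ i' → toℕ i ℕ.+ c ≡ toℕ i' ℕ.+ c' → vget (P i) c ≡ just a → vget (P i') c' ≡ just b →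
           not ((a =L b) ∧ not (primed a)) ≡ true
      go i i' c c' {a} {b} l e p q = St-elim a b (column-chain (adjacent N) d i i' c' i'≡ (≡.trans (≡.cong (vget (P i)) (≡.sym c≡)) p) q)
        where
        d = toℕ i' ∸ suc (toℕ i)
        i'≡ : toℕ i' ≡ suc (d ℕ.+ toℕ i)
        i'≡ = ≡.trans (≡.sym (ℕₚ.m∸n+n≡m l)) (ℕₚ.+-suc d (toℕ i))
        c≡ : c ≡ suc (d ℕ.+ c')
        c≡ = ℕₚ.+-cancelˡ-≡ (toℕ i) c _ (≡.trans e (≡.trans (≡.cong (ℕ._+ c') (≡.trans i'≡ (≡.cong suc (ℕₚ.+-comm d (toℕ i)))))
               (≡.trans (≡.cong suc (ℕₚ.+-assoc (toℕ i) d c')) (≡.sym (ℕₚ.+-suc (toℕ i) (d ℕ.+ c'))))))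
    unp : allFinB n (λ i → rel (λ a _ → not (primed a)) (diagEntry P i) (diagEntry P i)) ≡ true
    unp = allFinB⁺ n λ i → rel⁺ λ p _ → ≡.cong not (unprimed N i (≡.trans (≡.sym (diagEntry≡ i)) p))
    cnt : allFinB n (λ k → countFin n (λ i → isKorBar P k (diagEntry P i)) ≡ᵇ 1) ≡ true
    cnt = allFinB⁺ n λ k → Equivalence.to T-≡ (ℕₚ.≡⇒≡ᵇ _ 1 (once N k))

  heads : Fin n → Base n
  heads i = headBase (P i)

  head-just : ∀ i → ∃ λ a → vget (P i) 0 ≡ just a × headBase (P i) ≡ base a × head₀ (keys (P i)) ≡ key a
  head-just i = go (P i) (proj₂ strict i)
    where
    go : ∀ {k} (v : Vec (Letter n) k) → 0 < k → ∃ λ a → vget v 0 ≡ just a × headBase v ≡ base a × head₀ (keys v) ≡ key a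
    go (a ∷ v) p = a , ≡.refl , ≡.refl , ≡.refl

  isKorBar≡ : ∀ k i → isKorBar P k (diagEntry P i) ≡ isOf k (heads i)
  isKorBar≡ k i with head-just i
  ... | mkL b p , e , f , _ = ≡.trans (≡.cong (isKorBar P k) (≡.trans (diagEntry≡ i) e)) (≡.trans (go b) (≡.cong (isOf k) (≡.sym f)))
    where
    go : ∀ b → isKorBar P k (just (mkL b p)) ≡ isOf k b
    go (num _) = ≡.refl
    go zer     = ≡.refl
    go (bar _) = ≡.refl

  count≡ : ∀ k → countFin n (λ i → isKorBar P k (diagEntry P i)) ≡ count k (tabulate heads)
  count≡ k = count-tabulate n id heads (isKorBar≡ k)

  head-key : (∀ i {a} → vget (P i) 0 ≡ just a → primed a ≡ false) → ∀ i → head₀ (keys (P i)) ≡ diagKey (heads i)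
  head-key unp i with head-just i
  ... | mkL b p , e , f , g rewrite f = ≡.trans g (≡.trans (≡.cong (key ∘ mkL b) (unp i e)) (key-unprimed b))

  nice⇒admissible : Nice → Admissible (allFin n) (tabulate heads)
  nice⇒admissible N = admissible
    (Linked⇒AllPairs ℕₚ.<-trans (linked-tabulate n heads λ i i' e → increase i i' e))
    (All.universal within-all (tabulate heads))
    (≡.trans (length-tabulate heads) (≡.sym (length-tabulate id)))
    λ {j} _ → ≡.trans (≡.sym (count≡ j)) (once N j)
    where
    within-all : ∀ b → Within (allFin n) b
    within-all (num j) = num (∈-allFin j)
    within-all zer     = zer
    within-all (bar j) = bar (∈-allFin j)
    -- The path goes through the box to the right of the first diagonal box, which exists because
    -- row `i` is longer than the non-empty row `i'`. Both diagonal codes are odd, so a strict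
    -- inequality of codes passes to ranks.
    increase : ∀ i i' → toℕ i' ≡ suc (toℕ i) → heads i <ᴿ heads i'
    increase i i' e with head-just i | head-just i' | vget-just (P i) 1 (ℕₚ.≤-<-trans (proj₂ strict i') (lam-suc e))
    ... | a , p , _ , k | b , q , _ , l | x , f = double-cancel-< (ℕₚ.≤-pred (≡.subst₂ ℕ._<_
            (≡.trans (≡.sym k) (head-key (unprimed N) i)) (≡.trans (≡.sym l) (head-key (unprimed N) i'))
            (Le-St-< (rows N i 0 p f) (adjacent N i i' e 0 f q))))

  headKeys : List ℕ
  headKeys = tabulate (λ i → head₀ (keys (P i)))

  tails : List (List ℕ)
  tails = tabulate (λ i → drop 1 (keys (P i)))

  nice⇒headKeys : Nice → headKeys ≡ map diagKey (tabulate heads)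
  nice⇒headKeys N = ≡.trans (tabulate-cong (head-key (unprimed N))) (≡.sym (map-tabulate heads diagKey))

  nice⇒good : Nice → Good headKeys tails
  nice⇒good N = good⁺ n _ _ (λ i → row⇒link (P i) (rows N i)) λ i i' e →
    ≡.trans (≡.cong (below? _) (head-drop (P i') (proj₂ strict i'))) (adj⇒below (P i) (P i') (lam-suc e) (adjacent N i i' e))

  -- The codes of `D` are odd, which makes the diagonal unprimed; they then determine its bases, so
  -- that `once` is inherited from `D`.
  good⇒nice : ∀ {D} → Admissible (allFin n) D → headKeys ≡ map diagKey D → Good headKeys tails → Nice
  good⇒nice {D} A e G with good⁻ n _ _ G
  ... | ls , bs = record
    { rows     = λ i → link⇒row (P i) (ls i)
    ; adjacent = λ i i' q → below⇒adj (P i) (P i') (≡.trans (≡.cong (below? _) (≡.sym (head-drop (P i') (proj₂ strict i')))) (bs i i' q))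
    ; unprimed = unp
    ; once     = λ k → ≡.trans (count≡ k) (≡.trans (≡.cong (count k) heads≡) (once′ k))
    }
    where
    once′ : ∀ k → count k D ≡ 1
    once′ k = Admissible.once A (∈-allFin k)
    all-unprimed : All (λ x → isPrimed x ≡ false) headKeys
    all-unprimed = ≡.subst (All _) (≡.sym e) (Allₚ.map⁺ (All.universal (λ b → isPrimed-suc-double (rank b)) D))
    unp : ∀ i {a} → vget (P i) 0 ≡ just a → primed a ≡ false
    unp i {a} p with head-just i
    ... | b , q , _ , k with just-injective (≡.trans (≡.sym p) q)
    ...   | ≡.refl = ≡.trans (≡.sym (isPrimed-key a)) (≡.trans (≡.cong isPrimed (≡.sym k)) (Allₚ.tabulate⁻ {f = λ i → head₀ (keys (P i))} all-unprimed i))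
    heads≡ : tabulate heads ≡ D
    heads≡ = map-injective diagKey-injective (≡.trans (map-tabulate heads diagKey) (≡.trans (≡.sym (tabulate-cong (head-key unp))) e))

-- Summing over all fillings and collecting by diagonal

eqL : List ℕ → List ℕ → Bool
eqL []       []       = true
eqL (x ∷ xs) (y ∷ ys) = (x ≡ᵇ y) ∧ eqL xs ys
eqL _        _        = false

eqL-refl : ∀ xs → eqL xs xs ≡ true
eqL-refl []       = ≡.refl
eqL-refl (x ∷ xs) = ∧-true⁺ (≡ᵇ-refl x) (eqL-refl xs)

eqL⇒≡ : ∀ xs ys → eqL xs ys ≡ true → xs ≡ ys
eqL⇒≡ []       []       e = ≡.refl
eqL⇒≡ (x ∷ xs) (y ∷ ys) e =
  ≡.cong₂ _∷_ (ℕₚ.≡ᵇ⇒≡ x y (Equivalence.from T-≡ (proj₁ (∧-true⁻ e)))) (eqL⇒≡ xs ys (proj₂ (∧-true⁻ {x ≡ᵇ y} e)))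

module Assembly {c ℓ} (R : CommutativeRing c ℓ) {n : ℕ} (p : Params R n) where
  open CommutativeRing R hiding (zero)
  open import Algebra.Solver.Ring.NaturalCoefficients.Default commutativeSemiring using (solve; _:=_; _:*_)
  open import Relation.Binary.Reasoning.Setoid setoid
  open Sums R
  open Expansion R p
  module Sum = RangeProducts +-commutativeMonoid

  Σ<-range : ∀ K f → Σ< K f ≈ Sum.∏< K f
  Σ<-range zero    f = refl
  Σ<-range (suc K) f = trans (+-congʳ (Σ<-range K f)) (sym (Sum.∏<-snoc K f))

  Σ<-double : ∀ K f → Σ< (double K) f ≈ Σ< K (λ r → f (double r) + f (suc (double r)))
  Σ<-double zero    f = refl
  Σ<-double (suc K) f = trans (+-assoc _ _ _) (+-congʳ (Σ<-double K f))

  -- `allBases` lists the barred bases by increasing index, hence by decreasing rank, so their part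
  -- of the sum is reversed.
  bases-sum : ∀ f → ∑ (allBases n) (f ∘ rank) ≈ Σ< (suc (n ℕ.+ n)) f
  bases-sum f = begin
    ∑ (allBases n) (f ∘ rank)
      ≈⟨ ∑-++ (map num (allFin n)) _ _ ⟩
    ∑ (map num (allFin n)) (f ∘ rank) + (f n + ∑ (map bar (allFin n)) (f ∘ rank))
      ≡⟨ ≡.cong₂ (λ s t → s + (f n + t)) (∑-map num (allFin n) _) (∑-map bar (allFin n) _) ⟩
    ∑ (allFin n) (f ∘ toℕ) + (f n + ∑ (allFin n) (λ k → f (n ℕ.+ (n ∸ toℕ k))))
      ≈⟨ +-cong (Sum.prod-tabulate n id _ f (λ _ → refl)) (+-congˡ (trans
           (Sum.prod-tabulate n id _ (λ k → f (n ℕ.+ (n ∸ k))) (λ _ → refl)) (sym (Sum.∏<-reverse n _)))) ⟩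
    Sum.∏< n f + (f n + Sum.∏< n (λ i → f (n ℕ.+ (n ∸ (n ∸ suc i)))))
      ≈⟨ +-congˡ (+-cong (reflexive (≡.cong f (≡.sym (ℕₚ.+-identityʳ n))))
           (Sum.∏<-cong n λ i i<n → reflexive (≡.cong (λ t → f (n ℕ.+ t)) (ℕₚ.m∸[m∸n]≡n i<n)))) ⟩
    Sum.∏< n f + Sum.∏< (suc n) (λ i → f (n ℕ.+ i))
      ≈⟨ Sum.∏<-+ n (suc n) f ⟨
    Sum.∏< (n ℕ.+ suc n) f
      ≡⟨ ≡.cong (λ t → Sum.∏< t f) (ℕₚ.+-suc n n) ⟩
    Sum.∏< (suc (n ℕ.+ n)) f
      ≈⟨ Σ<-range (suc (n ℕ.+ n)) f ⟨
    Σ< (suc (n ℕ.+ n)) f ∎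

  letters-sum : ∀ f → ∑ (allLetters n) (f ∘ key) ≈ Σ< size f
  letters-sum f = begin
    ∑ (allLetters n) (f ∘ key)
      ≈⟨ ∑-concatMap _ (allBases n) _ ⟩
    ∑ (allBases n) (λ b → f (key (mkL b true)) + (f (key (mkL b false)) + 0#))
      ≈⟨ ∑-cong (allBases n) (λ b → +-cong (reflexive (≡.cong f (key-primed b)))
           (trans (+-identityʳ _) (reflexive (≡.cong f (key-unprimed b))))) ⟩
    ∑ (allBases n) (λ b → f (double (rank b)) + f (suc (double (rank b))))
      ≈⟨ bases-sum (λ r → f (double r) + f (suc (double r))) ⟩
    Σ< (suc (n ℕ.+ n)) (λ r → f (double r) + f (suc (double r)))
      ≈⟨ Σ<-double (suc (n ℕ.+ n)) f ⟨
    Σ< size f ∎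

  vecs-sum : ∀ k G → ∑ (allVecs (allLetters n) k) (λ v → G (keys v)) ≈ Words size k G
  vecs-sum zero    G = +-identityʳ _
  vecs-sum (suc k) G = begin
    ∑ (allVecs (allLetters n) (suc k)) (λ v → G (keys v))
      ≈⟨ ∑-concatMap _ (allLetters n) _ ⟩
    ∑ (allLetters n) (λ a → ∑ (map (a ∷_) (allVecs (allLetters n) k)) (λ v → G (keys v)))
      ≈⟨ ∑-cong (allLetters n) (λ a → trans (reflexive (∑-map (a ∷_) (allVecs (allLetters n) k) _)) (vecs-sum k (λ v → G (key a ∷ v)))) ⟩
    ∑ (allLetters n) (λ a → Words size k (λ v → G (key a ∷ v)))
      ≈⟨ letters-sum (λ x → Words size k (λ v → G (x ∷ v))) ⟩
    Words size (suc k) G ∎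

  fillings-sum : ∀ m (lam : Fin m → ℕ) G →
    ∑ (allDep m (λ i → Vec (Letter n) (lam i)) (λ i → allVecs (allLetters n) (lam i))) (λ P → G (tabulate (λ i → keys (P i))))
    ≈ Rows size (tabulate lam) G
  fillings-sum zero    lam G = +-identityʳ _
  fillings-sum (suc m) lam G = trans (∑-concatMap _ (allVecs (allLetters n) (lam zero)) _)
    (trans (∑-cong (allVecs (allLetters n) (lam zero)) λ v →
              trans (reflexive (∑-map (consF {B = λ i → Vec (Letter n) (lam i)} v) (allDep m _ _) _))
                    (fillings-sum m (lam ∘ suc) (λ vs → G (keys v ∷ vs))))
           (vecs-sum (lam zero) (λ v → Rows size (tabulate (lam ∘ suc)) (λ vs → G (v ∷ vs)))))

  Rows-+ : ∀ K m F G → Rows K m (λ vs → F vs + G vs) ≈ Rows K m F + Rows K m G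
  Rows-+ K []      F G = refl
  Rows-+ K (k ∷ m) F G = trans (Words-cong K k λ v _ _ → Rows-+ K m _ _) (Words-+ K k _ _)

  Rows-∑ : ∀ {A : Set} K m (xs : List A) (F : A → List (List ℕ) → Carrier) →
           Rows K m (λ vs → ∑ xs (λ x → F x vs)) ≈ ∑ xs (λ x → Rows K m (F x))
  Rows-∑ K m []       F = Rows-zero K m (λ _ _ → refl)
  Rows-∑ K m (x ∷ xs) F = trans (Rows-+ K m _ _) (+-congˡ (Rows-∑ K m xs F))

  Σ<-pick : ∀ K {d} x → d < K → Σ< K (λ k → ind (k ≡ᵇ d) * x) ≈ x
  Σ<-pick (suc K) {d} x (s≤s d≤K) with ℕₚ.m≤n⇒m<n∨m≡n d≤K
  ... | inj₁ d<K = trans (+-cong (Σ<-pick K x d<K) (trans (*-congʳ (reflexive (≡.cong ind (≡ᵇ-false (ℕₚ.<⇒≢ d<K ∘ ≡.sym))))) (zeroˡ _)))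
                         (+-identityʳ _)
  ... | inj₂ ≡.refl =
    trans (+-cong (Σ<-zero K λ k k<K → trans (*-congʳ (reflexive (≡.cong ind (≡ᵇ-false (ℕₚ.<⇒≢ k<K))))) (zeroˡ _))
                  (trans (*-congʳ (reflexive (≡.cong ind (≡ᵇ-refl K)))) (*-identityˡ _)))
          (+-identityˡ _)

  -- The indicator leaves a single choice for the first letter of each row, which exists because the
  -- letters of `D` lie within the alphabet. This removes the diagonal boxes and turns full lengths
  -- into off-diagonal ones.
  Rows-heads : ∀ D m F → length D ≡ length m → All (_< size) D →
    Rows size (map suc m) (λ rs → ind (eqL (map head₀ rs) D) * F (map (drop 1) rs)) ≈ Rows size m F
  Rows-heads []      []      F e q        = *-identityˡ _
  Rows-heads (d ∷ D) (k ∷ m) F e (q ∷ qs) = begin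
    Σ< size (λ x → Words size k (λ v → Rows size (map suc m) (λ rs → ind ((x ≡ᵇ d) ∧ eqL (map head₀ rs) D) * F (v ∷ map (drop 1) rs))))
      ≈⟨ Σ<-cong size (λ x _ → trans (Words-cong size k (λ v _ _ → trans
           (Rows-cong size (map suc m) (λ rs _ → trans (*-congʳ (ind-∧ _ _)) (*-assoc _ _ _)))
           (trans (Rows-*ˡ size (map suc m) _ _) (*-congˡ (Rows-heads D m _ (ℕₚ.suc-injective e) qs)))))
           (Words-*ˡ size k _ _)) ⟩
    Σ< size (λ x → ind (x ≡ᵇ d) * Rows size (k ∷ m) F)
      ≈⟨ Σ<-pick size _ q ⟩
    Rows size (k ∷ m) F ∎

  ∑-single : ∀ {A : Set} {xs : List A} {x} (F : A → Carrier) → Unique xs → x ∈ xs → (∀ y → y ≢ x → F y ≈ 0#) → ∑ xs F ≈ F x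
  ∑-single {xs = _ ∷ xs} F (u ∷ us) (here ≡.refl) z =
    trans (+-congˡ (trans (∑-congAll u (λ y x≢y → z y (x≢y ∘ ≡.sym))) (∑-0 xs))) (+-identityʳ _)
  ∑-single F (u ∷ us) (there x∈) z = trans (+-cong (z _ (All.lookup u x∈)) (∑-single F us x∈ z)) (+-identityˡ _)

  wordsWgt : List (List ℕ) → Carrier
  wordsWgt = foldr (λ v r → wordWgt v * r) 1#

  val-good : ∀ {D vs} → Good D vs → val D vs ≈ wordsWgt vs
  val-good []          = refl
  val-good (row l e G) rewrite l | e = *-cong (*-identityˡ _) (val-good G)

  good? : ∀ D vs → Good D vs ⊎ val D vs ≈ 0#
  good? []      []       = inj₁ []
  good? []      (_ ∷ _)  = inj₂ refl
  good? (_ ∷ _) []       = inj₂ refl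
  good? (d ∷ D) (v ∷ vs) with link d v in l | next? v D vs in e | good? D vs
  ... | false | _     | _      = inj₂ (ind*-zero ≡.refl)
  ... | true  | false | _      = inj₂ (ind*-zero ≡.refl)
  ... | true  | true  | inj₁ G = inj₁ (row l e G)
  ... | true  | true  | inj₂ z = inj₂ (trans (*-congˡ z) (zeroʳ _))

  weight-key : ∀ a → weight (key a) ≡ wgtOff R p a
  weight-key a = ≡.cong₂ (λ b q → wgtOff R p (mkL b q)) (≡.trans (≡.cong (unrank n) (half-key a)) (unrank-rank (base a))) (isPrimed-key a)

  wordWgt-keys : ∀ {k} (v : Vec (Letter n) k) → Vec.foldr _ (λ b r → wgtOff R p b * r) 1# v ≈ wordWgt (keys v)
  wordWgt-keys []      = refl
  wordWgt-keys (a ∷ v) = *-cong (reflexive (≡.sym (weight-key a))) (wordWgt-keys v)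

  rowWgt-split : ∀ {k} (v : Vec (Letter n) k) → rowWgt R p v ≈ wgtDiag R p (mkL (headBase v) false) * wordWgt (drop 1 (keys v))
  rowWgt-split []                = sym (*-identityʳ _)
  rowWgt-split (mkL (num k) _ ∷ v) = *-congˡ (wordWgt-keys v)
  rowWgt-split (mkL zer _ ∷ v)     = *-congˡ (wordWgt-keys v)
  rowWgt-split (mkL (bar k) _ ∷ v) = *-congˡ (wordWgt-keys v)

  wgt-split : ∀ {lam : Fin n → ℕ} (P : Filling n lam) m (e : Fin m → Fin n) →
    prodL R (tabulate e) (λ i → rowWgt R p (P i)) ≈
    diagWgt (tabulate (λ i → headBase (P (e i)))) * wordsWgt (tabulate (λ i → drop 1 (keys (P (e i)))))
  wgt-split P zero    e = sym (*-identityʳ _)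
  wgt-split P (suc m) e = trans (*-cong (rowWgt-split (P (e zero))) (wgt-split P m (e ∘ suc)))
    (solve 4 (λ x y z t → (x :* y) :* (z :* t) := (x :* z) :* (y :* t)) refl _ _ _ _)

  term : List (List ℕ) → List (Base n) → Carrier
  term rs D = diagWgt D * (ind (eqL (map head₀ rs) (map diagKey D)) * val (map diagKey D) (map (drop 1) rs))

  allFin-increasing : AllPairs _<ᶠ_ (allFin n)
  allFin-increasing = AllPairsₚ.tabulate⁺-< id

  -- A valid filling matches exactly one listed diagonal, its own. An invalid one contributes
  -- nothing, since a matching diagonal with legal rows would make it valid. In this form the sum
  -- over diagonals can be moved outside the sum over fillings.
  filling-value : ∀ {lam} → StrictPartition n lam → (P : Filling n lam) →
    (if valid P then wgt R p P else 0#) ≈ ∑ (diagonals (allFin n)) (term (tabulate (λ i → keys (P i))))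
  filling-value {lam} strict P with valid P in eq
  ... | true = begin
    wgt R p P
      ≈⟨ wgt-split P n id ⟩
    diagWgt (tabulate heads) * wordsWgt tails
      ≈⟨ *-congˡ (trans (*-identityˡ _) (val-good (≡.subst (λ t → Good t tails) (nice⇒headKeys nice) (nice⇒good nice)))) ⟨
    diagWgt (tabulate heads) * (1# * val (map diagKey (tabulate heads)) tails)
      ≡⟨ ≡.cong₂ (λ b t → diagWgt (tabulate heads) * (ind b * val (map diagKey (tabulate heads)) t)) heads-match tails≡ ⟨
    term rs (tabulate heads)
      ≈⟨ ∑-single (term rs) (diagonals-unique allFin-increasing) (admissible-∈ allFin-increasing (nice⇒admissible nice)) others ⟨
    ∑ (diagonals (allFin n)) (term rs) ∎
    where
    open Validity strict P
    rs = tabulate (λ i → keys (P i))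
    nice = valid⇒nice eq
    tails≡ : map (drop 1) rs ≡ tails
    tails≡ = map-tabulate _ (drop 1)
    headKeys≡ : map head₀ rs ≡ map diagKey (tabulate heads)
    headKeys≡ = ≡.trans (map-tabulate _ head₀) (nice⇒headKeys nice)
    heads-match : eqL (map head₀ rs) (map diagKey (tabulate heads)) ≡ true
    heads-match = ≡.trans (≡.cong (λ t → eqL t (map diagKey (tabulate heads))) headKeys≡) (eqL-refl (map diagKey (tabulate heads)))
    others : ∀ D → D ≢ tabulate heads → term rs D ≈ 0#
    others D D≢ with eqL (map head₀ rs) (map diagKey D) in m
    ... | true  = ⊥-elim (D≢ (map-injective diagKey-injective (≡.trans (≡.sym (eqL⇒≡ _ _ m)) headKeys≡)))
    ... | false = trans (*-congˡ (zeroˡ _)) (zeroʳ _)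
  ... | false = sym (trans (∑-congAll (diagonals-admissible allFin-increasing) none) (∑-0 (diagonals (allFin n))))
    where
    open Validity strict P
    rs = tabulate (λ i → keys (P i))
    none : ∀ D → Admissible (allFin n) D → term rs D ≈ 0#
    none D A with eqL (map head₀ rs) (map diagKey D) in m | good? (map diagKey D) (map (drop 1) rs)
    ... | false | _      = trans (*-congˡ (zeroˡ _)) (zeroʳ _)
    ... | true  | inj₂ z = trans (*-congˡ (trans (*-congˡ z) (zeroʳ _))) (zeroʳ _)
    ... | true  | inj₁ G = contradiction (≡.trans (≡.sym eq) (nice⇒valid (good⇒nice A headKeys≡
                             (≡.subst₂ Good (≡.sym headKeys≡) (map-tabulate _ (drop 1)) G)))) λ ()
      where
      headKeys≡ : headKeys ≡ map diagKey D
      headKeys≡ = ≡.trans (≡.sym (map-tabulate _ head₀)) (eqL⇒≡ _ _ m)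

  diagKey<size : ∀ (b : Base n) → diagKey b < size
  diagKey<size b = s≤s (s≤s (double-mono-≤ (rank≤ b)))

  diagKey-increasing : ∀ {D : List (Base n)} → AllPairs _<ᴿ_ D → AllPairs _<_ (map diagKey D)
  diagKey-increasing i = AllPairsₚ.map⁺ (AllPairs.map (λ r<s → s≤s (ℕₚ.<⇒≤ (double-mono-≤ r<s))) i)

  tableauSum≈detCoeff : ∀ lam → StrictPartition n lam → tableauSum R p lam ≈ detCoeff R p lam
  tableauSum≈detCoeff lam strict = begin
    tableauSum R p lam
      ≈⟨ ∑-cong (allFillings n lam) (filling-value strict) ⟩
    ∑ (allFillings n lam) (λ P → ∑ (diagonals (allFin n)) (term (tabulate (λ i → keys (P i)))))
      ≈⟨ fillings-sum n lam (λ rs → ∑ (diagonals (allFin n)) (term rs)) ⟩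
    Rows size (tabulate lam) (λ rs → ∑ (diagonals (allFin n)) (term rs))
      ≡⟨ ≡.cong (λ t → Rows size t (λ rs → ∑ (diagonals (allFin n)) (term rs))) lam≡ ⟩
    Rows size (map suc (tabulate m)) (λ rs → ∑ (diagonals (allFin n)) (term rs))
      ≈⟨ Rows-∑ size (map suc (tabulate m)) (diagonals (allFin n)) (λ D rs → term rs D) ⟩
    ∑ (diagonals (allFin n)) (λ D → Rows size (map suc (tabulate m)) (λ rs → term rs D))
      ≈⟨ ∑-congAll (diagonals-admissible allFin-increasing) fixed-diagonal ⟩
    ∑ (diagonals (allFin n)) (λ D → diagWgt D * Det size (map diagKey D) (tabulate m))
      ≈⟨ detCoeff-expand lam m suc-m ⟨
    detCoeff R p lam ∎
    where
    m : Fin n → ℕ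
    m = pred ∘ lam
    suc-m : ∀ i → lam i ≡ suc (m i)
    suc-m i = ≡.sym (ℕₚ.suc-pred (lam i) ⦃ ℕ.>-nonZero (proj₂ strict i) ⦄)
    lam≡ : tabulate lam ≡ map suc (tabulate m)
    lam≡ = ≡.trans (tabulate-cong suc-m) (≡.sym (map-tabulate m suc))
    weakly : Linked _≥_ (tabulate m)
    weakly = linked-tabulate n m λ i i' e → ℕₚ.pred-mono-≤ (ℕₚ.<⇒≤ (proj₁ strict i i' (ℕₚ.≤-reflexive (≡.sym e))))
    fixed-diagonal : ∀ D → Admissible (allFin n) D →
      Rows size (map suc (tabulate m)) (λ rs → term rs D) ≈ diagWgt D * Det size (map diagKey D) (tabulate m)
    fixed-diagonal D A = trans (Rows-*ˡ size (map suc (tabulate m)) _ _) (*-congˡ (trans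
      (Rows-heads (map diagKey D) (tabulate m) (val (map diagKey D)) lengths bounded)
      (S≈Det size (map diagKey D) (tabulate m) bounded
         (Allₚ.map⁺ (All.universal (λ b → isPrimed-suc-double (rank b)) D))
         (diagKey-increasing (increasing A)) lengths weakly)))
      where
      bounded : All (_< size) (map diagKey D)
      bounded = Allₚ.map⁺ (All.universal diagKey<size D)
      lengths : length (map diagKey D) ≡ length (tabulate m)
      lengths = ≡.trans (length-map diagKey D) (≡.trans (len A) (≡.trans (length-tabulate id) (≡.sym (length-tabulate m))))

theorem5 : ∀ {c ℓ} (R : CommutativeRing c ℓ) (n : ℕ) (p : Params R n) → Inverses R p →
    (lam : Fin n → ℕ) → StrictPartition n lam →
    CommutativeRing._≈_ R (tableauSum R p lam) (detCoeff R p lam)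
theorem5 R n p _ lam strict = Assembly.tableauSum≈detCoeff R p lam strict
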